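{- Let $(P,A,\lambda)$ be a marked poset with marked elements $A=\{p_1,\ldots,p_k\}$ labeled so that $\lambda(p_1)\ge\cdots\ge\lambda(p_k)$ (and so that $p_i>p_j$ in $P$ implies $i<j$). Let $a_1,\ldots,a_{k-1}\ge 0$ be integers and suppose $a_{j-1}>1$ and $a_j>1$ for some $j$ with $2\le j\le k-1$. Then \[N_{P,A,\lambda}(a_1,\ldots,a_{k-1})^2\ \ge\ N_{P,A,\lambda}(a_1,\ldots,a_{j-2},a_{j-1}+1,a_j-1,a_{j+1},\ldots,a_{k-1})\cdot N_{P,A,\lambda}(a_1,\ldots,a_{j-2},a_{j-1}-1,a_j+1,a_{j+1},\ldots,a_{k-1}).\]
   Context: A marked poset $(P,A,\lambda)$ consists of a finite poset $P$, a subset $A\subseteq P$ (induced order) containing all minimal and maximal elements of $P$, and an order-preserving map $\lambda:A\to\mathbb{R}$. With $n=|P|$, a linear extension of $P$ is an order-reversing bijection $\sigma:[n]\to P$ (i.e. $\sigma(i)<\sigma(j)$ in $P$ implies $i>j$). $N_{P,A,\lambda}(a_1,\ldots,a_{k-1})$ is the number of linear extensions $\sigma$ of $P$ such that $p_1,\ldots,p_k$ occur at positions $1,\,2+a_1,\,\ldots,\,k+a_1+\cdots+a_{k-1}$ respectively. -}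

module Defs where

open import Data.Nat using (ℕ; zero; suc; _+_; _<_)
open import Data.Fin using (Fin; zero; suc; toℕ)
open import Data.Fin.Properties using (all?; any?) renaming (_≟_ to _≟F_)
open import Data.Vec using (Vec; []; _∷_; lookup)
open import Data.List using (List; []; _∷_; map; concatMap; filter; length)
open import Data.List.Base using (allFin)
open import Data.Product using (_×_; ∃; _,_)
open import Relation.Binary.PropositionalEquality using (_≡_; _≢_)
open import Relation.Binary.Structures using (IsPartialOrder)
open import Relation.Binary.Definitions using (Decidable)
open import Relation.Nullary using (¬_; Dec)
open import Relation.Nullary.Decidable using (_×-dec_; _→-dec_; ¬?)
import Data.Nat.Properties as ℕP

record FinPoset (n : ℕ) : Set₁ where
  field
    _≤P_           : Fin n → Fin n → Set
    isPartialOrder : IsPartialOrder _≡_ _≤P_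
    _≤P?_          : Decidable _≤P_

  _<P_ : Fin n → Fin n → Set
  x <P y = x ≤P y × x ≢ y

  _<P?_ : Decidable _<P_
  x <P? y = (x ≤P? y) ×-dec ¬? (x ≟F y)

  IsMinimal : Fin n → Set
  IsMinimal x = ∀ y → y ≤P x → y ≡ x

  IsMaximal : Fin n → Set
  IsMaximal x = ∀ y → x ≤P y → y ≡ x

open FinPoset public

allVecs : (n m : ℕ) → List (Vec (Fin n) m)
allVecs n zero    = [] ∷ []
allVecs n (suc m) = concatMap (λ x → map (x ∷_) (allVecs n m)) (allFin n)

-- A linear extension (paper's convention): an order-REVERSING bijection
-- σ : [n] → P, i.e. σ(i) < σ(j) in P implies i > j.  σ is given as the
-- vector of its values, σ(i) = lookup σ i (positions are 0-based here).
IsLinExt : ∀ {n} → FinPoset n → Vec (Fin n) n → Set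
IsLinExt P σ =
    (∀ i j → lookup σ i ≡ lookup σ j → i ≡ j)
  × (∀ x → ∃ λ i → lookup σ i ≡ x)
  × (∀ i j → _<P_ P (lookup σ i) (lookup σ j) → toℕ j < toℕ i)

isLinExt? : ∀ {n} (P : FinPoset n) (σ : Vec (Fin n) n) → Dec (IsLinExt P σ)
isLinExt? P σ =
      all? (λ i → all? (λ j → (lookup σ i ≟F lookup σ j) →-dec (i ≟F j)))
  ×-dec all? (λ x → any? (λ i → lookup σ i ≟F x))
  ×-dec all? (λ i → all? (λ j → _<P?_ P (lookup σ i) (lookup σ j) →-dec (toℕ j ℕP.<? toℕ i)))

-- 0-based position of the marked element p_{t+1} (t : Fin (m+1)) prescribed by
-- gaps a_1..a_m (a t' = a_{t'+1}):  pos t = t + a_1 + ... + a_t.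
-- (Paper, 1-based: p_{i} at position i + a_1 + ... + a_{i-1}.)
pos : ∀ {m} → (Fin m → ℕ) → Fin (suc m) → ℕ
pos a zero = zero
pos {suc m} a (suc t) = suc (a zero + pos (λ l → a (suc l)) t)

Places : ∀ {n m} → (Fin (suc m) → Fin n) → (Fin m → ℕ) → Vec (Fin n) n → Set
Places p a σ = ∀ t → ∃ λ (i : Fin _) → toℕ i ≡ pos a t × lookup σ i ≡ p t

places? : ∀ {n m} (p : Fin (suc m) → Fin n) (a : Fin m → ℕ) (σ : Vec (Fin n) n)
        → Dec (Places p a σ)
places? p a σ = all? (λ t → any? (λ i → (toℕ i ℕP.≟ pos a t) ×-dec (lookup σ i ≟F p t)))

-- N_{P,A,λ}(a_1,...,a_{k-1}) with k = m+1 and A = {p_1,...,p_k} = image of p.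
N : ∀ {n m} → FinPoset n → (Fin (suc m) → Fin n) → (Fin m → ℕ) → ℕ
N {n} P p a =
  length (filter (λ σ → isLinExt? P σ ×-dec places? p a σ) (allVecs n n))

shift : ∀ {m} → (Fin m → ℕ) → (u d : Fin m) → Fin m → ℕ
shift a u d x with x ≟F u
... | Relation.Nullary.yes _ = suc (a x)
... | Relation.Nullary.no _ with x ≟F d
...   | Relation.Nullary.yes _ = a x Data.Nat.∸ 1
...   | Relation.Nullary.no _ = a x

{-# OPTIONS --safe #-}

-- Read a linear extension as a word, letter by letter. For a prefix σ let g(σ) be
-- the number of ways to complete it when some of the remaining positions are
-- prescribed; g arises from the indicator of the complete words by summing over the
-- next letter (a free position) and by forcing it (a marked position). Attach to σ
-- the form with entries g(σef) for available letters e, f, where a word ef in which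
-- f only becomes available after e counts towards the diagonal entry of e. This form
-- has at most one positive eigenvalue. For a marked position this is inherited
-- directly. For a free position it is the local-to-global principle behind the
-- Alexandrov-Fenchel inequality (Shenfeld-van Handel, Chan-Pak): the forms at the
-- prefixes σe give N² ≥ N for a stochastic matrix N, so no eigenvalue lies in (0, 1),
-- and an exchange property of the supports shows that the eigenvalue 1 is simple.
-- Two formal letters, standing for one more position in the gap before and in the
-- gap after the moved mark, are adjoined to the alphabet with small positive weights.
-- The form restricted to them is a 2 × 2 matrix whose determinant is nonpositive,
-- which is the asserted inequality in the limit of vanishing weights.

module Submission where

-- All scalars are integers, so eigenvalues are never formed. That a form has at most one positive
-- eigenvalue is expressed by a linear functional on whose kernel the form is nonpositive, and
-- division by row sums becomes multiplication by a common multiple. The spectral gap is obtained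
-- without diagonalisation: connectedness gives a Poincaré inequality, hence some bound below 1 on
-- the complement of the constants, and N² ≥ N turns each such bound into a better one, with limit
-- 0.
--
-- Connectedness is the delicate point and the reason why the exchange property accompanies the form
-- through every construction. It also forces all weights to be strictly positive: a zero weight
-- would break the passage from a positive value of g to a positive sum over the next letter. The
-- weights of the formal letters are therefore removed only at the end, by comparing leading
-- coefficients in a large parameter T.
--
-- A formal letter needs no new spectral argument. Summing over a free position is pairing with the
-- weight vector h, so the letter acts in the form as a copy of h.

module LinearExtensionForms where

  import Data.Integer.Properties as ℤₚ
  open import Algebra.Properties.Semiring.Sum ℤₚ.+-*-semiring
    using (sum; sum-cong-≗; ∑-distrib-+; ∑-comm; *-distribˡ-sum)
  open import Data.Bool.Base using (Bool; true; false)
  import Data.Bool.Properties as Boolₚ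
  open import Data.Empty using (⊥; ⊥-elim)
  open import Data.Fin.Base using (Fin; zero; suc; toℕ; fromℕ)
  import Data.Fin.Properties as Finₚ
  open import Data.Integer.Base
    using (ℤ; +_; -[1+_]; 0ℤ; 1ℤ; -_; _+_; _-_; _*_; _^_; _≤_; _<_; +≤+; +<+; ∣_∣; positive; nonNegative)
  open import Data.Integer.Tactic.RingSolver using (solve-∀)
  open import Data.List.Base as List using (List; []; _∷_; _++_; replicate)
  import Data.List.Properties as Listₚ
  open import Data.Maybe.Base using (Maybe; just; nothing)
  open import Data.Nat.Base as ℕ using (ℕ; zero; suc)
  import Data.Nat.Properties as ℕₚ
  open import Data.Product using (∃; ∃₂; _×_; _,_; proj₁; proj₂)
  open import Data.Sum.Base using (_⊎_; inj₁; inj₂)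
  open import Data.Unit.Base using (⊤; tt)
  open import Data.Vec.Base as Vec using (Vec; []; _∷_; lookup; updateAt)
  import Data.Vec.Properties as Vecₚ
  open import Function.Base using (_∘_; case_of_)
  open import Relation.Binary.PropositionalEquality
  open import Relation.Nullary using (¬_; Dec; yes; no; contradiction)
  open import Relation.Nullary.Decidable using (map′; _⊎-dec_; _×-dec_; _→-dec_; ¬?)

  -- Sums of integers

  0≤+ : ∀ {a b} → 0ℤ ≤ a → 0ℤ ≤ b → 0ℤ ≤ a + b
  0≤+ = ℤₚ.+-mono-≤

  0≤* : ∀ {a b} → 0ℤ ≤ a → 0ℤ ≤ b → 0ℤ ≤ a * b
  0≤* {+ a} {+ b} _ _ = subst (0ℤ ≤_) (ℤₚ.pos-* a b) (+≤+ ℕ.z≤n)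

  0<* : ∀ {a b} → 0ℤ < a → 0ℤ < b → 0ℤ < a * b
  0<* {a} {b} p q = subst (_< a * b) (ℤₚ.*-zeroʳ a) (ℤₚ.*-monoˡ-<-pos a {{positive p}} q)

  0≤sq : ∀ a → 0ℤ ≤ a * a
  0≤sq (+ n) = 0≤* {+ n} {+ n} (+≤+ ℕ.z≤n) (+≤+ ℕ.z≤n)
  0≤sq -[1+ n ] = +≤+ ℕ.z≤n

  *-monoˡ : ∀ {a b c} → 0ℤ ≤ c → a ≤ b → c * a ≤ c * b
  *-monoˡ {c = c} p q = ℤₚ.*-monoˡ-≤-nonNeg c {{nonNegative p}} q

  diff : ∀ {a b c} → b - a ≡ c → 0ℤ ≤ c → a ≤ b
  diff e p = ℤₚ.0≤i-j⇒j≤i (subst (0ℤ ≤_) (sym e) p)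

  0≤diff : ∀ {a b} → a ≤ b → 0ℤ ≤ b - a
  0≤diff = ℤₚ.i≤j⇒0≤j-i

  *-cancel : ∀ {c a b} → 0ℤ < c → c * a ≤ c * b → a ≤ b
  *-cancel {c} {a} {b} p = ℤₚ.*-cancelˡ-≤-pos a b c {{positive p}}

  0≤-cancel : ∀ {c a} → 0ℤ < c → 0ℤ ≤ c * a → 0ℤ ≤ a
  0≤-cancel {c} {a} p q = *-cancel p (subst (_≤ c * a) (sym (ℤₚ.*-zeroʳ c)) q)

  ≡0⊎> : ∀ {a} → 0ℤ ≤ a → a ≡ 0ℤ ⊎ 0ℤ < a
  ≡0⊎> {+ zero} _ = inj₁ refl
  ≡0⊎> {+ suc n} _ = inj₂ (+<+ (ℕ.s≤s ℕ.z≤n))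

  ≤∧≥0 : ∀ {a} → 0ℤ ≤ a → a ≤ 0ℤ → a ≡ 0ℤ
  ≤∧≥0 p q = ℤₚ.≤-antisym q p

  +≡0ˡ : ∀ {a b} → 0ℤ ≤ a → 0ℤ ≤ b → a + b ≡ 0ℤ → a ≡ 0ℤ
  +≡0ˡ {a} {b} p q e = ≤∧≥0 p (subst (a ≤_) e (subst (_≤ a + b) (ℤₚ.+-identityʳ a) (ℤₚ.+-monoʳ-≤ a q)))

  +≡0ʳ : ∀ {a b} → 0ℤ ≤ a → 0ℤ ≤ b → a + b ≡ 0ℤ → b ≡ 0ℤ
  +≡0ʳ {a} {b} p q e = +≡0ˡ q p (trans (ℤₚ.+-comm b a) e)

  *≡0 : ∀ {c a} → 0ℤ < c → c * a ≡ 0ℤ → a ≡ 0ℤ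
  *≡0 {c} {a} p e with ℤₚ.i*j≡0⇒i≡0∨j≡0 c e
  ... | inj₁ refl = contradiction p (ℤₚ.<-irrefl refl)
  ... | inj₂ q = q

  ∑-zero : ∀ {N} {f : Fin N → ℤ} → (∀ i → f i ≡ 0ℤ) → sum f ≡ 0ℤ
  ∑-zero {zero} _ = refl
  ∑-zero {suc N} p = cong₂ _+_ (p zero) (∑-zero (p ∘ suc))

  ∑-≥0 : ∀ {N} {f : Fin N → ℤ} → (∀ i → 0ℤ ≤ f i) → 0ℤ ≤ sum f
  ∑-≥0 {zero} _ = ℤₚ.≤-refl
  ∑-≥0 {suc N} p = 0≤+ (p zero) (∑-≥0 (p ∘ suc))

  ∑-mono : ∀ {N} {f g : Fin N → ℤ} → (∀ i → f i ≤ g i) → sum f ≤ sum g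
  ∑-mono {zero} _ = ℤₚ.≤-refl
  ∑-mono {suc N} p = ℤₚ.+-mono-≤ (p zero) (∑-mono (p ∘ suc))

  ∑≡0⇒ : ∀ {N} {f : Fin N → ℤ} → (∀ i → 0ℤ ≤ f i) → sum f ≡ 0ℤ → ∀ i → f i ≡ 0ℤ
  ∑≡0⇒ {suc N} p e zero = +≡0ˡ (p zero) (∑-≥0 (p ∘ suc)) e
  ∑≡0⇒ {suc N} p e (suc i) = ∑≡0⇒ (p ∘ suc) (+≡0ʳ (p zero) (∑-≥0 (p ∘ suc)) e) i

  ∑-term : ∀ {N} {f : Fin N → ℤ} → (∀ i → 0ℤ ≤ f i) → ∀ i → f i ≤ sum f
  ∑-term {suc N} {f} p zero = subst (_≤ sum f) (ℤₚ.+-identityʳ (f zero)) (ℤₚ.+-monoʳ-≤ (f zero) (∑-≥0 (p ∘ suc)))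
  ∑-term {suc N} {f} p (suc i) = subst (_≤ sum f) (ℤₚ.+-identityˡ (f (suc i))) (ℤₚ.+-mono-≤ (p zero) (∑-term (p ∘ suc) i))

  ∑>0⇒ : ∀ {N} {f : Fin N → ℤ} → (∀ i → 0ℤ ≤ f i) → 0ℤ < sum f → ∃ λ i → 0ℤ < f i
  ∑>0⇒ {zero} _ (+<+ ())
  ∑>0⇒ {suc N} {f} p q with ≡0⊎> (p zero)
  ... | inj₂ r = zero , r
  ... | inj₁ e with ∑>0⇒ (p ∘ suc) (subst (0ℤ <_) (trans (cong (_+ sum (f ∘ suc)) e) (ℤₚ.+-identityˡ (sum (f ∘ suc)))) q)
  ...   | i , r = suc i , r

  ∑-* : ∀ {N} c (f : Fin N → ℤ) → sum (λ i → c * f i) ≡ c * sum f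
  ∑-* c f = sym (*-distribˡ-sum c f)

  ∑-lin : ∀ {N} a b c (f g h : Fin N → ℤ) →
    sum (λ i → a * f i + b * g i + c * h i) ≡ a * sum f + b * sum g + c * sum h
  ∑-lin a b c f g h = trans (∑-distrib-+ (λ i → a * f i + b * g i) (λ i → c * h i))
    (cong₂ _+_ (trans (∑-distrib-+ (λ i → a * f i) (λ i → b * g i)) (cong₂ _+_ (∑-* a f) (∑-* b g))) (∑-* c h))

  ∑-lin₂ : ∀ {N} a b (f g : Fin N → ℤ) →
    sum (λ i → a * f i + b * g i) ≡ a * sum f + b * sum g
  ∑-lin₂ a b f g = trans (∑-distrib-+ (λ i → a * f i) (λ i → b * g i)) (cong₂ _+_ (∑-* a f) (∑-* b g))

  ∑∑-lin : ∀ {N M} a b c (f g h : Fin N → Fin M → ℤ) →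
    sum (λ i → sum (λ j → a * f i j + b * g i j + c * h i j))
      ≡ a * sum (λ i → sum (f i)) + b * sum (λ i → sum (g i)) + c * sum (λ i → sum (h i))
  ∑∑-lin a b c f g h = trans (sum-cong-≗ (λ i → ∑-lin a b c (f i) (g i) (h i)))
    (∑-lin a b c (sum ∘ f) (sum ∘ g) (sum ∘ h))

  -- Clears denominators: `k e` stands for μ/d(e) wherever d(e) is nonzero.
  commonMultiple : ∀ {N} (d : Fin N → ℤ) → (∀ e → 0ℤ ≤ d e) →
    ∃₂ λ (μ : ℤ) (k : Fin N → ℤ) → 0ℤ < μ × (∀ e → 0ℤ ≤ k e) × (∀ e → d e ≡ 0ℤ ⊎ k e * d e ≡ μ)
  commonMultiple {zero} d p = 1ℤ , (λ ()) , +<+ (ℕ.s≤s ℕ.z≤n) , (λ ()) , (λ ())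
  commonMultiple {suc N} d p with commonMultiple (d ∘ suc) (p ∘ suc) | ≡0⊎> (p zero)
  ... | μ , k , μ>0 , k≥0 , q | inj₁ e = μ , k′ , μ>0 , k′≥0 , q′
    where
    k′ : Fin (suc N) → ℤ
    k′ zero = 0ℤ
    k′ (suc i) = k i
    k′≥0 : ∀ e → 0ℤ ≤ k′ e
    k′≥0 zero = ℤₚ.≤-refl
    k′≥0 (suc i) = k≥0 i
    q′ : ∀ e → d e ≡ 0ℤ ⊎ k′ e * d e ≡ μ
    q′ zero = inj₁ e
    q′ (suc i) = q i
  ... | μ , k , μ>0 , k≥0 , q | inj₂ r = d zero * μ , k′ , 0<* r μ>0 , k′≥0 , q′
    where
    k′ : Fin (suc N) → ℤ
    k′ zero = μ
    k′ (suc i) = d zero * k i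
    k′≥0 : ∀ e → 0ℤ ≤ k′ e
    k′≥0 zero = ℤₚ.<⇒≤ μ>0
    k′≥0 (suc i) = 0≤* (p zero) (k≥0 i)
    q′ : ∀ e → d e ≡ 0ℤ ⊎ k′ e * d e ≡ d zero * μ
    q′ zero = inj₂ (ℤₚ.*-comm μ (d zero))
    q′ (suc i) with q i
    ... | inj₁ e = inj₁ e
    ... | inj₂ e = inj₂ (trans (ℤₚ.*-assoc (d zero) (k i) (d (suc i))) (cong (d zero *_) e))

  -- Spectral gap of a reversible Markov operator

  module Form {N} (A : Fin N → Fin N → ℤ) (δ : Fin N → ℤ) where

    app : (Fin N → ℤ) → Fin N → ℤ
    app v e = sum (λ f → A e f * v f) + δ e * v e

    form : (Fin N → ℤ) → (Fin N → ℤ) → ℤ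
    form u v = sum (λ e → u e * app v e)

    app-lin : ∀ s t u w e → app (λ f → s * u f + t * w f) e ≡ s * app u e + t * app w e
    app-lin s t u w e = trans (cong (_+ δ e * (s * u e + t * w e))
        (trans (sum-cong-≗ (λ f → r₁ (A e f) s (u f) t (w f)))
               (∑-lin₂ s t (λ f → A e f * u f) (λ f → A e f * w f))))
        (r₂ s (sum (λ f → A e f * u f)) t (sum (λ f → A e f * w f)) (δ e) (u e) (w e))
      where
      r₁ : ∀ a s x t y → a * (s * x + t * y) ≡ s * (a * x) + t * (a * y)
      r₁ = solve-∀
      r₂ : ∀ s X t Y d x y → s * X + t * Y + d * (s * x + t * y) ≡ s * (X + d * x) + t * (Y + d * y)
      r₂ = solve-∀

    form-linʳ : ∀ s t x u w → form x (λ f → s * u f + t * w f) ≡ s * form x u + t * form x w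
    form-linʳ s t x u w = trans (sum-cong-≗ (λ e → trans (cong (x e *_) (app-lin s t u w e))
        (r (x e) s (app u e) t (app w e)))) (∑-lin₂ s t (λ e → x e * app u e) (λ e → x e * app w e))
      where
      r : ∀ a s x t y → a * (s * x + t * y) ≡ s * (a * x) + t * (a * y)
      r = solve-∀

    form-linˡ : ∀ s t x u w → form (λ f → s * u f + t * w f) x ≡ s * form u x + t * form w x
    form-linˡ s t x u w = trans (sum-cong-≗ (λ e → r s (u e) t (w e) (app x e)))
        (∑-lin₂ s t (λ e → u e * app x e) (λ e → w e * app x e))
      where
      r : ∀ s x t y a → (s * x + t * y) * a ≡ s * (x * a) + t * (y * a)
      r = solve-∀

    cross : (Fin N → ℤ) → (Fin N → ℤ) → ℤ
    cross u v = sum (λ e → sum (λ f → u e * (A e f * v f)))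

    form-split : ∀ u v → form u v ≡ cross u v + sum (λ e → δ e * (u e * v e))
    form-split u v = trans (sum-cong-≗ (λ e → trans (r (u e) (sum (λ f → A e f * v f)) (δ e) (v e))
          (cong (_+ δ e * (u e * v e)) (sym (∑-* (u e) (λ f → A e f * v f))))))
        (∑-distrib-+ (λ e → sum (λ f → u e * (A e f * v f))) (λ e → δ e * (u e * v e)))
      where
      r : ∀ u S d v → u * (S + d * v) ≡ u * S + d * (u * v)
      r = solve-∀

    module _ (A-sym : ∀ e f → A e f ≡ A f e) where

      form-sym : ∀ u v → form u v ≡ form v u
      form-sym u v = trans (form-split u v) (trans (cong₂ _+_
          (trans (∑-comm (λ e f → u e * (A e f * v f))) (sum-cong-≗ λ f → sum-cong-≗ λ e →
            trans (cong (λ a → u e * (a * v f)) (A-sym e f)) (r (u e) (A f e) (v f))))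
          (sum-cong-≗ λ e → cong (δ e *_) (ℤₚ.*-comm (u e) (v e)))) (sym (form-split v u)))
        where
        r : ∀ u a v → u * (a * v) ≡ v * (a * u)
        r = solve-∀

      form-quad : ∀ s t u w → form (λ f → s * u f + t * w f) (λ f → s * u f + t * w f)
        ≡ s * s * form u u + + 2 * (s * t) * form u w + t * t * form w w
      form-quad s t u w = trans (form-linˡ s t (λ f → s * u f + t * w f) u w)
        (trans (cong₂ (λ p q → s * p + t * q) (form-linʳ s t u u w)
          (trans (form-linʳ s t w u w) (cong (λ p → s * p + t * form w w) (form-sym w u))))
        (r s t (form u u) (form u w) (form w w)))
        where
        r : ∀ s t a b c → s * (s * a + t * b) + t * (s * b + t * c) ≡ s * s * a + + 2 * (s * t) * b + t * t * c
        r = solve-∀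

  module Markov {N} (A : Fin N → Fin N → ℤ) (δ : Fin N → ℤ)
    (A-sym : ∀ e f → A e f ≡ A f e) (A≥0 : ∀ e f → 0ℤ ≤ A e f) (δ≥0 : ∀ e → 0ℤ ≤ δ e) where

    open Form A δ public

    V : Set
    V = Fin N → ℤ

    d : V
    d e = sum (A e) + δ e

    d≥0 : ∀ e → 0ℤ ≤ d e
    d≥0 e = 0≤+ (∑-≥0 (A≥0 e)) (δ≥0 e)

    dot : V → V → ℤ
    dot u v = sum (λ e → d e * (u e * v e))

    tot : V → ℤ
    tot v = sum (λ e → d e * v e)

    dot-quad : ∀ s t u w → dot (λ f → s * u f + t * w f) (λ f → s * u f + t * w f)
      ≡ s * s * dot u u + + 2 * (s * t) * dot u w + t * t * dot w w
    dot-quad s t u w = trans (sum-cong-≗ (λ e → r (d e) s t (u e) (w e)))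
        (∑-lin (s * s) (+ 2 * (s * t)) (t * t)
          (λ e → d e * (u e * u e)) (λ e → d e * (u e * w e)) (λ e → d e * (w e * w e)))
      where
      r : ∀ d s t u w → d * ((s * u + t * w) * (s * u + t * w))
        ≡ s * s * (d * (u * u)) + + 2 * (s * t) * (d * (u * w)) + t * t * (d * (w * w))
      r = solve-∀

    row-sq : V → ℤ
    row-sq v = sum (λ e → sum (λ f → A e f * (v e * v e)))

    dot-split : ∀ v → dot v v ≡ row-sq v + sum (λ e → δ e * (v e * v e))
    dot-split v = trans (sum-cong-≗ (λ e → trans (r (sum (A e)) (δ e) (v e))
          (cong (_+ δ e * (v e * v e)) (trans (sym (∑-* (v e * v e) (A e)))
            (sum-cong-≗ λ f → ℤₚ.*-comm (v e * v e) (A e f))))))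
        (∑-distrib-+ (λ e → sum (λ f → A e f * (v e * v e))) (λ e → δ e * (v e * v e)))
      where
      r : ∀ S d v → (S + d) * (v * v) ≡ v * v * S + d * (v * v)
      r = solve-∀

    col-sq : ∀ v → sum (λ e → sum (λ f → A e f * (v f * v f))) ≡ row-sq v
    col-sq v = trans (∑-comm (λ e f → A e f * (v f * v f)))
      (sum-cong-≗ λ f → sum-cong-≗ λ e → cong (_* (v f * v f)) (A-sym e f))

    -- The Dirichlet form of the reversible chain with edge weights `A`; the loops `δ` do not
    -- contribute to it.
    energy : V → ℤ
    energy v = sum (λ e → sum (λ f → A e f * ((v e - v f) * (v e - v f))))

    energy≥0 : ∀ v → 0ℤ ≤ energy v
    energy≥0 v = ∑-≥0 λ e → ∑-≥0 λ f → 0≤* (A≥0 e f) (0≤sq (v e - v f))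

    energy-form : ∀ v → energy v ≡ + 2 * (dot v v - form v v)
    energy-form v = begin
        energy v
          ≡⟨ sum-cong-≗ (λ e → sum-cong-≗ λ f → r₁ (A e f) (v e) (v f)) ⟩
        sum (λ e → sum (λ f → 1ℤ * (A e f * (v e * v e)) + - + 2 * (v e * (A e f * v f)) + 1ℤ * (A e f * (v f * v f))))
          ≡⟨ ∑∑-lin 1ℤ (- + 2) 1ℤ (λ e f → A e f * (v e * v e)) (λ e f → v e * (A e f * v f)) (λ e f → A e f * (v f * v f)) ⟩
        1ℤ * row-sq v + - + 2 * cross v v + 1ℤ * sum (λ e → sum (λ f → A e f * (v f * v f)))
          ≡⟨ cong (λ x → 1ℤ * row-sq v + - + 2 * cross v v + 1ℤ * x) (col-sq v) ⟩
        1ℤ * row-sq v + - + 2 * cross v v + 1ℤ * row-sq v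
          ≡⟨ r₂ (row-sq v) (cross v v) D ⟩
        + 2 * (row-sq v + D - (cross v v + D))
          ≡⟨ sym (cong₂ (λ x y → + 2 * (x - y)) (dot-split v) (form-split v v)) ⟩
        + 2 * (dot v v - form v v) ∎
      where
      open ≡-Reasoning
      D : ℤ
      D = sum (λ e → δ e * (v e * v e))
      r₁ : ∀ a x y → a * ((x - y) * (x - y)) ≡ 1ℤ * (a * (x * x)) + - + 2 * (x * (a * y)) + 1ℤ * (a * (y * y))
      r₁ = solve-∀
      r₂ : ∀ R C D → 1ℤ * R + - + 2 * C + 1ℤ * R ≡ + 2 * (R + D - (C + D))
      r₂ = solve-∀

    -- Twice the right side is a sum of terms A(e,f)(v(e) + v(f))² and 4δ(e)v(e)². Thus the
    -- normalised operator has no spectrum below -1.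
    dot+form≥0 : ∀ v → 0ℤ ≤ dot v v + form v v
    dot+form≥0 v = 0≤-cancel {+ 2} (+<+ (ℕ.s≤s ℕ.z≤n)) (subst (0ℤ ≤_) eq
        (0≤+ (∑-≥0 λ e → ∑-≥0 λ f → 0≤* (A≥0 e f) (0≤sq (v e + v f)))
             (0≤* {+ 4} (+≤+ ℕ.z≤n) (∑-≥0 λ e → 0≤* (δ≥0 e) (0≤sq (v e))))))
      where
      open ≡-Reasoning
      D : ℤ
      D = sum (λ e → δ e * (v e * v e))
      r₁ : ∀ a x y → a * ((x + y) * (x + y)) ≡ 1ℤ * (a * (x * x)) + + 2 * (x * (a * y)) + 1ℤ * (a * (y * y))
      r₁ = solve-∀
      r₂ : ∀ R C D → 1ℤ * R + + 2 * C + 1ℤ * R + + 4 * D ≡ + 2 * (R + D + (C + D))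
      r₂ = solve-∀
      eq : sum (λ e → sum (λ f → A e f * ((v e + v f) * (v e + v f)))) + + 4 * D ≡ + 2 * (dot v v + form v v)
      eq = begin
        sum (λ e → sum (λ f → A e f * ((v e + v f) * (v e + v f)))) + + 4 * D
          ≡⟨ cong (_+ + 4 * D) (sum-cong-≗ (λ e → sum-cong-≗ λ f → r₁ (A e f) (v e) (v f))) ⟩
        sum (λ e → sum (λ f → 1ℤ * (A e f * (v e * v e)) + + 2 * (v e * (A e f * v f)) + 1ℤ * (A e f * (v f * v f)))) + + 4 * D
          ≡⟨ cong (_+ + 4 * D) (∑∑-lin 1ℤ (+ 2) 1ℤ (λ e f → A e f * (v e * v e)) (λ e f → v e * (A e f * v f)) (λ e f → A e f * (v f * v f))) ⟩
        1ℤ * row-sq v + + 2 * cross v v + 1ℤ * sum (λ e → sum (λ f → A e f * (v f * v f))) + + 4 * D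
          ≡⟨ cong (λ x → 1ℤ * row-sq v + + 2 * cross v v + 1ℤ * x + + 4 * D) (col-sq v) ⟩
        1ℤ * row-sq v + + 2 * cross v v + 1ℤ * row-sq v + + 4 * D
          ≡⟨ r₂ (row-sq v) (cross v v) D ⟩
        + 2 * (row-sq v + D + (cross v v + D))
          ≡⟨ sym (cong₂ (λ x y → + 2 * (x + y)) (dot-split v) (form-split v v)) ⟩
        + 2 * (dot v v + form v v) ∎

    form≤dot : ∀ v → form v v ≤ dot v v
    form≤dot v = ℤₚ.0≤i-j⇒j≤i (0≤-cancel {+ 2} (+<+ (ℕ.s≤s ℕ.z≤n)) (subst (0ℤ ≤_) (energy-form v) (energy≥0 v)))

    -- Finite effective resistance between e and f: being in one component, in the quantitative form
    -- that the Poincaré inequality uses.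
    Linked : Fin N → Fin N → Set
    Linked e f = ∃ λ C → 0ℤ ≤ C × (∀ v → (v e - v f) * (v e - v f) ≤ C * energy v)

    linked-refl : ∀ e → Linked e e
    linked-refl e = 0ℤ , ℤₚ.≤-refl , λ v → ℤₚ.≤-reflexive (r (v e) (energy v))
      where
      r : ∀ x E → (x - x) * (x - x) ≡ 0ℤ * E
      r = solve-∀

    -- A positive integer weight is at least 1, so a single term of the energy already dominates the
    -- square.
    linked-edge : ∀ e f → 0ℤ < A e f → Linked e f
    linked-edge e f p = 1ℤ , +≤+ ℕ.z≤n , λ v → subst ((v e - v f) * (v e - v f) ≤_) (sym (ℤₚ.*-identityˡ (energy v)))
      (ℤₚ.≤-trans (subst (_≤ A e f * ((v e - v f) * (v e - v f))) (ℤₚ.*-identityˡ _)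
          (ℤₚ.*-monoʳ-≤-nonNeg ((v e - v f) * (v e - v f)) {{nonNegative (0≤sq (v e - v f))}} (ℤₚ.i<j⇒suc[i]≤j p)))
       (ℤₚ.≤-trans (∑-term (λ f → 0≤* (A≥0 e f) (0≤sq (v e - v f))) f)
          (∑-term (λ e → ∑-≥0 λ f → 0≤* (A≥0 e f) (0≤sq (v e - v f))) e)))

    linked-trans : ∀ {e f g} → Linked e f → Linked f g → Linked e g
    linked-trans {e} {f} {g} (C , C≥0 , p) (D , D≥0 , q) = + 2 * (C + D) , 0≤* {+ 2} (+≤+ ℕ.z≤n) (0≤+ C≥0 D≥0) , λ v →
      diff (r (v e) (v f) (v g) C D (energy v))
        (0≤+ (0≤+ (0≤* {+ 2} (+≤+ ℕ.z≤n) (0≤diff (p v))) (0≤* {+ 2} (+≤+ ℕ.z≤n) (0≤diff (q v)))) (0≤sq (v e - v f - (v f - v g))))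
      where
      r : ∀ x y z C D E → + 2 * (C + D) * E - (x - z) * (x - z)
        ≡ + 2 * (C * E - (x - y) * (x - y)) + + 2 * (D * E - (y - z) * (y - z)) + (x - y - (y - z)) * (x - y - (y - z))
      r = solve-∀

    -- Let N be the operator that divides each entry of `app` by the row sum. Then `key` is μ times
    -- the inequality ⟨v, Nv⟩ ≤ ⟨Nv, Nv⟩ for the inner product `dot`, that is, N² ≥ N.
    module Gap
      (linked : ∀ e f → 0ℤ < d e → 0ℤ < d f → Linked e f)
      (key : ∀ (μ : ℤ) (k : V) → 0ℤ < μ → (∀ e → 0ℤ ≤ k e) → (∀ e → d e ≡ 0ℤ ⊎ k e * d e ≡ μ) →
             ∀ v → μ * form v v ≤ sum (λ e → k e * (app v e * app v e))) where

      private
        cm = commonMultiple d d≥0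
        μ = proj₁ cm
        k = proj₁ (proj₂ cm)
        μ>0 : 0ℤ < μ
        μ>0 = proj₁ (proj₂ (proj₂ cm))
        kd : ∀ e → d e ≡ 0ℤ ⊎ k e * d e ≡ μ
        kd = proj₂ (proj₂ (proj₂ (proj₂ cm)))
        μ≥0 : 0ℤ ≤ μ
        μ≥0 = ℤₚ.<⇒≤ μ>0

      app-isolated : ∀ v e → d e ≡ 0ℤ → app v e ≡ 0ℤ
      app-isolated v e p = cong₂ _+_
        (∑-zero λ f → cong (_* v f) (∑≡0⇒ (A≥0 e) (+≡0ˡ (∑-≥0 (A≥0 e)) (δ≥0 e) p) f))
        (cong (_* v e) (+≡0ʳ (∑-≥0 (A≥0 e)) (δ≥0 e) p))

      -- The operator μN. Rows of sum zero do no harm, since `app` vanishes there.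
      step : V → V
      step v e = k e * app v e

      d-step : ∀ v e → d e * step v e ≡ μ * app v e
      d-step v e with kd e
      ... | inj₁ p = trans (cong (λ x → d e * (k e * x)) (app-isolated v e p))
                     (trans (r (d e) (k e) μ) (cong (μ *_) (sym (app-isolated v e p))))
        where
        r : ∀ d k m → d * (k * 0ℤ) ≡ m * 0ℤ
        r = solve-∀
      ... | inj₂ p = trans (r (d e) (k e) (app v e)) (cong (_* app v e) p)
        where
        r : ∀ d k a → d * (k * a) ≡ k * d * a
        r = solve-∀

      dot-step : ∀ u v → dot u (step v) ≡ μ * form u v
      dot-step u v = trans (sum-cong-≗ λ e → trans (r₁ (d e) (u e) (step v e))
          (trans (cong (u e *_) (d-step v e)) (r₂ (u e) μ (app v e)))) (∑-* μ (λ e → u e * app v e))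
        where
        r₁ : ∀ d u s → d * (u * s) ≡ u * (d * s)
        r₁ = solve-∀
        r₂ : ∀ u m a → u * (m * a) ≡ m * (u * a)
        r₂ = solve-∀

      form-step : ∀ v → μ * form v (step v) ≡ dot (step v) (step v)
      form-step v = trans (cong (μ *_) (form-sym A-sym v (step v))) (sym (dot-step (step v) v))

      dot-step² : ∀ v → μ * (μ * form v v) ≤ dot (step v) (step v)
      dot-step² v = subst (μ * (μ * form v v) ≤_) (sym eq)
          (*-monoˡ μ≥0 (key μ k μ>0 (proj₁ (proj₂ (proj₂ (proj₂ cm)))) kd v))
        where
        eq : dot (step v) (step v) ≡ μ * sum (λ e → k e * (app v e * app v e))
        eq = trans (dot-step (step v) v) (cong (μ *_) (sum-cong-≗ λ e → ℤₚ.*-assoc (k e) (app v e) (app v e)))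

      one : V
      one _ = 1ℤ

      app-one : ∀ e → app one e ≡ d e
      app-one e = cong₂ _+_ (sum-cong-≗ λ f → ℤₚ.*-identityʳ (A e f)) (ℤₚ.*-identityʳ (δ e))

      tot-step : ∀ v → tot (step v) ≡ μ * tot v
      tot-step v = begin
        tot (step v) ≡⟨ sum-cong-≗ (λ e → trans (d-step v e) (cong (μ *_) (sym (ℤₚ.*-identityˡ (app v e))))) ⟩
        sum (λ e → μ * (1ℤ * app v e)) ≡⟨ ∑-* μ (λ e → 1ℤ * app v e) ⟩
        μ * form one v ≡⟨ cong (μ *_) (form-sym A-sym one v) ⟩
        μ * form v one ≡⟨ cong (μ *_) (sum-cong-≗ λ e → trans (cong (v e *_) (app-one e)) (ℤₚ.*-comm (v e) (d e))) ⟩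
        μ * tot v ∎
        where open ≡-Reasoning

      -- For x ≥ 0 and y > 0 this is N ≤ y/(x + y) on the complement of the constants.
      Bound : ℤ → ℤ → Set
      Bound x y = ∀ v → tot v ≡ 0ℤ → x * form v v ≤ y * (dot v v - form v v)

      -- With spectrum in [-1, 1] and N² ≥ N, the estimate N ≤ ν on the complement
      -- of 1 improves itself to 2 N ≤ ν (1 + N).
      double : ∀ {x y} → 0ℤ ≤ x → 0ℤ < y → Bound x y → Bound (+ 2 * x) y
      double {x} {y} x≥0 y>0 bound v v⊥1 = diff (r₅ x y (form v v) (dot v v)) (0≤-cancel (0<* μ>0 μ>0) goal)
        where
        α β F G a₂ F′ a₃ : ℤ
        α = y * μ
        β = x + y
        F = form v v
        G = dot v v
        a₂ = dot (step v) (step v)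
        F′ = form (step v) (step v)
        a₃ = μ * F′
        -- With ν = y/(x + y), `z` is μ(1 + N)v and `q` is μ(x + y)(ν - N)v.
        z q : V
        z e = μ * v e + 1ℤ * step v e
        q e = α * v e + - β * step v e
        tot-z : tot z ≡ 0ℤ
        tot-z = begin
          tot z ≡⟨ sum-cong-≗ (λ e → r (d e) μ (v e) (step v e)) ⟩
          sum (λ e → μ * (d e * v e) + 1ℤ * (d e * step v e)) ≡⟨ ∑-lin₂ μ 1ℤ (λ e → d e * v e) (λ e → d e * step v e) ⟩
          μ * tot v + 1ℤ * tot (step v) ≡⟨ cong (λ t → μ * tot v + 1ℤ * t) (tot-step v) ⟩
          μ * tot v + 1ℤ * (μ * tot v) ≡⟨ cong (λ t → μ * t + 1ℤ * (μ * t)) v⊥1 ⟩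
          μ * 0ℤ + 1ℤ * (μ * 0ℤ) ≡⟨ r′ μ ⟩
          0ℤ ∎
          where
          open ≡-Reasoning
          r : ∀ d m v s → d * (m * v + 1ℤ * s) ≡ m * (d * v) + 1ℤ * (d * s)
          r = solve-∀
          r′ : ∀ m → m * 0ℤ + 1ℤ * (m * 0ℤ) ≡ 0ℤ
          r′ = solve-∀
        zz : dot z z ≡ μ * μ * G + + 2 * (μ * 1ℤ) * (μ * F) + 1ℤ * 1ℤ * a₂
        zz = trans (dot-quad μ 1ℤ v (step v)) (cong (λ t → μ * μ * G + + 2 * (μ * 1ℤ) * t + 1ℤ * 1ℤ * a₂) (dot-step v v))
        zBz : μ * form z z ≡ μ * (μ * μ * F) + + 2 * μ * a₂ + a₃
        zBz = trans (cong (μ *_) (form-quad A-sym μ 1ℤ v (step v)))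
          (trans (r μ F (form v (step v)) F′) (cong (λ t → μ * (μ * μ * F) + + 2 * μ * t + a₃) (form-step v)))
          where
          r : ∀ m F c F′ → m * (m * m * F + + 2 * (m * 1ℤ) * c + 1ℤ * 1ℤ * F′) ≡ m * (m * m * F) + + 2 * m * (m * c) + m * F′
          r = solve-∀
        qq : dot q q ≡ α * α * G + + 2 * (α * - β) * (μ * F) + - β * - β * a₂
        qq = trans (dot-quad α (- β) v (step v)) (cong (λ t → α * α * G + + 2 * (α * - β) * t + - β * - β * a₂) (dot-step v v))
        qBq : μ * form q q ≡ μ * (α * α * F) + + 2 * (α * - β) * a₂ + β * β * a₃
        qBq = trans (cong (μ *_) (form-quad A-sym α (- β) v (step v)))
          (trans (r μ α β F (form v (step v)) F′) (cong (λ t → μ * (α * α * F) + + 2 * (α * - β) * t + β * β * a₃) (form-step v)))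
          where
          r : ∀ m a b F c F′ → m * (a * a * F + + 2 * (a * - b) * c + - b * - b * F′)
            ≡ m * (a * a * F) + + 2 * (a * - b) * (m * c) + b * b * (m * F′)
          r = solve-∀
        -- Up to a positive factor, (1 + N)(ν - N)² ≥ 0 at v, because N ≥ -1.
        i₁ : 0ℤ ≤ μ * (α * α * G + + 2 * (α * - β) * (μ * F) + - β * - β * a₂) + (μ * (α * α * F) + + 2 * (α * - β) * a₂ + β * β * a₃)
        i₁ = subst (0ℤ ≤_) (trans (ℤₚ.*-distribˡ-+ μ (dot q q) (form q q)) (cong₂ _+_ (cong (μ *_) qq) qBq)) (0≤* μ≥0 (dot+form≥0 q))
        -- Up to a positive factor, (1 + N)²(ν - N) ≥ 0 at v: the given bound at `z`, which is again
        -- orthogonal to the constants.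
        i₂ : 0ℤ ≤ α * (μ * μ * G + + 2 * (μ * 1ℤ) * (μ * F) + 1ℤ * 1ℤ * a₂) - β * (μ * (μ * μ * F) + + 2 * μ * a₂ + a₃)
        i₂ = subst (0ℤ ≤_) (trans (r μ x y (dot z z) (form z z)) (cong₂ (λ s t → α * s - β * t) zz zBz))
               (0≤* μ≥0 (0≤diff (bound z tot-z)))
          where
          r : ∀ m x y D F → m * (y * (D - F) - x * F) ≡ y * m * D - (x + y) * (m * F)
          r = solve-∀
        x+y>0 : 0ℤ < β
        x+y>0 = ℤₚ.+-mono-≤-< x≥0 y>0
        -- The two inequalities add up to (1 + ν)(1 + N)(ν - N) ≥ 0, and the factor 1 + ν cancels.
        -- Inserting N² ≥ N then gives ν(1 + N) ≥ 2N.
        i₃ : 0ℤ ≤ α * μ * G + (α - β * μ) * (μ * F) - β * a₂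
        i₃ = 0≤-cancel (ℤₚ.+-mono-< (0<* y>0 μ>0) (0<* x+y>0 μ>0))
               (subst (0ℤ ≤_) (r α β μ G F a₂ a₃) (0≤+ i₁ (0≤* (ℤₚ.<⇒≤ x+y>0) i₂)))
          where
          r : ∀ a b m G F s t →
            m * (a * a * G + + 2 * (a * - b) * (m * F) + - b * - b * s) + (m * (a * a * F) + + 2 * (a * - b) * s + b * b * t)
            + b * (a * (m * m * G + + 2 * (m * 1ℤ) * (m * F) + 1ℤ * 1ℤ * s) - b * (m * (m * m * F) + + 2 * m * s + t))
            ≡ (a + b * m) * (a * m * G + (a - b * m) * (m * F) - b * s)
          r = solve-∀
        goal : 0ℤ ≤ μ * μ * (y * G - (+ 2 * x + y) * F)
        goal = subst (0ℤ ≤_) (r x y μ G F a₂) (0≤+ i₃ (0≤* (ℤₚ.<⇒≤ x+y>0) (0≤diff (dot-step² v))))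
          where
          r : ∀ x y m G F s → y * m * m * G + (y * m - (x + y) * m) * (m * F) - (x + y) * s + (x + y) * (s - m * (m * F))
            ≡ m * m * (y * G - (+ 2 * x + y) * F)
          r = solve-∀
        r₅ : ∀ x y F G → y * (G - F) - + 2 * x * F ≡ y * G - (+ 2 * x + y) * F
        r₅ = solve-∀

      weaken : ∀ {x x′ y} → 0ℤ ≤ x′ → 0ℤ ≤ y → x′ ≤ x → Bound x y → Bound x′ y
      weaken {x} {x′} {y} x′≥0 y≥0 x′≤x bound v p with ℤₚ.≤-total 0ℤ (form v v)
      ... | inj₁ q = ℤₚ.≤-trans (ℤₚ.*-monoʳ-≤-nonNeg (form v v) {{nonNegative q}} x′≤x) (bound v p)
      ... | inj₂ q = ℤₚ.≤-trans (subst (x′ * form v v ≤_) (ℤₚ.*-zeroʳ x′) (*-monoˡ x′≥0 q))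
                       (0≤* y≥0 (0≤diff (form≤dot v)))

      -- Doubling reaches every integer, since 2(n + 1) ≥ n + 2 and a bound may be weakened.
      unbounded : ∀ {y} → 0ℤ < y → Bound 1ℤ y → ∀ n → Bound (+ suc n) y
      unbounded y>0 b zero = b
      unbounded {y} y>0 b (suc n) = weaken {+ (2 ℕ.* suc n)} {+ suc (suc n)} {y} (+≤+ ℕ.z≤n) (ℤₚ.<⇒≤ y>0)
          (+≤+ (subst (suc (suc n) ℕ.≤_) (cong (suc n ℕ.+_) (sym (ℕₚ.+-identityʳ (suc n)))) (ℕ.s≤s (ℕₚ.m≤n+m (suc n) n))))
          (subst (λ x → Bound x y) (sym (ℤₚ.pos-* 2 (suc n))) (double {+ suc n} {y} (+≤+ ℕ.z≤n) y>0 (unbounded y>0 b n)))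

      total : ℤ
      total = sum d

      linkConstant : ∀ e f → ∃ λ C → 0ℤ ≤ C × (∀ v → d e * (d f * ((v e - v f) * (v e - v f))) ≤ C * energy v)
      linkConstant e f with ≡0⊎> (d≥0 e) | ≡0⊎> (d≥0 f)
      ... | inj₁ p | _ = 0ℤ , ℤₚ.≤-refl , λ v → ℤₚ.≤-reflexive (cong (_* (d f * ((v e - v f) * (v e - v f)))) p)
      ... | inj₂ _ | inj₁ p = 0ℤ , ℤₚ.≤-refl , λ v → ℤₚ.≤-reflexive
              (trans (cong (λ t → d e * (t * ((v e - v f) * (v e - v f)))) p) (ℤₚ.*-zeroʳ (d e)))
      ... | inj₂ p | inj₂ q with linked e f p q
      ...   | C , C≥0 , b = d e * (d f * C) , 0≤* (d≥0 e) (0≤* (d≥0 f) C≥0) , λ v →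
              subst (d e * (d f * ((v e - v f) * (v e - v f))) ≤_) (r (d e) (d f) C (energy v))
                (*-monoˡ (d≥0 e) (*-monoˡ (d≥0 f) (b v)))
        where
        r : ∀ a b c x → a * (b * (c * x)) ≡ a * (b * c) * x
        r = solve-∀

      -- For a vector of mean zero, the variance identity writes 2·total·⟨v, v⟩ as the sum of
      -- d(e)d(f)(v(e) - v(f))², and each term is bounded by a multiple of the energy.
      poincare : ∃ λ C → 0ℤ ≤ C × (∀ v → tot v ≡ 0ℤ → total * dot v v ≤ C * (dot v v - form v v))
      poincare = C , ∑-≥0 (λ e → ∑-≥0 λ f → proj₁ (proj₂ (linkConstant e f))) , λ v p →
          *-cancel {+ 2} (+<+ (ℕ.s≤s ℕ.z≤n)) (subst₂ _≤_ (lhs v p)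
            (trans (cong (C *_) (energy-form v)) (r₀ C (dot v v - form v v))) (upper v))
        where
        open ≡-Reasoning
        C : ℤ
        C = sum (λ e → sum (λ f → proj₁ (linkConstant e f)))
        r₀ : ∀ c x → c * (+ 2 * x) ≡ + 2 * (c * x)
        r₀ = solve-∀
        r₁ : ∀ a b x y → a * (b * ((x - y) * (x - y))) ≡ 1ℤ * (b * (a * (x * x))) + - + 2 * (a * x * (b * y)) + 1ℤ * (a * (b * (y * y)))
        r₁ = solve-∀
        r₂ : ∀ T G s → 1ℤ * (T * G) + - + 2 * (s * s) + 1ℤ * (T * G) ≡ + 2 * (T * G) - + 2 * s * s
        r₂ = solve-∀
        lhs : ∀ v → tot v ≡ 0ℤ → sum (λ e → sum (λ f → d e * (d f * ((v e - v f) * (v e - v f))))) ≡ + 2 * (total * dot v v)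
        lhs v p = begin
          sum (λ e → sum (λ f → d e * (d f * ((v e - v f) * (v e - v f)))))
            ≡⟨ sum-cong-≗ (λ e → sum-cong-≗ λ f → r₁ (d e) (d f) (v e) (v f)) ⟩
          sum (λ e → sum (λ f → 1ℤ * (d f * (d e * (v e * v e))) + - + 2 * (d e * v e * (d f * v f)) + 1ℤ * (d e * (d f * (v f * v f)))))
            ≡⟨ ∑∑-lin 1ℤ (- + 2) 1ℤ (λ e f → d f * (d e * (v e * v e))) (λ e f → d e * v e * (d f * v f)) (λ e f → d e * (d f * (v f * v f))) ⟩
          1ℤ * sum (λ e → sum (λ f → d f * (d e * (v e * v e)))) + - + 2 * sum (λ e → sum (λ f → d e * v e * (d f * v f)))
            + 1ℤ * sum (λ e → sum (λ f → d e * (d f * (v f * v f))))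
            ≡⟨ cong₂ _+_ (cong₂ _+_ (cong (1ℤ *_) (trans (∑-comm (λ e f → d f * (d e * (v e * v e)))) (prod d (λ e → d e * (v e * v e)))))
                 (cong (- + 2 *_) (prod (λ e → d e * v e) (λ e → d e * v e))))
                 (cong (1ℤ *_) (prod d (λ e → d e * (v e * v e)))) ⟩
          1ℤ * (total * dot v v) + - + 2 * (tot v * tot v) + 1ℤ * (total * dot v v)
            ≡⟨ r₂ total (dot v v) (tot v) ⟩
          + 2 * (total * dot v v) - + 2 * tot v * tot v
            ≡⟨ cong (λ t → + 2 * (total * dot v v) - + 2 * t * t) p ⟩
          + 2 * (total * dot v v) - + 2 * 0ℤ * 0ℤ
            ≡⟨ ℤₚ.+-identityʳ _ ⟩
          + 2 * (total * dot v v) ∎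
          where
          prod : ∀ (x y : V) → sum (λ e → sum (λ f → x e * y f)) ≡ sum x * sum y
          prod x y = trans (sum-cong-≗ λ e → trans (∑-* (x e) y) (ℤₚ.*-comm (x e) (sum y)))
                       (trans (∑-* (sum y) x) (ℤₚ.*-comm (sum y) (sum x)))
        upper : ∀ v → sum (λ e → sum (λ f → d e * (d f * ((v e - v f) * (v e - v f))))) ≤ C * energy v
        upper v = subst (sum (λ e → sum (λ f → d e * (d f * ((v e - v f) * (v e - v f))))) ≤_) eq
            (∑-mono λ e → ∑-mono λ f → proj₂ (proj₂ (linkConstant e f)) v)
          where
          eq : sum (λ e → sum (λ f → proj₁ (linkConstant e f) * energy v)) ≡ C * energy v
          eq = begin
            sum (λ e → sum (λ f → proj₁ (linkConstant e f) * energy v))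
              ≡⟨ sum-cong-≗ (λ e → trans (sum-cong-≗ λ f → ℤₚ.*-comm (proj₁ (linkConstant e f)) (energy v)) (∑-* (energy v) (λ f → proj₁ (linkConstant e f)))) ⟩
            sum (λ e → energy v * sum (λ f → proj₁ (linkConstant e f)))
              ≡⟨ ∑-* (energy v) (λ e → sum (λ f → proj₁ (linkConstant e f))) ⟩
            energy v * C ≡⟨ ℤₚ.*-comm (energy v) C ⟩
            C * energy v ∎

      form≤0 : ∀ v → tot v ≡ 0ℤ → form v v ≤ 0ℤ
      form≤0 v p with ≡0⊎> (∑-≥0 d≥0)
      ... | inj₁ z = ℤₚ.≤-trans (form≤dot v) (ℤₚ.≤-reflexive
              (∑-zero λ e → cong (_* (v e * v e)) (∑≡0⇒ d≥0 z e)))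
      ... | inj₂ T>0 with form v v in eq
      ...   | + zero = ℤₚ.≤-refl
      ...   | -[1+ n ] = ℤₚ.nonPositive⁻¹ -[1+ n ]
      -- A positive value is at least 1. It contradicts the bound with x = |W| + 1, where the right
      -- side W does not depend on x.
      ...   | + suc n = ⊥-elim (ℤₚ.<-irrefl refl (ℤₚ.<-≤-trans bad₁ bad₂))
        where
        C y W : ℤ
        C = proj₁ poincare
        -- The summand 1 makes y positive even if C vanishes, as the doubling step requires.
        y = 1ℤ + C
        C≥0 : 0ℤ ≤ C
        C≥0 = proj₁ (proj₂ poincare)
        y>0 : 0ℤ < y
        y>0 = ℤₚ.+-mono-<-≤ (+<+ (ℕ.s≤s ℕ.z≤n)) C≥0
        base : Bound total y
        base u q = ℤₚ.≤-trans (*-monoˡ (ℤₚ.<⇒≤ T>0) (form≤dot u))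
          (ℤₚ.≤-trans (proj₂ (proj₂ poincare) u q)
            (ℤₚ.*-monoʳ-≤-nonNeg (dot u u - form u u) {{nonNegative (0≤diff (form≤dot u))}} {C} {y} (ℤₚ.i≤j⇒i≤k+j 1ℤ ℤₚ.≤-refl)))
        W = y * (dot v v - form v v)
        W≥0 : 0ℤ ≤ W
        W≥0 = 0≤* (ℤₚ.<⇒≤ y>0) (0≤diff (form≤dot v))
        bad₁ : W < + suc ∣ W ∣
        bad₁ = subst (_< + suc ∣ W ∣) (ℤₚ.0≤i⇒+∣i∣≡i W≥0) (+<+ ℕₚ.≤-refl)
        bad₂ : + suc ∣ W ∣ ≤ W
        bad₂ = ℤₚ.≤-trans (subst₂ _≤_ (ℤₚ.*-identityʳ (+ suc ∣ W ∣)) refl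
                  (*-monoˡ {1ℤ} {form v v} {+ suc ∣ W ∣} (+≤+ ℕ.z≤n) (subst (1ℤ ≤_) (sym eq) (+≤+ (ℕ.s≤s ℕ.z≤n)))))
                (unbounded {y} y>0 (weaken {total} {1ℤ} {y} (+≤+ ℕ.z≤n) (ℤₚ.<⇒≤ y>0) (ℤₚ.i<j⇒suc[i]≤j T>0) base) ∣ W ∣ v p)

  -- Prefixes of words, and the exchange property of their supports

  ⟦_⟧ : ∀ {P : Set} → Dec P → ℤ
  ⟦ yes _ ⟧ = 1ℤ
  ⟦ no _ ⟧ = 0ℤ

  ⟦⟧≥0 : ∀ {P : Set} (d : Dec P) → 0ℤ ≤ ⟦ d ⟧
  ⟦⟧≥0 (yes _) = +≤+ ℕ.z≤n
  ⟦⟧≥0 (no _) = ℤₚ.≤-refl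

  ⟦⟧-yes : ∀ {P : Set} (d : Dec P) → P → ⟦ d ⟧ ≡ 1ℤ
  ⟦⟧-yes (yes _) _ = refl
  ⟦⟧-yes (no ¬p) p = contradiction p ¬p

  ⟦⟧-no : ∀ {P : Set} (d : Dec P) → ¬ P → ⟦ d ⟧ ≡ 0ℤ
  ⟦⟧-no (yes p) ¬p = contradiction p ¬p
  ⟦⟧-no (no _) _ = refl

  ⟦⟧-iff : ∀ {P Q : Set} (d : Dec P) (e : Dec Q) → (P → Q) → (Q → P) → ⟦ d ⟧ ≡ ⟦ e ⟧
  ⟦⟧-iff (yes p) e f g = sym (⟦⟧-yes e (f p))
  ⟦⟧-iff (no ¬p) e f g = sym (⟦⟧-no e (¬p ∘ g))

  *-guard : ∀ {P : Set} (d : Dec P) {x y} → (P → x ≡ y) → ⟦ d ⟧ * x ≡ ⟦ d ⟧ * y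
  *-guard (yes p) e = cong (1ℤ *_) (e p)
  *-guard (no _) {x} {y} _ = refl

  0<guard : ∀ {P : Set} (d : Dec P) {x} → 0ℤ < ⟦ d ⟧ * x → P × 0ℤ < x
  0<guard (yes p) {x} q = p , subst (0ℤ <_) (ℤₚ.*-identityˡ x) q
  0<guard (no _) (+<+ ())

  guard>0 : ∀ {P : Set} (d : Dec P) {x} → P → 0ℤ < x → 0ℤ < ⟦ d ⟧ * x
  guard>0 (yes _) {x} _ q = subst (0ℤ <_) (sym (ℤₚ.*-identityˡ x)) q
  guard>0 (no ¬p) p _ = contradiction p ¬p

  guard≥0 : ∀ {P : Set} (d : Dec P) {x} → 0ℤ ≤ x → 0ℤ ≤ ⟦ d ⟧ * x
  guard≥0 d q = 0≤* (⟦⟧≥0 d) q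

  -- Formal letters are always available and may be repeated; a plain letter is
  -- available once, after all the letters that must precede it.
  record Alphabet : Set₁ where
    field
      N : ℕ
      formal : Fin N → Bool
      _≺_ : Fin N → Fin N → Set
      _≺?_ : ∀ x y → Dec (x ≺ y)
      ≺-plain : ∀ {x y} → x ≺ y → formal x ≡ false

  module Language (𝔸 : Alphabet) where
    open Alphabet 𝔸

    -- A prefix is remembered by its letter multiplicities alone, because availability does not
    -- depend on the order of the letters.
    Letter State : Set
    Letter = Fin N
    State = Vec ℕ N

    infixl 6 _⊕_
    _⊕_ : State → Letter → State
    σ ⊕ x = updateAt σ x suc

    data Ad (σ : State) (x : Letter) : Set where
      always : formal x ≡ true → Ad σ x
      ready : lookup σ x ≡ 0 → (∀ y → y ≺ x → lookup σ y ≢ 0) → Ad σ x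

    abstract
     ad? : ∀ σ x → Dec (Ad σ x)
     ad? σ x = map′ (λ { (inj₁ p) → always p ; (inj₂ (p , q)) → ready p q })
      (λ { (always p) → inj₁ p ; (ready p q) → inj₂ (p , q) })
      ((formal x Boolₚ.≟ true) ⊎-dec
        ((lookup σ x ℕₚ.≟ 0) ×-dec Finₚ.all? (λ y → (y ≺? x) →-dec ¬? (lookup σ y ℕₚ.≟ 0))))

    ι : State → Letter → ℤ
    ι σ x = ⟦ ad? σ x ⟧

    ⊕-comm : ∀ σ x y → σ ⊕ x ⊕ y ≡ σ ⊕ y ⊕ x
    ⊕-comm σ x y with y Finₚ.≟ x
    ... | yes refl = refl
    ... | no y≢x = Vecₚ.updateAt-commutes y x y≢x σ

    look-same : ∀ σ x → lookup (σ ⊕ x) x ≡ suc (lookup σ x)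
    look-same σ x = Vecₚ.lookup∘updateAt x σ

    look-other : ∀ σ {x y} → y ≢ x → lookup (σ ⊕ x) y ≡ lookup σ y
    look-other σ {x} {y} y≢x = Vecₚ.lookup∘updateAt′ y x y≢x σ

    look-mono : ∀ σ x y → lookup σ y ℕ.≤ lookup (σ ⊕ x) y
    look-mono σ x y with y Finₚ.≟ x
    ... | yes refl = subst (lookup σ y ℕ.≤_) (sym (look-same σ y)) (ℕₚ.n≤1+n _)
    ... | no y≢x = ℕₚ.≤-reflexive (sym (look-other σ y≢x))

    ⊕-cancel : ∀ (σ τ : State) x → σ ⊕ x ≡ τ ⊕ x → σ ≡ τ
    ⊕-cancel σ τ x = go σ τ x
      where
      go : ∀ {n} (σ τ : Vec ℕ n) x → updateAt σ x suc ≡ updateAt τ x suc → σ ≡ τ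
      go (a ∷ σ) (b ∷ τ) zero e = cong₂ _∷_ (ℕₚ.suc-injective (Vecₚ.∷-injectiveˡ e)) (Vecₚ.∷-injectiveʳ e)
      go (a ∷ σ) (b ∷ τ) (suc x) e = cong₂ _∷_ (Vecₚ.∷-injectiveˡ e) (go σ τ x (Vecₚ.∷-injectiveʳ e))

    ≢0⇒> : ∀ {n} → n ≢ 0 → 0 ℕ.< n
    ≢0⇒> {zero} p = contradiction refl p
    ≢0⇒> {suc n} _ = ℕ.s≤s ℕ.z≤n

    >⇒≢0 : ∀ {n} → 0 ℕ.< n → n ≢ 0
    >⇒≢0 () refl

    ad-keep : ∀ {σ c e} → c ≢ e → Ad σ c → Ad (σ ⊕ e) c
    ad-keep _ (always p) = always p
    ad-keep {σ} {c} {e} c≢e (ready p q) = ready (trans (look-other σ c≢e) p)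
      λ y r → >⇒≢0 (ℕₚ.<-≤-trans (≢0⇒> (q y r)) (look-mono σ e y))

    ad-plain : ∀ {σ x} → formal x ≡ false → Ad σ x → lookup σ x ≡ 0 × (∀ y → y ≺ x → lookup σ y ≢ 0)
    ad-plain p (always q) = contradiction (trans (sym p) q) λ ()
    ad-plain _ (ready p q) = p , q

    ¬ad-plain : ∀ {σ x} → ¬ Ad σ x → formal x ≡ false
    ¬ad-plain {σ} {x} p with formal x in e
    ... | true = contradiction (always e) p
    ... | false = refl

    missing : ∀ {σ x} → ¬ Ad σ x → lookup σ x ≡ 0 → ∃ λ y → y ≺ x × lookup σ y ≡ 0
    missing {σ} {x} ¬a z with Finₚ.any? (λ y → (y ≺? x) ×-dec (lookup σ y ℕₚ.≟ 0))
    ... | yes r = r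
    ... | no ¬r = contradiction (ready z λ y p q → ¬r (y , p , q)) ¬a

    zero-back : ∀ {σ x} e → lookup (σ ⊕ e) x ≡ 0 → lookup σ x ≡ 0
    zero-back {σ} {x} e p = ℕₚ.n≤0⇒n≡0 (subst (lookup σ x ℕ.≤_) p (look-mono σ e x))

    filled : ∀ {σ e y} → lookup σ y ≡ 0 → lookup (σ ⊕ e) y ≢ 0 → y ≡ e
    filled {σ} {e} {y} p q with y Finₚ.≟ e
    ... | yes r = r
    ... | no r = contradiction (trans (look-other σ r) p) q

    -- Some predecessor of c has not occurred at σ, and appending e can supply it only by being it.
    ad-new : ∀ {σ e c} → ¬ Ad σ c → Ad (σ ⊕ e) c → e ≺ c
    ad-new {σ} {e} {c} ¬a a with ad-plain (¬ad-plain {σ} ¬a) a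
    ... | p , q with missing ¬a (zero-back {σ} {c} e p)
    ...   | y , y≺c , z with filled {σ} {e} {y} z (q y y≺c)
    ...     | refl = y≺c

    ad-new-unique : ∀ {σ a b c} → ¬ Ad σ c → Ad (σ ⊕ a) c → Ad (σ ⊕ b) c → a ≡ b
    ad-new-unique {σ} {a} {b} {c} ¬p pa pb with ad-plain (¬ad-plain {σ} ¬p) pa | ad-plain (¬ad-plain {σ} ¬p) pb
    ... | za , qa | zb , qb with missing ¬p (zero-back {σ} {c} a za)
    ...   | y , y≺c , z = trans (sym (filled {σ} {a} {y} z (qa y y≺c))) (filled {σ} {b} {y} z (qb y y≺c))

    -- A plain letter loses its availability only by being used, and then for good.
    ad-between : ∀ {τ c} a b → Ad τ c → Ad (τ ⊕ a ⊕ b) c → Ad (τ ⊕ a) c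
    ad-between a b (always p) _ = always p
    ad-between {τ} {c} a b p@(ready _ _) q with ad? (τ ⊕ a) c
    ... | yes r = r
    ... | no ¬r with c Finₚ.≟ a
    ...   | no c≢a = contradiction (ad-keep c≢a p) ¬r
    ...   | yes refl with ad-plain (¬ad-plain {τ ⊕ c} ¬r) q
    ...     | z , _ = contradiction (trans (sym (look-same τ c)) (zero-back {τ ⊕ c} {c} b z)) λ ()

    data Path (σ : State) : ℕ → State → Set where
      nil : Path σ 0 σ
      snoc : ∀ {k K x} → Path σ k K → Ad K x → Path σ (suc k) (K ⊕ x)

    path-mono : ∀ {σ k J} → Path σ k J → ∀ y → lookup σ y ℕ.≤ lookup J y
    path-mono nil y = ℕₚ.≤-refl
    path-mono (snoc {K = K} {x} p _) y = ℕₚ.≤-trans (path-mono p y) (look-mono K x y)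

    path-preds : ∀ {σ k J x} → Path σ k J → formal x ≡ false → lookup σ x ℕ.< lookup J x →
      ∀ y → y ≺ x → lookup J y ≢ 0
    path-preds nil _ lt = contradiction lt (ℕₚ.<-irrefl refl)
    path-preds {x = x} (snoc {K = K} {z} p a) fx lt y r with x Finₚ.≟ z
    ... | yes refl = >⇒≢0 (ℕₚ.<-≤-trans (≢0⇒> (proj₂ (ad-plain fx a) y r)) (look-mono K z y))
    ... | no x≢z = >⇒≢0 (ℕₚ.<-≤-trans (≢0⇒> (path-preds p fx (subst (_ ℕ.<_) (look-other K x≢z) lt) y r)) (look-mono K z y))

    Removal : State → ℕ → State → State → Set
    Removal σ k J J′ = ∃₂ λ K u → (∃ λ k′ → k ≡ suc k′ × Path σ k′ K) × Ad K u × K ⊕ u ≡ J × lookup J′ u ℕ.< lookup J u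

    -- J′ contains all predecessors of v but not u, so u does not precede v.
    not-pred : ∀ {σ k J′ K u v} → Path σ k J′ → lookup σ v ℕ.< lookup J′ v →
      Ad K u → lookup J′ u ℕ.< lookup (K ⊕ u) u → Ad (K ⊕ u) v → Ad K v
    not-pred {J′ = J′} {K = K} {u} {v} p lt au lu av with ad? K v
    ... | yes a = a
    ... | no ¬a = contradiction u∈ (ℕₚ.<⇒≱ (≢0⇒> (path-preds p (¬ad-plain {K} ¬a) lt u u≺v)))
      where
      u≺v : u ≺ v
      u≺v = ad-new ¬a av
      u∈ : lookup J′ u ℕ.≤ 0
      u∈ = ℕₚ.≤-pred (subst (lookup J′ u ℕ.<_) (trans (look-same K u) (cong suc (proj₁ (ad-plain (≺-plain u≺v) au)))) lu)

    -- If the last letter x of J is not in excess, a letter u in excess is removed from the part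
    -- before x, and x is read earlier. This is allowed because J′ contains x with all its
    -- predecessors but fewer copies of u, so u does not precede x.
    removal : ∀ {σ k k₂ J J′} → Path σ k J → Path σ k₂ J′ → (∃ λ u → lookup J′ u ℕ.< lookup J u) → Removal σ k J J′
    removal nil q (u , lt) = contradiction (path-mono q u) (ℕₚ.<⇒≱ lt)
    removal {J′ = J′} (snoc {k} {K} {x} p ax) q (u₀ , lt) with lookup J′ x ℕₚ.<? lookup (K ⊕ x) x
    ... | yes r = K , x , (k , refl , p) , ax , refl , r
    ... | no ¬r with removal p q (u₀ , subst (lookup J′ u₀ ℕ.<_) (look-other K λ { refl → ¬r lt }) lt)
    ...   | K′ , u , (k′ , refl , p′) , au , refl , lu =
        K′ ⊕ x , u , (suc k′ , refl , snoc p′ ax′) , ad-keep u≢x au , ⊕-comm K′ x u ,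
        subst (lookup J′ u ℕ.<_) (sym (look-other (K′ ⊕ u) u≢x)) lu
      where
      x∈ : lookup (K′ ⊕ u) x ℕ.< lookup J′ x
      x∈ = ℕₚ.<-≤-trans (subst (lookup (K′ ⊕ u) x ℕ.<_) (sym (look-same (K′ ⊕ u) x)) (ℕₚ.n<1+n _)) (ℕₚ.≮⇒≥ ¬r)
      u≢x : u ≢ x
      u≢x refl = ℕₚ.<-asym x∈ lu
      ax′ : Ad K′ x
      ax′ = not-pred q (ℕₚ.≤-<-trans (path-mono p x) x∈) au lu ax

    path-size : ∀ {σ k J} → Path σ k J → Vec.sum J ≡ k ℕ.+ Vec.sum σ
    path-size nil = refl
    path-size (snoc {K = K} {x} p _) = trans (size-⊕ K x) (cong suc (path-size p))
      where
      size-⊕ : ∀ {n} (σ : Vec ℕ n) x → Vec.sum (updateAt σ x suc) ≡ suc (Vec.sum σ)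
      size-⊕ (a ∷ σ) zero = refl
      size-⊕ (a ∷ σ) (suc x) = trans (cong (a ℕ.+_) (size-⊕ σ x)) (ℕₚ.+-suc a (Vec.sum σ))

    sum-weak : ∀ {n} (σ τ : Vec ℕ n) → (∀ u → lookup σ u ℕ.≤ lookup τ u) → Vec.sum σ ℕ.≤ Vec.sum τ
    sum-weak [] [] _ = ℕ.z≤n
    sum-weak (a ∷ σ) (b ∷ τ) r = ℕₚ.+-mono-≤ (r zero) (sum-weak σ τ (r ∘ suc))

    sum-strict : ∀ {n} (σ τ : Vec ℕ n) v → (∀ u → lookup σ u ℕ.≤ lookup τ u) → lookup σ v ℕ.< lookup τ v → Vec.sum σ ℕ.< Vec.sum τ
    sum-strict (a ∷ σ) (b ∷ τ) zero r l = ℕₚ.+-mono-<-≤ l (sum-weak σ τ (r ∘ suc))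
    sum-strict (a ∷ σ) (b ∷ τ) (suc v) r l = ℕₚ.+-mono-≤-< (r zero) (sum-strict σ τ v (r ∘ suc) l)

    exceeds : ∀ {σ k J J′} → Path σ k J → Path σ k J′ → ∀ {v} → lookup J v ℕ.< lookup J′ v →
      ∃ λ u → lookup J′ u ℕ.< lookup J u
    exceeds {J = J} {J′} p q {v} lt with Finₚ.any? (λ u → lookup J′ u ℕₚ.<? lookup J u)
    ... | yes r = r
    ... | no ¬r = contradiction (trans (path-size p) (sym (path-size q)))
        (ℕₚ.<⇒≢ (sum-strict J J′ v (λ u → ℕₚ.≮⇒≥ λ l → ¬r (u , l)) lt))

    exceeds-longer : ∀ {σ k k′ J J′} → Path σ k J → Path σ k′ J′ → k′ ℕ.< k → ∃ λ u → lookup J′ u ℕ.< lookup J u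
    exceeds-longer {σ} {J = J} {J′} p q lt with Finₚ.any? (λ u → lookup J′ u ℕₚ.<? lookup J u)
    ... | yes r = r
    ... | no ¬r = contradiction (sum-weak J J′ λ u → ℕₚ.≮⇒≥ λ l → ¬r (u , l))
        (ℕₚ.<⇒≱ (subst₂ ℕ._<_ (sym (path-size q)) (sym (path-size p)) (ℕₚ.+-monoˡ-< (Vec.sum σ) lt)))

    -- The exchange J - u + v of matroid bases, with multiplicities (M-convexity), where u must
    -- moreover be able to stand last in a word for J.
    Exchange : (State → ℤ) → Set
    Exchange g = ∀ {σ k J J′} → Path σ k J → Path σ k J′ → 0ℤ < g J → 0ℤ < g J′ →
      ∀ {v} → Ad J v → lookup J v ℕ.< lookup J′ v →
      ∃₂ λ K u → (∃ λ k′ → k ≡ suc k′ × Path σ k′ K) × Ad K u × K ⊕ u ≡ J × lookup J′ u ℕ.< lookup J u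
        × Ad K v × 0ℤ < g (K ⊕ v)

    -- Two different last letters of one prefix close up to a diamond: both can be appended to a
    -- common K₀, in either order.
    square : ∀ {σ k J K x u} → Path σ k J → Ad J x → Path σ k K → Ad K u → K ⊕ u ≡ J ⊕ x → u ≢ x →
      ∃ λ K₀ → (∃ λ k′ → k ≡ suc k′ × Path σ k′ K₀) × Ad K₀ x × Ad K₀ u × K₀ ⊕ x ≡ K × K₀ ⊕ u ≡ J
    square {σ} {k} {J} {K} {x} {u} p ax q au eq u≢x with removal q p (x , x∈)
      where
      x∈ : lookup J x ℕ.< lookup K x
      x∈ = subst (lookup J x ℕ.<_) (trans (sym (look-same J x)) (trans (cong (λ S → lookup S x) (sym eq)) (look-other K (u≢x ∘ sym)))) (ℕₚ.n<1+n _)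
    ... | K₀ , u′ , (k′ , refl , p₀) , au′ , refl , lu′ with u′ Finₚ.≟ x
    ...   | no u′≢x = contradiction (subst (lookup K u′ ℕ.≤_) (trans (cong (λ S → lookup S u′) eq) (look-other J u′≢x)) (look-mono K u u′)) (ℕₚ.<⇒≱ lu′)
    ...   | yes refl = K₀ , (k′ , refl , p₀) , au′ , au₀ , refl , e₀
      where
      e₀ : K₀ ⊕ u ≡ J
      e₀ = ⊕-cancel (K₀ ⊕ u) J x (trans (⊕-comm K₀ u x) eq)
      au₀ : Ad K₀ u
      au₀ with ad? K₀ u
      ... | yes a = a
      ... | no ¬a = contradiction (proj₁ (ad-plain (≺-plain x≺u) ax)) (path-preds p fu u∈ x x≺u)
        where
        x≺u : x ≺ u
        x≺u = ad-new ¬a au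
        fu : formal u ≡ false
        fu = ¬ad-plain {K₀} ¬a
        u∈ : lookup σ u ℕ.< lookup J u
        u∈ = ℕₚ.≤-<-trans (ℕₚ.≤-trans (path-mono q u) (ℕₚ.≤-reflexive (proj₁ (ad-plain fu au))))
          (subst (0 ℕ.<_) (trans (sym (look-same K₀ u)) (cong (λ S → lookup S u) e₀)) (ℕ.s≤s ℕ.z≤n))

    ad-without : ∀ {J K x v} → Ad J x → Ad J v → Ad (K ⊕ x) v → Ad K v
    ad-without {J} {K} {x} {v} ax av avK with ad? K v
    ... | yes a = a
    ... | no ¬a = contradiction (proj₁ (ad-plain (≺-plain x≺v) ax)) (proj₂ (ad-plain (¬ad-plain {K} ¬a) av) x x≺v)
      where
      x≺v : x ≺ v
      x≺v = ad-new ¬a avK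

    -- What an exchange between J x and J′ x′ leaves for J and J′. In the first case v takes the
    -- place of x (or equals it); in the second a letter of J gives way to v, and x can still
    -- follow.
    Lift : (State → ℤ) → State → ℕ → State → State → Letter → Letter → Letter → Set
    Lift g σ k J J′ x x′ v =
      (0ℤ < g (J ⊕ v) × (v ≡ x ⊎ lookup (J′ ⊕ x′) x ℕ.< lookup (J ⊕ x) x)) ⊎
      (∃₂ λ K u → (∃ λ k′ → k ≡ suc k′ × Path σ k′ K) × Ad K u × K ⊕ u ≡ J × lookup J′ u ℕ.< lookup J u
        × Ad K v × Ad (K ⊕ v) x × 0ℤ < g (K ⊕ v ⊕ x))

    exchange-lift : ∀ {g} → Exchange g → ∀ {σ k J J′ x x′ v} → Path σ k J → Path σ k J′ → Ad J x → Ad J′ x′ →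
      0ℤ < g (J ⊕ x) → 0ℤ < g (J′ ⊕ x′) → Ad J v → lookup J v ℕ.< lookup J′ v → Lift g σ k J J′ x x′ v
    exchange-lift {g} ex {σ} {k} {J} {J′} {x} {x′} {v} p p′ ax ax′ gx gx′ av lv with v Finₚ.≟ x
    ... | yes refl = inj₁ (gx , inj₁ refl)
    ... | no v≢x with ex (snoc p ax) (snoc p′ ax′) gx gx′ (ad-keep v≢x av)
                   (subst (ℕ._< lookup (J′ ⊕ x′) v) (sym (look-other J v≢x)) (ℕₚ.<-≤-trans lv (look-mono J′ x′ v)))
    ...   | K , u , (_ , refl , q) , au , eq , lu , avK , gK with u Finₚ.≟ x
    ...     | yes refl = inj₁ (subst (λ S → 0ℤ < g (S ⊕ v)) (⊕-cancel K J x eq) gK , inj₂ lu)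
    ...     | no u≢x with square p ax q au eq u≢x
    ...       | K₀ , pk , ax₀ , au₀ , refl , refl = inj₂ (K₀ , u , pk , au₀ , refl ,
                  subst (lookup J′ u ℕ.<_) (look-other (K₀ ⊕ u) u≢x) (ℕₚ.≤-<-trans (look-mono J′ x′ u) lu) ,
                  ad-without ax av avK , ad-keep (v≢x ∘ sym) ax₀ , subst (λ S → 0ℤ < g S) (⊕-comm K₀ x v) gK)

    free : (Letter → ℤ) → (State → ℤ) → State → ℤ
    free h g σ = sum (λ x → h x * (ι σ x * g (σ ⊕ x)))

    mark : Letter → (State → ℤ) → State → ℤ
    mark p g σ = ι σ p * g (σ ⊕ p)

    free≥0 : ∀ {h g} → (∀ x → 0ℤ ≤ h x) → (∀ σ → 0ℤ ≤ g σ) → ∀ σ → 0ℤ ≤ free h g σ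
    free≥0 h≥0 g≥0 σ = ∑-≥0 λ x → 0≤* (h≥0 x) (guard≥0 (ad? σ x) (g≥0 (σ ⊕ x)))

    mark≥0 : ∀ {p g} → (∀ σ → 0ℤ ≤ g σ) → ∀ σ → 0ℤ ≤ mark p g σ
    mark≥0 {p} g≥0 σ = guard≥0 (ad? σ p) (g≥0 (σ ⊕ p))

    module _ {h : Letter → ℤ} (h>0 : ∀ x → 0ℤ < h x) {g : State → ℤ} (g≥0 : ∀ σ → 0ℤ ≤ g σ) where

      free>0⇒ : ∀ {σ} → 0ℤ < free h g σ → ∃ λ x → Ad σ x × 0ℤ < g (σ ⊕ x)
      free>0⇒ {σ} p with ∑>0⇒ (λ x → 0≤* (ℤₚ.<⇒≤ (h>0 x)) (guard≥0 (ad? σ x) (g≥0 (σ ⊕ x)))) p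
      ... | x , q = x , 0<guard (ad? σ x) (ℤₚ.*-cancelˡ-<-nonNeg (h x) {{nonNegative (ℤₚ.<⇒≤ (h>0 x))}}
                      (subst (_< h x * (ι σ x * g (σ ⊕ x))) (sym (ℤₚ.*-zeroʳ (h x))) q))

      free>0 : ∀ {σ x} → Ad σ x → 0ℤ < g (σ ⊕ x) → 0ℤ < free h g σ
      free>0 {σ} {x} a q = ℤₚ.<-≤-trans (0<* (h>0 x) (guard>0 (ad? σ x) a q))
        (∑-term (λ x → 0≤* (ℤₚ.<⇒≤ (h>0 x)) (guard≥0 (ad? σ x) (g≥0 (σ ⊕ x)))) x)

      exchange-free : Exchange g → Exchange (free h g)
      exchange-free ex {σ} {k} {J} {J′} p p′ fJ fJ′ {v} av lv with free>0⇒ fJ | free>0⇒ fJ′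
      ... | x , ax , gx | x′ , ax′ , gx′ with exchange-lift ex p p′ ax ax′ gx gx′ av lv
      ...   | inj₂ (K , u , pk , au , eq , lu , aKv , aKx , gK) = K , u , pk , au , eq , lu , aKv , free>0 aKx gK
      -- Only J v is known to be in the support of `g`. Since J and J′ have equal length, some u in
      -- excess can be taken out of J; read after v, it fills the free position: K v u = J v.
      ...   | inj₁ (gv , _) with removal p p′ (exceeds p p′ lv)
      ...     | K , u , pk , au , refl , lu = K , u , pk , au , refl , lu , aKv ,
                  free>0 (ad-keep u≢v au) (subst (λ S → 0ℤ < g S) (⊕-comm K u v) gv)
        where
        u≢v : u ≢ v
        u≢v refl = ℕₚ.<-asym lu lv
        aKv : Ad K v
        aKv = not-pred p′ (ℕₚ.≤-<-trans (path-mono p v) lv) au lu av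

    exchange-mark : ∀ {p g} → formal p ≡ false → Exchange g → Exchange (mark p g)
    exchange-mark {p} {g} fp ex {σ} {k} {J} {J′} q q′ mJ mJ′ {v} av lv
      with 0<guard (ad? J p) mJ | 0<guard (ad? J′ p) mJ′
    ... | ap , gp | ap′ , gp′ with exchange-lift ex q q′ ap ap′ gp gp′ av lv
    ...   | inj₂ (K , u , pk , au , eq , lu , aKv , aKx , gK) = K , u , pk , au , eq , lu , aKv , guard>0 (ad? (K ⊕ v) p) aKx gK
    -- The marked letter is still absent from both J and J′, so it is neither v nor in excess.
    ...   | inj₁ (_ , inj₁ refl) = contradiction (proj₁ (ad-plain fp ap′)) (>⇒≢0 (ℕₚ.≤-<-trans ℕ.z≤n lv))
    ...   | inj₁ (_ , inj₂ l) = contradiction (trans (look-same J′ p) (trans (cong suc (trans (proj₁ (ad-plain fp ap′)) (sym (proj₁ (ad-plain fp ap))))) (sym (look-same J p)))) (ℕₚ.<⇒≢ l)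

  -- Forms that are nonpositive on a hyperplane

  module Hyperbolic {N} (A : Fin N → Fin N → ℤ) (δ : Fin N → ℤ) (A-sym : ∀ e f → A e f ≡ A f e) where
    open Form A δ

    -- Linearity is required for every v that equals the combination pointwise, since equal values
    -- do not make functions equal here.
    Hyp : Set
    Hyp = ∃ λ (ℓ : (Fin N → ℤ) → ℤ) →
      (∀ s t u w v → (∀ i → v i ≡ s * u i + t * w i) → ℓ v ≡ s * ℓ u + t * ℓ w) × (∀ w → ℓ w ≡ 0ℤ → form w w ≤ 0ℤ)

    -- The vector ℓ(u)w - ℓ(w)u lies in the kernel of ℓ. Its form, negated, multiplied by the form
    -- of u and completed by a square, equals ℓ(u)² times the asserted difference; and ℓ(u) ≠ 0
    -- because the form is positive at u.
    reverse-CS : Hyp → ∀ u w → 0ℤ < form u u → form u u * form w w ≤ form u w * form u w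
    reverse-CS (ℓ , lin , neg) u w pos = ℤₚ.0≤i-j⇒j≤i (0≤-cancel p²>0
        (subst (0ℤ ≤_) (r₃ p q a b c) (0≤+ (0≤sq (p * b - q * a)) (0≤* (ℤₚ.<⇒≤ pos) (0≤diff Mz≤0)))))
      where
      p q a b c : ℤ
      p = ℓ u
      q = ℓ w
      a = form u u
      b = form u w
      c = form w w
      z : Fin N → ℤ
      z i = p * w i + - q * u i
      ℓz : ℓ z ≡ 0ℤ
      ℓz = trans (lin p (- q) w u z (λ _ → refl)) (r p q)
        where
        r : ∀ p q → p * q + - q * p ≡ 0ℤ
        r = solve-∀
      Mz≤0 : p * p * c + + 2 * (p * - q) * b + - q * - q * a ≤ 0ℤ
      Mz≤0 = subst (_≤ 0ℤ) (trans (form-quad A-sym p (- q) w u)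
        (cong (λ x → p * p * c + + 2 * (p * - q) * x + - q * - q * a) (form-sym A-sym w u))) (neg z ℓz)
      r₃ : ∀ p q a b c → (p * b - q * a) * (p * b - q * a) + a * (0ℤ - (p * p * c + + 2 * (p * - q) * b + - q * - q * a))
        ≡ p * p * (b * b - a * c)
      r₃ = solve-∀
      p²>0 : 0ℤ < p * p
      p²>0 with ≡0⊎> (0≤sq p)
      ... | inj₂ r = r
      ... | inj₁ e with ℤₚ.i*j≡0⇒i≡0∨j≡0 p e
      ...   | inj₁ e′ = contradiction pos (ℤₚ.≤⇒≯ (neg u e′))
      ...   | inj₂ e′ = contradiction pos (ℤₚ.≤⇒≯ (neg u e′))

  -- The local-to-global criterion

  module Weighted {N} (O : Fin N → Fin N → ℤ) (D : Fin N → ℤ)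
    (O-sym : ∀ e f → O e f ≡ O f e) (O≥0 : ∀ e f → 0ℤ ≤ O e f) (D≥0 : ∀ e → 0ℤ ≤ D e)
    (h co : Fin N → ℤ) (H : ℤ) (h>0 : ∀ e → 0ℤ < h e) (H>0 : 0ℤ < H) (co-h : ∀ e → co e * h e ≡ H)
    (Q : Fin N → (Fin N → ℤ) → ℤ) where

    module F = Form O D

    m : Fin N → ℤ
    m = F.app h

    -- Conjugation by diag(h) moves the vector h to the constant vector, which is the eigenvector
    -- for 1 of the resulting chain.
    A : Fin N → Fin N → ℤ
    A e f = h e * (O e f * h f)

    δ : Fin N → ℤ
    δ e = h e * (D e * h e)

    h≥0 : ∀ e → 0ℤ ≤ h e
    h≥0 e = ℤₚ.<⇒≤ (h>0 e)

    A-sym : ∀ e f → A e f ≡ A f e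
    A-sym e f = trans (cong (λ x → h e * (x * h f)) (O-sym e f)) (r (h e) (O f e) (h f))
      where
      r : ∀ a o b → a * (o * b) ≡ b * (o * a)
      r = solve-∀

    open Markov A δ A-sym (λ e f → 0≤* (h≥0 e) (0≤* (O≥0 e f) (h≥0 f))) (λ e → 0≤* (h≥0 e) (0≤* (D≥0 e) (h≥0 e)))

    scale : (Fin N → ℤ) → Fin N → ℤ
    scale v e = h e * v e

    m≥0 : ∀ e → 0ℤ ≤ m e
    m≥0 e = 0≤+ (∑-≥0 λ f → 0≤* (O≥0 e f) (h≥0 f)) (0≤* (D≥0 e) (h≥0 e))

    d-m : ∀ e → d e ≡ h e * m e
    d-m e = trans (cong (_+ δ e) (∑-* (h e) (λ f → O e f * h f))) (sym (ℤₚ.*-distribˡ-+ (h e) _ (D e * h e)))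

    app-scale : ∀ v e → app v e ≡ h e * F.app (scale v) e
    app-scale v e = trans (cong₂ _+_ (trans (sum-cong-≗ λ f → r (h e) (O e f) (h f) (v f)) (∑-* (h e) (λ f → O e f * scale v f)))
        (r (h e) (D e) (h e) (v e))) (sym (ℤₚ.*-distribˡ-+ (h e) _ (D e * scale v e)))
      where
      r : ∀ a o b x → a * (o * b) * x ≡ a * (o * (b * x))
      r = solve-∀

    form-scale : ∀ v → form v v ≡ F.form (scale v) (scale v)
    form-scale v = sum-cong-≗ λ e → trans (cong (v e *_) (app-scale v e)) (r (v e) (h e) (F.app (scale v) e))
      where
      r : ∀ x a y → x * (a * y) ≡ a * x * y
      r = solve-∀

    module _
      (Q-bound : ∀ e w → 0ℤ < m e → Q e w * m e ≤ F.app w e * F.app w e)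
      (Q-zero : ∀ e w → m e ≡ 0ℤ → Q e w ≤ 0ℤ)
      (pull : ∀ w → F.form w w ≤ sum (λ e → h e * Q e w))
      (conn : ∀ e f → 0ℤ < m e → 0ℤ < m f → ∃ λ g → (g ≡ e ⊎ 0ℤ < O e g) × (f ≡ g ⊎ 0ℤ < O g f)) where

      link : ∀ {e f} → f ≡ e ⊎ 0ℤ < O e f → Linked e f
      link {e} (inj₁ refl) = linked-refl e
      link {e} {f} (inj₂ p) = linked-edge e f (0<* (h>0 e) (0<* p (h>0 f)))

      m>0 : ∀ e → 0ℤ < d e → 0ℤ < m e
      m>0 e p with ≡0⊎> (m≥0 e)
      ... | inj₂ q = q
      ... | inj₁ q = contradiction (subst (0ℤ <_) (trans (d-m e) (trans (cong (h e *_) q) (ℤₚ.*-zeroʳ (h e)))) p) (ℤₚ.<-irrefl refl)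

      -- `Q-bound` estimates Q(e, w) by the square of entry e of the image of w, divided by m(e).
      -- Summed with the weights h and combined with `pull`, this is N² ≥ N.
      key : ∀ (μ : ℤ) (k : V) → 0ℤ < μ → (∀ e → 0ℤ ≤ k e) → (∀ e → d e ≡ 0ℤ ⊎ k e * d e ≡ μ) →
             ∀ v → μ * form v v ≤ sum (λ e → k e * (app v e * app v e))
      key μ k μ>0 k≥0 kd v = subst (_≤ sum (λ e → k e * (app v e * app v e))) (cong (μ *_) (sym (form-scale v)))
          (ℤₚ.≤-trans (*-monoˡ (ℤₚ.<⇒≤ μ>0) (pull w))
            (subst (_≤ sum (λ e → k e * (app v e * app v e))) (∑-* μ (λ e → h e * Q e w)) (∑-mono pointwise)))
        where
        w : V
        w = scale v
        pointwise : ∀ e → μ * (h e * Q e w) ≤ k e * (app v e * app v e)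
        pointwise e with ≡0⊎> (m≥0 e)
        ... | inj₁ z = ℤₚ.≤-trans (*-monoˡ (ℤₚ.<⇒≤ μ>0) (*-monoˡ (h≥0 e) (Q-zero e w z)))
                         (subst (_≤ k e * (app v e * app v e)) (sym (r μ (h e))) (0≤* (k≥0 e) (0≤sq (app v e))))
          where
          r : ∀ a b → a * (b * 0ℤ) ≡ 0ℤ
          r = solve-∀
        ... | inj₂ p with kd e
        ...   | inj₁ z = contradiction (*≡0 (h>0 e) (trans (sym (d-m e)) z)) (λ q → ℤₚ.<-irrefl (sym q) p)
        ...   | inj₂ eq = subst₂ _≤_ e₁ e₂ (*-monoˡ (0≤* (k≥0 e) (0≤* (h≥0 e) (h≥0 e))) (Q-bound e w p))
          where
          r₁ : ∀ k h q m → k * (h * h) * (q * m) ≡ k * (h * m) * (h * q)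
          r₁ = solve-∀
          r₂ : ∀ k h a → k * (h * h) * (a * a) ≡ k * (h * a * (h * a))
          r₂ = solve-∀
          e₁ : k e * (h e * h e) * (Q e w * m e) ≡ μ * (h e * Q e w)
          e₁ = trans (r₁ (k e) (h e) (Q e w) (m e)) (cong (_* (h e * Q e w)) (trans (cong (k e *_) (sym (d-m e))) eq))
          e₂ : k e * (h e * h e) * (F.app w e * F.app w e) ≡ k e * (app v e * app v e)
          e₂ = trans (r₂ (k e) (h e) (F.app w e)) (cong (λ x → k e * (x * x)) (sym (app-scale v e)))

      linked : ∀ e f → 0ℤ < d e → 0ℤ < d f → Linked e f
      linked e f p q with conn e f (m>0 e p) (m>0 f q)
      ... | g , x , y = linked-trans (link x) (link y)

      open Gap linked key

      -- The functional is the pairing with h under the form. On its kernel the vector rescaled by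
      -- `co`, the inverse weights up to the factor H, is orthogonal to the constants.
      hyperbolic : Hyperbolic.Hyp O D O-sym
      hyperbolic = (λ w → sum (λ e → w e * m e)) ,
          (λ s t u w v eq → trans (sum-cong-≗ λ e → trans (cong (_* m e) (eq e)) (r₁ s (u e) t (w e) (m e))) (∑-lin₂ s t (λ e → u e * m e) (λ e → w e * m e))) , neg
        where
        r₁ : ∀ s x t y m → (s * x + t * y) * m ≡ s * (x * m) + t * (y * m)
        r₁ = solve-∀
        neg : ∀ w → sum (λ e → w e * m e) ≡ 0ℤ → F.form w w ≤ 0ℤ
        neg w z = *-cancel (0<* H>0 H>0) (subst₂ _≤_ eq (sym (ℤₚ.*-zeroʳ (H * H))) (form≤0 v tot0))
          where
          v : V
          v e = co e * w e
          sv : ∀ e → scale v e ≡ H * w e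
          sv e = trans (r (h e) (co e) (w e)) (cong (_* w e) (co-h e))
            where
            r : ∀ h c w → h * (c * w) ≡ c * h * w
            r = solve-∀
          tot0 : tot v ≡ 0ℤ
          tot0 = trans (sum-cong-≗ λ e → trans (cong (_* v e) (d-m e)) (trans (r (h e) (m e) (v e))
              (trans (cong (_* m e) (sv e)) (ℤₚ.*-assoc H (w e) (m e)))))
            (trans (∑-* H (λ e → w e * m e)) (trans (cong (H *_) z) (ℤₚ.*-zeroʳ H)))
            where
            r : ∀ h m v → h * m * v ≡ h * v * m
            r = solve-∀
          r₄ : ∀ H f → H * H * f + + 2 * (H * 0ℤ) * f + 0ℤ * 0ℤ * f ≡ H * H * f
          r₄ = solve-∀
          eq : form v v ≡ H * H * F.form w w
          eq = trans (form-scale v) (trans (sum-cong-≗ λ e → cong₂ _*_ (sv′ e) (cong₂ _+_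
                 (sum-cong-≗ λ f → cong (O e f *_) (sv′ f)) (cong (D e *_) (sv′ e))))
                 (trans (F.form-quad O-sym H 0ℤ w w) (r₄ H (F.form w w))))
            where
            sv′ : ∀ e → scale v e ≡ H * w e + 0ℤ * w e
            sv′ e = trans (sv e) (r (H) (w e))
              where
              r : ∀ H w → H * w ≡ H * w + 0ℤ * w
              r = solve-∀

  -- The quadratic form at a prefix

  pick : ∀ {P : Set} → Dec P → ℤ → ℤ → ℤ
  pick (yes _) x _ = x
  pick (no _) _ y = y

  pick-yes : ∀ {P : Set} (d : Dec P) {x y} → P → pick d x y ≡ x
  pick-yes (yes _) _ = refl
  pick-yes (no ¬p) p = contradiction p ¬p

  pick-no : ∀ {P : Set} (d : Dec P) {x y} → ¬ P → pick d x y ≡ y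
  pick-no (yes p) ¬p = contradiction p ¬p
  pick-no (no _) _ = refl

  sum₃ : ∀ {N} → (Fin N → Fin N → Fin N → ℤ) → ℤ
  sum₃ f = sum λ a → sum λ b → sum λ c → f a b c

  sum₃-cong : ∀ {N} {f g : Fin N → Fin N → Fin N → ℤ} → (∀ a b c → f a b c ≡ g a b c) → sum₃ f ≡ sum₃ g
  sum₃-cong p = sum-cong-≗ λ a → sum-cong-≗ λ b → sum-cong-≗ λ c → p a b c

  sum₃-+ : ∀ {N} (f g : Fin N → Fin N → Fin N → ℤ) → sum₃ (λ a b c → f a b c + g a b c) ≡ sum₃ f + sum₃ g
  sum₃-+ f g = trans (sum-cong-≗ λ a → trans (sum-cong-≗ λ b → ∑-distrib-+ (f a b) (g a b))
      (∑-distrib-+ (λ b → sum (f a b)) (λ b → sum (g a b)))) (∑-distrib-+ (λ a → sum λ b → sum (f a b)) (λ a → sum λ b → sum (g a b)))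

  sum₃-12 : ∀ {N} (f : Fin N → Fin N → Fin N → ℤ) → sum₃ (λ a b c → f b a c) ≡ sum₃ f
  sum₃-12 f = ∑-comm (λ a b → sum (λ c → f b a c))

  sum₃-23 : ∀ {N} (f : Fin N → Fin N → Fin N → ℤ) → sum₃ (λ a b c → f a c b) ≡ sum₃ f
  sum₃-23 f = sum-cong-≗ λ a → ∑-comm (λ b c → f a c b)

  symmetrised : ∀ {N} → (Fin N → Fin N → Fin N → ℤ) → Fin N → Fin N → Fin N → ℤ
  symmetrised t a b c = t a b c + t a c b + t b a c + t b c a + t c a b + t c b a

  -- All six permutations of the arguments have the same total, so only their sum has to be
  -- nonnegative termwise.
  sum₃-sym : ∀ {N} (t : Fin N → Fin N → Fin N → ℤ) → (∀ a b c → 0ℤ ≤ symmetrised t a b c) → 0ℤ ≤ sum₃ t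
  sum₃-sym t p = 0≤-cancel {+ 6} (+<+ (ℕ.s≤s ℕ.z≤n)) (subst (0ℤ ≤_) eq (∑-≥0 λ a → ∑-≥0 λ b → ∑-≥0 λ c → p a b c))
    where
    τ : ℤ
    τ = sum₃ t
    r : ∀ x → x + x + x + x + x + x ≡ + 6 * x
    r = solve-∀
    bca : sum₃ (λ a b c → t b c a) ≡ τ
    bca = trans (sum₃-23 (λ a b c → t c b a)) (trans (sum₃-12 (λ a b c → t c a b))
            (trans (sum₃-23 (λ a b c → t b a c)) (sum₃-12 t)))
    cab : sum₃ (λ a b c → t c a b) ≡ τ
    cab = trans (sum₃-23 (λ a b c → t b a c)) (sum₃-12 t)
    cba : sum₃ (λ a b c → t c b a) ≡ τ
    cba = trans (sum₃-12 (λ a b c → t c a b)) cab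
    eq : sum₃ (symmetrised t) ≡ + 6 * τ
    eq = trans (sum₃-+ (λ a b c → t a b c + t a c b + t b a c + t b c a + t c a b) (λ a b c → t c b a))
      (trans (cong₂ _+_ (trans (sum₃-+ (λ a b c → t a b c + t a c b + t b a c + t b c a) (λ a b c → t c a b))
        (cong₂ _+_ (trans (sum₃-+ (λ a b c → t a b c + t a c b + t b a c) (λ a b c → t b c a))
        (cong₂ _+_ (trans (sum₃-+ (λ a b c → t a b c + t a c b) (λ a b c → t b a c))
        (cong₂ _+_ (trans (sum₃-+ t (λ a b c → t a c b)) (cong (λ x → τ + x) (sum₃-23 t))) (sum₃-12 t))) bca)) cab)) cba) (r τ))

  module LanguageForm (𝔸 : Alphabet) where
    open Alphabet 𝔸 public
    open Language 𝔸 public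

    new : State → Letter → ℤ
    new σ b = ⟦ ¬? (ad? σ b) ⟧

    -- The third indicator matters only for f = e: it excludes the repetition of a plain letter and
    -- admits that of a formal one.
    O : (State → ℤ) → State → Letter → Letter → ℤ
    O g σ e f = ι σ e * (ι σ f * (ι (σ ⊕ e) f * g (σ ⊕ e ⊕ f)))

    D : (State → ℤ) → State → Letter → ℤ
    D g σ e = ι σ e * sum (λ b → new σ b * (ι (σ ⊕ e) b * g (σ ⊕ e ⊕ b)))

    O-sym : ∀ g σ e f → O g σ e f ≡ O g σ f e
    O-sym g σ e f with e Finₚ.≟ f
    ... | yes refl = refl
    ... | no e≢f with ad? σ e | ad? σ f
    ...   | no _ | no _ = refl
    ...   | no _ | yes _ = refl
    ...   | yes _ | no _ = refl
    ...   | yes ae | yes af = cong (λ x → 1ℤ * (1ℤ * x)) (cong₂ _*_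
              (trans (⟦⟧-yes (ad? (σ ⊕ e) f) (ad-keep (e≢f ∘ sym) af)) (sym (⟦⟧-yes (ad? (σ ⊕ f) e) (ad-keep e≢f ae))))
              (cong g (⊕-comm σ e f)))

    module M (g : State → ℤ) (σ : State) = Form (O g σ) (D g σ)

    HypAt : (State → ℤ) → State → Set
    HypAt g σ = Hyperbolic.Hyp (O g σ) (D g σ) (O-sym g σ)

    -- The restriction of a vector to the state σ ⊕ e: letters made available by e
    -- inherit the value at e.
    restrict : State → Letter → (Letter → ℤ) → Letter → ℤ
    restrict σ e w b = pick (ad? σ b) (w b) (w e)

    -- Letters available at σ enter through `O`, letters unlocked by e through the diagonal. As
    -- `restrict` gives the latter the value w(e), both merge into one sum over the words e b.
    row : ∀ g σ w e → M.app g σ w e ≡ ι σ e * sum (λ b → ι (σ ⊕ e) b * (restrict σ e w b * g (σ ⊕ e ⊕ b)))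
    row g σ w e = begin
        sum (λ f → O g σ e f * w f) + D g σ e * w e
          ≡⟨ cong₂ _+_ (sum-cong-≗ λ f → r₁ (ι σ e) (ι σ f) (ι (σ ⊕ e) f) (g (σ ⊕ e ⊕ f)) (w f)) (r₂ (ι σ e) (sum N-term) (w e)) ⟩
        sum (λ f → ι σ e * (ι σ f * (ι (σ ⊕ e) f * (w f * g (σ ⊕ e ⊕ f))))) + ι σ e * w e * sum N-term
          ≡⟨ cong₂ _+_ (∑-* (ι σ e) (λ f → ι σ f * (ι (σ ⊕ e) f * (w f * g (σ ⊕ e ⊕ f))))) (ℤₚ.*-assoc (ι σ e) (w e) (sum N-term)) ⟩
        ι σ e * sum (λ f → ι σ f * (ι (σ ⊕ e) f * (w f * g (σ ⊕ e ⊕ f)))) + ι σ e * (w e * sum N-term)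
          ≡⟨ sym (ℤₚ.*-distribˡ-+ (ι σ e) (sum (λ f → ι σ f * (ι (σ ⊕ e) f * (w f * g (σ ⊕ e ⊕ f))))) (w e * sum N-term)) ⟩
        ι σ e * (sum (λ f → ι σ f * (ι (σ ⊕ e) f * (w f * g (σ ⊕ e ⊕ f)))) + w e * sum N-term)
          ≡⟨ cong (ι σ e *_) (trans (cong (λ x → sum (λ f → ι σ f * (ι (σ ⊕ e) f * (w f * g (σ ⊕ e ⊕ f)))) + x) (sym (∑-* (w e) N-term)))
               (sym (∑-distrib-+ (λ f → ι σ f * (ι (σ ⊕ e) f * (w f * g (σ ⊕ e ⊕ f)))) (λ f → w e * N-term f)))) ⟩
        ι σ e * sum (λ f → ι σ f * (ι (σ ⊕ e) f * (w f * g (σ ⊕ e ⊕ f))) + w e * N-term f)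
          ≡⟨ cong (ι σ e *_) (sum-cong-≗ λ f → pointwise f) ⟩
        ι σ e * sum (λ b → ι (σ ⊕ e) b * (restrict σ e w b * g (σ ⊕ e ⊕ b))) ∎
      where
      open ≡-Reasoning
      N-term : Letter → ℤ
      N-term b = new σ b * (ι (σ ⊕ e) b * g (σ ⊕ e ⊕ b))
      r₁ : ∀ a b c x y → a * (b * (c * x)) * y ≡ a * (b * (c * (y * x)))
      r₁ = solve-∀
      r₂ : ∀ a s w → a * s * w ≡ a * w * s
      r₂ = solve-∀
      r₃ : ∀ i x g y → 1ℤ * (i * (x * g)) + y * (0ℤ * (i * g)) ≡ i * (x * g)
      r₃ = solve-∀
      r₄ : ∀ i x g y → 0ℤ * (i * (x * g)) + y * (1ℤ * (i * g)) ≡ i * (y * g)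
      r₄ = solve-∀
      pointwise : ∀ f → ι σ f * (ι (σ ⊕ e) f * (w f * g (σ ⊕ e ⊕ f))) + w e * N-term f
        ≡ ι (σ ⊕ e) f * (restrict σ e w f * g (σ ⊕ e ⊕ f))
      pointwise f with ad? σ f
      ... | yes _ = r₃ (ι (σ ⊕ e) f) (w f) (g (σ ⊕ e ⊕ f)) (w e)
      ... | no _ = r₄ (ι (σ ⊕ e) f) (w f) (g (σ ⊕ e ⊕ f)) (w e)

    O≥0 : ∀ {g} → (∀ σ → 0ℤ ≤ g σ) → ∀ σ e f → 0ℤ ≤ O g σ e f
    O≥0 g≥0 σ e f = guard≥0 (ad? σ e) (guard≥0 (ad? σ f) (guard≥0 (ad? (σ ⊕ e) f) (g≥0 _)))

    D≥0 : ∀ {g} → (∀ σ → 0ℤ ≤ g σ) → ∀ σ e → 0ℤ ≤ D g σ e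
    D≥0 g≥0 σ e = guard≥0 (ad? σ e) (∑-≥0 λ b → guard≥0 (¬? (ad? σ b)) (guard≥0 (ad? (σ ⊕ e) b) (g≥0 _)))

    -- Ensures that `restrict` fixes h on the letters available next: an unlocked letter weighs as
    -- much as the one unlocking it.
    Compatible : (Letter → ℤ) → Set
    Compatible h = ∀ {x y} → x ≺ y → h x ≡ h y

    restrict-h : ∀ {h} → Compatible h → ∀ {σ e b} → Ad (σ ⊕ e) b → restrict σ e h b ≡ h b
    restrict-h hc {σ} {e} {b} a with ad? σ b
    ... | yes _ = refl
    ... | no ¬a = hc (ad-new ¬a a)

    -- Pairing with h sums over the second letter, which creates one more free position. This ties
    -- the forms of `g` to those of `free h g`.
    row-h : ∀ {h} → Compatible h → ∀ g σ e → M.app g σ h e ≡ ι σ e * free h g (σ ⊕ e)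
    row-h {h} hc g σ e = trans (row g σ h e) (cong (ι σ e *_) (sum-cong-≗ λ b →
        trans (*-guard (ad? (σ ⊕ e) b) (λ a → cong (_* g (σ ⊕ e ⊕ b)) (restrict-h hc a))) (r (ι (σ ⊕ e) b) (h b) (g (σ ⊕ e ⊕ b)))))
      where
      r : ∀ i h g → i * (h * g) ≡ h * (i * g)
      r = solve-∀

    form-h : ∀ {h} → Compatible h → ∀ g σ w → M.form g σ w h ≡ sum (λ e → w e * (ι σ e * free h g (σ ⊕ e)))
    form-h hc g σ w = sum-cong-≗ λ e → cong (w e *_) (row-h hc g σ e)

  -- A free position

  module Pull (𝔸 : Alphabet) (h : Fin (Alphabet.N 𝔸) → ℤ) (h≥0 : ∀ x → 0ℤ ≤ h x)
    (hc : LanguageForm.Compatible 𝔸 h)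
    (g : Language.State 𝔸 → ℤ) (g≥0 : ∀ σ → 0ℤ ≤ g σ) (σ : Language.State 𝔸) (w : Fin (Alphabet.N 𝔸) → ℤ) where
    open LanguageForm 𝔸

    W : Letter → Letter → Letter → ℤ
    W a b c = ι σ a * (ι (σ ⊕ a) b * (ι (σ ⊕ a ⊕ b) c * g (σ ⊕ a ⊕ b ⊕ c)))

    W≥0 : ∀ a b c → 0ℤ ≤ W a b c
    W≥0 a b c = guard≥0 (ad? σ a) (guard≥0 (ad? (σ ⊕ a) b) (guard≥0 (ad? (σ ⊕ a ⊕ b) c) (g≥0 _)))

    W-cong : ∀ {a b c x y} → (Ad σ a → Ad (σ ⊕ a) b → Ad (σ ⊕ a ⊕ b) c → x ≡ y) → W a b c * x ≡ W a b c * y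
    W-cong {a} {b} {c} {x} {y} p with ad? σ a
    ... | no _ = refl
    ... | yes pa with ad? (σ ⊕ a) b
    ...   | no _ = refl
    ...   | yes pb with ad? (σ ⊕ a ⊕ b) c
    ...     | no _ = refl
    ...     | yes pc = cong (1ℤ * (1ℤ * (1ℤ * g (σ ⊕ a ⊕ b ⊕ c))) *_) (p pa pb pc)

    W-first : ∀ {a b c} → ¬ Ad σ a → W a b c ≡ 0ℤ
    W-first {a} p with ad? σ a
    ... | yes q = contradiction q p
    ... | no _ = refl

    W-second : ∀ {a b c} → ¬ Ad (σ ⊕ a) b → W a b c ≡ 0ℤ
    W-second {a} {b} p with ad? (σ ⊕ a) b
    ... | yes q = contradiction q p
    ... | no _ = ℤₚ.*-zeroʳ (ι σ a)

    W-third : ∀ {a b c} → ¬ Ad (σ ⊕ a ⊕ b) c → W a b c ≡ 0ℤ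
    W-third {a} {b} {c} p with ad? (σ ⊕ a ⊕ b) c
    ... | yes q = contradiction q p
    ... | no _ = trans (cong (ι σ a *_) (ℤₚ.*-zeroʳ (ι (σ ⊕ a) b))) (ℤₚ.*-zeroʳ (ι σ a))

    swap-first : ∀ {τ} {F : State → ℤ} {a b} → Ad τ a → Ad τ b →
      ι τ a * (ι (τ ⊕ a) b * F (τ ⊕ a ⊕ b)) ≡ ι τ b * (ι (τ ⊕ b) a * F (τ ⊕ b ⊕ a))
    swap-first {τ} {F} {a} {b} pa pb with a Finₚ.≟ b
    ... | yes refl = refl
    ... | no a≢b = cong₂ _*_ (trans (⟦⟧-yes (ad? τ a) pa) (sym (⟦⟧-yes (ad? τ b) pb)))
        (cong₂ _*_ (trans (⟦⟧-yes (ad? (τ ⊕ a) b) (ad-keep (a≢b ∘ sym) pb)) (sym (⟦⟧-yes (ad? (τ ⊕ b) a) (ad-keep a≢b pa))))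
          (cong F (⊕-comm τ a b)))

    W-12 : ∀ {a b c} → Ad σ a → Ad σ b → W a b c ≡ W b a c
    W-12 {c = c} pa pb = swap-first {σ} {λ S → ι S c * g (S ⊕ c)} pa pb

    W-23 : ∀ {a b c} → Ad (σ ⊕ a) b → Ad (σ ⊕ a) c → W a b c ≡ W a c b
    W-23 {a} pb pc = cong (ι σ a *_) (swap-first {σ ⊕ a} {g} pb pc)

    W-23′ : ∀ {a b c} → Ad σ b → Ad σ c → W a b c ≡ W a c b
    W-23′ {a} {b} {c} pb pc = cases (ad? (σ ⊕ a) b) (ad? (σ ⊕ a) c)
      where
      cases : Dec (Ad (σ ⊕ a) b) → Dec (Ad (σ ⊕ a) c) → W a b c ≡ W a c b
      cases (yes qb) (yes qc) = W-23 qb qc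
      cases (no ¬q) _ = trans (W-second {a} ¬q) (sym (W-third {a} {c} (¬q ∘ ad-between a c pb)))
      cases (yes _) (no ¬q) = trans (W-third {a} {b} (¬q ∘ ad-between a b pc)) (sym (W-second {a} ¬q))

    w₃ : Letter → Letter → Letter → ℤ
    w₃ a b = restrict (σ ⊕ a) b (restrict σ a w)

    bracket : Letter → Letter → Letter → ℤ
    bracket a b c = restrict σ a w b * (h a * w₃ a b c - w a * h c)

    -- The contribution of the word a b c to the difference of the two sides of `pull`.
    t : Letter → Letter → Letter → ℤ
    t a b c = W a b c * bracket a b c

    t-none : ∀ {a b c} → ¬ Ad σ a → t a b c ≡ 0ℤ
    t-none {a} {b} {c} p = cong (_* bracket a b c) (W-first {a} p)

    t-second : ∀ {a b c} → ¬ Ad (σ ⊕ a) b → t a b c ≡ 0ℤ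
    t-second {a} {b} {c} p = cong (_* bracket a b c) (W-second {a} p)

    W*0 : ∀ {a b c x} → (Ad σ a → Ad (σ ⊕ a) b → Ad (σ ⊕ a ⊕ b) c → x ≡ 0ℤ) → W a b c * x ≡ 0ℤ
    W*0 {a} {b} {c} p = trans (W-cong p) (ℤₚ.*-zeroʳ (W a b c))

    antisym : ∀ x y z → x * (y * z - z * y) ≡ 0ℤ
    antisym = solve-∀

    -- Both later letters are unlocked, directly or not, by a. They inherit its value and its
    -- weight, and the bracket becomes antisymmetric.
    t-lone : ∀ {a b c} → ¬ Ad σ b → ¬ Ad σ c → t a b c ≡ 0ℤ
    t-lone {a} {b} {c} ¬b ¬c = W*0 {a} {b} {c} λ pa pb pc → trans (cong₂ (λ x y → x * (h a * y - w a * h c)) (pick-no (ad? σ b) ¬b) (third pb))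
        (trans (cong (λ x → w a * (h a * w a - w a * x)) (weight pb pc)) (antisym (w a) (h a) (w a)))
      where
      third : Ad (σ ⊕ a) b → w₃ a b c ≡ w a
      third pb with ad? (σ ⊕ a) c
      ... | yes _ = pick-no (ad? σ c) ¬c
      ... | no _ = pick-no (ad? σ b) ¬b
      weight : Ad (σ ⊕ a) b → Ad (σ ⊕ a ⊕ b) c → h c ≡ h a
      weight pb pc with ad? (σ ⊕ a) c
      ... | yes q = sym (hc (ad-new ¬c q))
      ... | no ¬q = sym (trans (hc (ad-new ¬b pb)) (hc (ad-new ¬q pc)))

    t-old-third : ∀ {a b c} → Ad σ c → t a b c ≡ W a b c * (restrict σ a w b * (h a * w c - w a * h c))
    t-old-third {a} {b} {c} pc = W-cong {a} {b} {c} λ _ _ q → cong (λ x → restrict σ a w b * (h a * x - w a * h c))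
      (trans (pick-yes (ad? (σ ⊕ a) c) (ad-between a b pc q)) (pick-yes (ad? σ c) pc))

    t-new-old : ∀ {a b c} → ¬ Ad σ b → Ad σ c → t a b c ≡ W a b c * (w a * (h a * w c - w a * h c))
    t-new-old {a} {b} {c} ¬b pc = trans (t-old-third pc) (cong (λ x → W a b c * (x * (h a * w c - w a * h c))) (pick-no (ad? σ b) ¬b))

    t-old-old : ∀ {a b c} → Ad σ b → Ad σ c → t a b c ≡ W a b c * (w b * (h a * w c - w a * h c))
    t-old-old {a} {b} {c} pb pc = trans (t-old-third pc) (cong (λ x → W a b c * (x * (h a * w c - w a * h c))) (pick-yes (ad? σ b) pb))

    t-new-by-first : ∀ {a b c} → ¬ Ad σ c → Ad (σ ⊕ a) c → t a b c ≡ 0ℤ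
    t-new-by-first {a} {b} {c} ¬c q = W*0 {a} {b} {c} λ _ _ _ →
      trans (cong₂ (λ x y → restrict σ a w b * (h a * x - w a * y)) (trans (pick-yes (ad? (σ ⊕ a) c) q) (pick-no (ad? σ c) ¬c)) (sym (hc (ad-new ¬c q))))
        (antisym (restrict σ a w b) (h a) (w a))

    t-new-by-second : ∀ {a b c} → Ad σ b → ¬ Ad (σ ⊕ a) c → t a b c ≡ W a b c * (w b * (h a * w b - w a * h b))
    t-new-by-second {a} {b} {c} pb ¬q = W-cong {a} {b} {c} λ _ _ pc →
      trans (cong₂ (λ x y → x * (h a * y - w a * h c)) (pick-yes (ad? σ b) pb) (trans (pick-no (ad? (σ ⊕ a) c) ¬q) (pick-yes (ad? σ b) pb)))
        (cong (λ x → w b * (h a * w b - w a * x)) (sym (hc (ad-new ¬q pc))))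

    S : Letter → Letter → Letter → ℤ
    S = symmetrised t

    zero₆ : ∀ {x₁ x₂ x₃ x₄ x₅ x₆} → x₁ ≡ 0ℤ → x₂ ≡ 0ℤ → x₃ ≡ 0ℤ → x₄ ≡ 0ℤ → x₅ ≡ 0ℤ → x₆ ≡ 0ℤ →
      x₁ + x₂ + x₃ + x₄ + x₅ + x₆ ≡ 0ℤ
    zero₆ refl refl refl refl refl refl = refl

    cong₆ : ∀ {x₁ x₂ x₃ x₄ x₅ x₆ y₁ y₂ y₃ y₄ y₅ y₆ : ℤ} → x₁ ≡ y₁ → x₂ ≡ y₂ → x₃ ≡ y₃ → x₄ ≡ y₄ → x₅ ≡ y₅ → x₆ ≡ y₆ →
      x₁ + x₂ + x₃ + x₄ + x₅ + x₆ ≡ y₁ + y₂ + y₃ + y₄ + y₅ + y₆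
    cong₆ refl refl refl refl refl refl = refl

    -- All six orders carry the same weight W(a, b, c), so that the brackets cancel.
    S-three : ∀ {a b c} → Ad σ a → Ad σ b → Ad σ c → S a b c ≡ 0ℤ
    S-three {a} {b} {c} pa pb pc = trans (cong₆ (t-old-old pb pc)
        (trans (t-old-old pc pb) (cong (_* (w c * (h a * w b - w a * h b))) (W-23′ pc pb)))
        (trans (t-old-old pa pc) (cong (_* (w a * (h b * w c - w b * h c))) (W-12 pb pa)))
        (trans (t-old-old pc pa) (cong (_* (w c * (h b * w a - w b * h a))) (trans (W-23′ pc pa) (W-12 pb pa))))
        (trans (t-old-old pa pb) (cong (_* (w a * (h c * w b - w c * h b))) (trans (W-12 pc pa) (W-23′ pc pb))))
        (trans (t-old-old pb pa) (cong (_* (w b * (h c * w a - w c * h a))) (trans (W-12 pc pb) (trans (W-23′ pc pa) (W-12 pb pa))))))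
      (r (W a b c) (w a) (w b) (w c) (h a) (h b) (h c))
      where
      r : ∀ W x y z p q s → W * (y * (p * z - x * s)) + W * (z * (p * y - x * q)) + W * (x * (q * z - y * s))
        + W * (z * (q * x - y * p)) + W * (x * (s * y - z * q)) + W * (y * (s * x - z * p)) ≡ 0ℤ
      r = solve-∀

    -- If a or b alone unlocks c, everything cancels. If both are needed, only a b c and b a c
    -- remain; compatibility equates the weights of a and b, and W h(a)(w(a) - w(b))² is left. This
    -- is the only case in which the symmetrised term need not vanish.
    S-two : ∀ {a b c} → Ad σ a → Ad σ b → ¬ Ad σ c → 0ℤ ≤ S a b c
    S-two {a} {b} {c} pa pb ¬c = cases (ad? (σ ⊕ a) c) (ad? (σ ⊕ b) c)
      where
      cab : t c a b ≡ 0ℤ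
      cab = t-none ¬c
      cba : t c b a ≡ 0ℤ
      cba = t-none ¬c
      acb : t a c b ≡ W a c b * (w a * (h a * w b - w a * h b))
      acb = t-new-old ¬c pb
      bca : t b c a ≡ W b c a * (w b * (h b * w a - w b * h a))
      bca = t-new-old ¬c pa
      cases : Dec (Ad (σ ⊕ a) c) → Dec (Ad (σ ⊕ b) c) → 0ℤ ≤ S a b c
      cases (yes p) (yes q) with ad-new-unique ¬c p q
      ... | refl = ℤₚ.≤-reflexive (sym (zero₆ (t-new-by-first ¬c p) van (t-new-by-first ¬c p) van cab cab))
        where
        van : t a c a ≡ 0ℤ
        van = trans acb (r (W a c a) (w a) (h a))
          where
          r : ∀ W x p → W * (x * (p * x - x * p)) ≡ 0ℤ
          r = solve-∀
      cases (yes p) (no ¬q) = ℤₚ.≤-reflexive (sym (trans (cong₆ (t-new-by-first ¬c p) acb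
          (trans (t-new-by-second pa ¬q) (cong (_* (w a * (h b * w a - w b * h a))) (trans (W-12 pb pa) (W-23 (ad-keep b≢a pb) p))))
          (t-second ¬q) cab cba) (r (W a c b) (w a) (w b) (h a) (h b))))
        where
        b≢a : b ≢ a
        b≢a refl = ¬q p
        r : ∀ W x y p q → 0ℤ + W * (x * (p * y - x * q)) + W * (x * (q * x - y * p)) + 0ℤ + 0ℤ + 0ℤ ≡ 0ℤ
        r = solve-∀
      cases (no ¬p) (yes q) = ℤₚ.≤-reflexive (sym (trans (cong₆
          (trans (t-new-by-second pb ¬p) (cong (_* (w b * (h a * w b - w a * h b))) (trans (W-12 pa pb) (W-23 (ad-keep a≢b pa) q))))
          (t-second ¬p) (t-new-by-first ¬c q) bca cab cba) (r (W b c a) (w a) (w b) (h a) (h b))))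
        where
        a≢b : a ≢ b
        a≢b refl = ¬p q
        r : ∀ W x y p q → W * (y * (p * y - x * q)) + 0ℤ + 0ℤ + W * (y * (q * x - y * p)) + 0ℤ + 0ℤ ≡ 0ℤ
        r = solve-∀
      cases (no ¬p) (no ¬q) = subst (0ℤ ≤_) (sym eq) (0≤* (W≥0 a b c) (0≤* (h≥0 a) (0≤sq (w a - w b))))
        where
        r : ∀ W x y p q → W * (y * (p * y - x * q)) + 0ℤ + W * (x * (q * x - y * p)) + 0ℤ + 0ℤ + 0ℤ
          ≡ W * (y * (p * y - x * q) + x * (q * x - y * p))
        r = solve-∀
        r₂ : ∀ x y p → y * (p * y - x * p) + x * (p * x - y * p) ≡ p * ((x - y) * (x - y))
        r₂ = solve-∀
        eq : S a b c ≡ W a b c * (h a * ((w a - w b) * (w a - w b)))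
        eq = trans (cong₆ (t-new-by-second pb ¬p) (t-second ¬p)
            (trans (t-new-by-second pa ¬q) (cong (_* (w a * (h b * w a - w b * h a))) (W-12 pb pa))) (t-second ¬q) cab cba)
          (trans (r (W a b c) (w a) (w b) (h a) (h b)) (W-cong {a} {b} {c} λ _ _ pc →
            trans (cong (λ x → w b * (h a * w b - w a * x) + w a * (x * w a - w b * h a))
              (trans (hc (ad-new ¬p pc)) (sym (hc (ad-new ¬q (subst (λ τ → Ad τ c) (⊕-comm σ a b) pc))))))
              (r₂ (w a) (w b) (h a))))

    S-swap₁ : ∀ a b c → S b a c ≡ S a b c
    S-swap₁ a b c = r (t a b c) (t a c b) (t b a c) (t b c a) (t c a b) (t c b a)
      where
      r : ∀ x₁ x₂ x₃ x₄ x₅ x₆ → x₃ + x₄ + x₁ + x₂ + x₆ + x₅ ≡ x₁ + x₂ + x₃ + x₄ + x₅ + x₆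
      r = solve-∀

    S-swap₂ : ∀ a b c → S a c b ≡ S a b c
    S-swap₂ a b c = r (t a b c) (t a c b) (t b a c) (t b c a) (t c a b) (t c b a)
      where
      r : ∀ x₁ x₂ x₃ x₄ x₅ x₆ → x₂ + x₁ + x₅ + x₆ + x₃ + x₄ ≡ x₁ + x₂ + x₃ + x₄ + x₅ + x₆
      r = solve-∀

    S-one : ∀ {a b c} → ¬ Ad σ b → ¬ Ad σ c → S a b c ≡ 0ℤ
    S-one ¬b ¬c = zero₆ (t-lone ¬b ¬c) (t-lone ¬c ¬b) (t-none ¬b) (t-none ¬b) (t-none ¬c) (t-none ¬c)

    S≥0 : ∀ a b c → 0ℤ ≤ S a b c
    S≥0 a b c = cases (ad? σ a) (ad? σ b) (ad? σ c)
      where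
      cases : Dec (Ad σ a) → Dec (Ad σ b) → Dec (Ad σ c) → 0ℤ ≤ S a b c
      cases (yes p) (yes q) (yes r) = ℤₚ.≤-reflexive (sym (S-three p q r))
      cases (yes p) (yes q) (no r) = S-two p q r
      cases (yes p) (no q) (yes r) = subst (0ℤ ≤_) (S-swap₂ a b c) (S-two p r q)
      cases (no p) (yes q) (yes r) = subst (0ℤ ≤_) (trans (S-swap₂ b a c) (S-swap₁ a b c)) (S-two q r p)
      cases _ (no q) (no r) = ℤₚ.≤-reflexive (sym (S-one {a} q r))
      cases (no p) (yes q) (no r) = ℤₚ.≤-reflexive (sym (trans (sym (S-swap₁ a b c)) (S-one {b} p r)))
      cases (no p) (no q) (yes r) = ℤₚ.≤-reflexive (sym (trans (sym (trans (S-swap₁ a c b) (S-swap₂ a b c))) (S-one {c} p q)))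

    Q : Letter → ℤ
    Q e = ι σ e * M.form g (σ ⊕ e) (restrict σ e w) (restrict σ e w)

    lower : M.form (free h g) σ w w ≡ sum₃ (λ a b c → W a b c * (w a * (restrict σ a w b * h c)))
    lower = sum-cong-≗ λ a → begin
        w a * M.app (free h g) σ w a
          ≡⟨ cong (w a *_) (row (free h g) σ w a) ⟩
        w a * (ι σ a * sum (λ b → ι (σ ⊕ a) b * (restrict σ a w b * free h g (σ ⊕ a ⊕ b))))
          ≡⟨ trans (sym (ℤₚ.*-assoc (w a) (ι σ a) (sum (λ b → ι (σ ⊕ a) b * (restrict σ a w b * free h g (σ ⊕ a ⊕ b))))))
               (sym (∑-* (w a * ι σ a) (λ b → ι (σ ⊕ a) b * (restrict σ a w b * free h g (σ ⊕ a ⊕ b))))) ⟩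
        sum (λ b → w a * ι σ a * (ι (σ ⊕ a) b * (restrict σ a w b * free h g (σ ⊕ a ⊕ b))))
          ≡⟨ sum-cong-≗ (λ b → trans (r₁ (w a) (ι σ a) (ι (σ ⊕ a) b) (restrict σ a w b) (free h g (σ ⊕ a ⊕ b)))
               (trans (sym (∑-* (w a * ι σ a * (ι (σ ⊕ a) b * restrict σ a w b)) (λ c → h c * (ι (σ ⊕ a ⊕ b) c * g (σ ⊕ a ⊕ b ⊕ c)))))
                 (sum-cong-≗ λ c → r₂ (w a) (ι σ a) (ι (σ ⊕ a) b) (restrict σ a w b) (h c) (ι (σ ⊕ a ⊕ b) c) (g (σ ⊕ a ⊕ b ⊕ c))))) ⟩
        sum (λ b → sum (λ c → W a b c * (w a * (restrict σ a w b * h c)))) ∎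
      where
      open ≡-Reasoning
      r₁ : ∀ x i j v f → x * i * (j * (v * f)) ≡ x * i * (j * v) * f
      r₁ = solve-∀
      r₂ : ∀ x i j v h k g → x * i * (j * v) * (h * (k * g)) ≡ i * (j * (k * g)) * (x * (v * h))
      r₂ = solve-∀

    upper : sum (λ e → h e * Q e) ≡ sum₃ (λ a b c → W a b c * (h a * (restrict σ a w b * w₃ a b c)))
    upper = sum-cong-≗ λ a → begin
        h a * (ι σ a * M.form g (σ ⊕ a) (restrict σ a w) (restrict σ a w))
          ≡⟨ trans (sym (ℤₚ.*-assoc (h a) (ι σ a) (M.form g (σ ⊕ a) (restrict σ a w) (restrict σ a w))))
               (sym (∑-* (h a * ι σ a) (λ b → restrict σ a w b * M.app g (σ ⊕ a) (restrict σ a w) b))) ⟩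
        sum (λ b → h a * ι σ a * (restrict σ a w b * M.app g (σ ⊕ a) (restrict σ a w) b))
          ≡⟨ sum-cong-≗ (λ b → trans (cong (λ x → h a * ι σ a * (restrict σ a w b * x)) (row g (σ ⊕ a) (restrict σ a w) b))
               (trans (r₁ (h a) (ι σ a) (restrict σ a w b) (ι (σ ⊕ a) b) (sum (λ c → ι (σ ⊕ a ⊕ b) c * (w₃ a b c * g (σ ⊕ a ⊕ b ⊕ c)))))
               (trans (sym (∑-* (h a * ι σ a * (restrict σ a w b * ι (σ ⊕ a) b)) (λ c → ι (σ ⊕ a ⊕ b) c * (w₃ a b c * g (σ ⊕ a ⊕ b ⊕ c)))))
                 (sum-cong-≗ λ c → r₂ (h a) (ι σ a) (restrict σ a w b) (ι (σ ⊕ a) b) (ι (σ ⊕ a ⊕ b) c) (w₃ a b c) (g (σ ⊕ a ⊕ b ⊕ c)))))) ⟩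
        sum (λ b → sum (λ c → W a b c * (h a * (restrict σ a w b * w₃ a b c)))) ∎
      where
      open ≡-Reasoning
      r₁ : ∀ x i v j f → x * i * (v * (j * f)) ≡ x * i * (v * j) * f
      r₁ = solve-∀
      r₂ : ∀ x i v j k y g → x * i * (v * j) * (k * (y * g)) ≡ i * (j * (k * g)) * (x * (v * y))
      r₂ = solve-∀

    pull : M.form (free h g) σ w w ≤ sum (λ e → h e * Q e)
    pull = ℤₚ.0≤i-j⇒j≤i (subst (0ℤ ≤_) eq (sum₃-sym t S≥0))
      where
      r₁ : ∀ W v x y z s → W * (v * (x * y - z * s)) + W * (z * (v * s)) ≡ W * (x * (v * y))
      r₁ = solve-∀
      r₂ : ∀ x y → x ≡ x + y - y
      r₂ = solve-∀
      eq : sum₃ t ≡ sum (λ e → h e * Q e) - M.form (free h g) σ w w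
      eq = trans (r₂ (sum₃ t) (M.form (free h g) σ w w)) (cong (_- M.form (free h g) σ w w)
        (trans (cong (λ x → sum₃ t + x) lower) (trans (sym (sum₃-+ t (λ a b c → W a b c * (w a * (restrict σ a w b * h c)))))
          (trans (sum₃-cong λ a b c → r₁ (W a b c) (restrict σ a w b) (h a) (w₃ a b c) (w a) (h c)) (sym upper)))))

  record Weights (𝔸 : Alphabet) : Set where
    open LanguageForm 𝔸
    field
      h co : Letter → ℤ
      H : ℤ
      h>0 : ∀ x → 0ℤ < h x
      H>0 : 0ℤ < H
      co-h : ∀ x → co x * h x ≡ H
      compatible : Compatible h

  module FreeStep (𝔸 : Alphabet) (ω : Weights 𝔸) (g : Language.State 𝔸 → ℤ) (g≥0 : ∀ σ → 0ℤ ≤ g σ)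
    (ex : Language.Exchange 𝔸 g) (hyp : ∀ σ → LanguageForm.HypAt 𝔸 g σ) (σ : Language.State 𝔸) where
    open LanguageForm 𝔸
    open Weights ω

    h≥0 : ∀ x → 0ℤ ≤ h x
    h≥0 x = ℤₚ.<⇒≤ (h>0 x)

    g′ : State → ℤ
    g′ = free h g

    g′≥0 : ∀ τ → 0ℤ ≤ g′ τ
    g′≥0 = free≥0 h≥0 g≥0

    Q : Letter → (Letter → ℤ) → ℤ
    Q e w = Pull.Q 𝔸 h h≥0 compatible g g≥0 σ w e

    private
      module P = Weighted (O g′ σ) (D g′ σ) (O-sym g′ σ) (O≥0 g′≥0 σ) (D≥0 g′≥0 σ) h co H h>0 H>0 co-h Q

    form-restrict : ∀ w e → M.app g′ σ w e ≡ ι σ e * M.form g (σ ⊕ e) (restrict σ e w) h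
    form-restrict w e = trans (row g′ σ w e) (cong (ι σ e *_) (trans
        (sum-cong-≗ λ b → r (ι (σ ⊕ e) b) (restrict σ e w b) (g′ (σ ⊕ e ⊕ b)))
        (sym (form-h compatible g (σ ⊕ e) (restrict σ e w)))))
      where
      r : ∀ i x y → i * (x * y) ≡ x * (i * y)
      r = solve-∀

    m-form : ∀ e → P.m e ≡ ι σ e * M.form g (σ ⊕ e) h h
    m-form e = trans (form-restrict h e) (cong (ι σ e *_) (sum-cong-≗ λ b →
        trans (cong (restrict σ e h b *_) (row-h compatible g (σ ⊕ e) b))
       (trans (r (restrict σ e h b) (ι (σ ⊕ e) b) (g′ (σ ⊕ e ⊕ b)))
       (trans (*-guard (ad? (σ ⊕ e) b) (λ a → cong (_* g′ (σ ⊕ e ⊕ b)) (restrict-h compatible a)))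
       (trans (sym (r (h b) (ι (σ ⊕ e) b) (g′ (σ ⊕ e ⊕ b)))) (cong (h b *_) (sym (row-h compatible g (σ ⊕ e) b))))))))
      where
      r : ∀ x i y → x * (i * y) ≡ i * (x * y)
      r = solve-∀

    -- The entries are nonnegative and h is positive, so a zero value at h annihilates the whole
    -- form. This covers the prefixes at which the reverse Cauchy-Schwarz inequality has no positive
    -- vector to start from.
    form-vanishes : ∀ τ → M.form g τ h h ≡ 0ℤ → ∀ v → M.form g τ v v ≡ 0ℤ
    form-vanishes τ z v = ∑-zero λ b → trans (cong (v b *_) (trans (row g τ v b) (vanish b))) (ℤₚ.*-zeroʳ (v b))
      where
      z₁ : ∀ b → ι τ b * g′ (τ ⊕ b) ≡ 0ℤ
      z₁ b = *≡0 (h>0 b) (∑≡0⇒ (λ b → 0≤* (h≥0 b) (guard≥0 (ad? τ b) (g′≥0 (τ ⊕ b)))) (trans (sym (form-h compatible g τ h)) z) b)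
      r : ∀ i j x y → i * (j * (x * y)) ≡ x * (j * (i * y))
      r = solve-∀
      vanish : ∀ b → ι τ b * sum (λ c → ι (τ ⊕ b) c * (restrict τ b v c * g (τ ⊕ b ⊕ c))) ≡ 0ℤ
      vanish b = cases (ad? τ b)
        where
        inner : ℤ
        inner = sum (λ c → ι (τ ⊕ b) c * (restrict τ b v c * g (τ ⊕ b ⊕ c)))
        r₂ : ∀ i x y → i * (x * y) ≡ x * (i * y)
        r₂ = solve-∀
        cases : Dec (Ad τ b) → ι τ b * inner ≡ 0ℤ
        cases (no ¬p) = cong (_* inner) (⟦⟧-no (ad? τ b) ¬p)
        cases (yes p) = trans (cong (ι τ b *_) (∑-zero λ c → trans (r₂ (ι (τ ⊕ b) c) (restrict τ b v c) (g (τ ⊕ b ⊕ c)))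
              (trans (cong (restrict τ b v c *_) (*≡0 (h>0 c)
                (∑≡0⇒ (λ c → 0≤* (h≥0 c) (guard≥0 (ad? (τ ⊕ b) c) (g≥0 (τ ⊕ b ⊕ c)))) z₂ c)))
                (ℤₚ.*-zeroʳ (restrict τ b v c))))) (ℤₚ.*-zeroʳ (ι τ b))
          where
          z₂ : g′ (τ ⊕ b) ≡ 0ℤ
          z₂ = trans (sym (ℤₚ.*-identityˡ (g′ (τ ⊕ b)))) (trans (cong (_* g′ (τ ⊕ b)) (sym (⟦⟧-yes (ad? τ b) p))) (z₁ b))

    -- Reverse Cauchy-Schwarz at the prefix σ e: there m(e) is the form of h, and `app` is the mixed
    -- value of h and the restricted vector.
    Q-bound : ∀ e w → 0ℤ < P.m e → Q e w * P.m e ≤ M.app g′ σ w e * M.app g′ σ w e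
    Q-bound e w m>0 = subst₂ _≤_ (sym (trans (cong₂ _*_ qe me) (ℤₚ.*-comm F h′))) (sym (cong₂ _*_ ae ae))
        (Hyperbolic.reverse-CS (O g (σ ⊕ e)) (D g (σ ⊕ e)) (O-sym g (σ ⊕ e)) (hyp (σ ⊕ e)) h (restrict σ e w) (proj₂ pos))
      where
      F h′ c : ℤ
      F = M.form g (σ ⊕ e) (restrict σ e w) (restrict σ e w)
      h′ = M.form g (σ ⊕ e) h h
      c = M.form g (σ ⊕ e) (restrict σ e w) h
      pos : Ad σ e × 0ℤ < M.form g (σ ⊕ e) h h
      pos = 0<guard (ad? σ e) (subst (0ℤ <_) (m-form e) m>0)
      one : ι σ e ≡ 1ℤ
      one = ⟦⟧-yes (ad? σ e) (proj₁ pos)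
      qe : Q e w ≡ M.form g (σ ⊕ e) (restrict σ e w) (restrict σ e w)
      qe = trans (cong (_* F) one) (ℤₚ.*-identityˡ F)
      me : P.m e ≡ M.form g (σ ⊕ e) h h
      me = trans (m-form e) (trans (cong (_* h′) one) (ℤₚ.*-identityˡ h′))
      ae : M.app g′ σ w e ≡ M.form g (σ ⊕ e) h (restrict σ e w)
      ae = trans (form-restrict w e) (trans (cong (_* c) one)
        (trans (ℤₚ.*-identityˡ c) (M.form-sym g (σ ⊕ e) (O-sym g (σ ⊕ e)) (restrict σ e w) h)))

    Q-zero : ∀ e w → P.m e ≡ 0ℤ → Q e w ≤ 0ℤ
    Q-zero e w z = cases (ad? σ e)
      where
      F h′ : ℤ
      F = M.form g (σ ⊕ e) (restrict σ e w) (restrict σ e w)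
      h′ = M.form g (σ ⊕ e) h h
      cases : Dec (Ad σ e) → ι σ e * F ≤ 0ℤ
      cases (no ¬p) = ℤₚ.≤-reflexive (cong (_* F) (⟦⟧-no (ad? σ e) ¬p))
      cases (yes p) = ℤₚ.≤-reflexive (trans (cong (ι σ e *_) (form-vanishes (σ ⊕ e)
          (trans (sym (ℤₚ.*-identityˡ h′)) (trans (cong (_* h′) (sym (⟦⟧-yes (ad? σ e) p))) (trans (sym (m-form e)) z))) (restrict σ e w)))
        (ℤₚ.*-zeroʳ (ι σ e)))

    O-positive : ∀ {e f c} → Ad σ e → Ad σ f → Ad (σ ⊕ e) f → Ad (σ ⊕ e ⊕ f) c → 0ℤ < g (σ ⊕ e ⊕ f ⊕ c) → 0ℤ < O g′ σ e f
    O-positive {e} {f} {c} ae af aef ac p = guard>0 (ad? σ e) ae (guard>0 (ad? σ f) af (guard>0 (ad? (σ ⊕ e) f) aef (free>0 h>0 g≥0 ac p)))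

    Word : Letter → Letter → Letter → Set
    Word a b c = Ad σ a × Ad (σ ⊕ a) b × Ad (σ ⊕ a ⊕ b) c × 0ℤ < g (σ ⊕ a ⊕ b ⊕ c)

    word : ∀ e → 0ℤ < P.m e → ∃₂ λ b c → Word e b c
    word e p = b , c , proj₁ s₁ , proj₁ s₃ , proj₁ (proj₂ s₄) , proj₂ (proj₂ s₄)
      where
      term : Letter → ℤ
      term b = h b * (ι (σ ⊕ e) b * g′ (σ ⊕ e ⊕ b))
      s₁ : Ad σ e × 0ℤ < M.form g (σ ⊕ e) h h
      s₁ = 0<guard (ad? σ e) (subst (0ℤ <_) (m-form e) p)
      s₂ : ∃ λ b → 0ℤ < term b
      s₂ = ∑>0⇒ {f = term} (λ b → 0≤* (h≥0 b) (guard≥0 (ad? (σ ⊕ e) b) (g′≥0 (σ ⊕ e ⊕ b))))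
             (subst (0ℤ <_) (form-h compatible g (σ ⊕ e) h) (proj₂ s₁))
      b : Letter
      b = proj₁ s₂
      s₃ : Ad (σ ⊕ e) b × 0ℤ < g′ (σ ⊕ e ⊕ b)
      s₃ = 0<guard (ad? (σ ⊕ e) b) (ℤₚ.*-cancelˡ-<-nonNeg (h b) {{nonNegative (h≥0 b)}}
             (subst (_< term b) (sym (ℤₚ.*-zeroʳ (h b))) (proj₂ s₂)))
      s₄ : ∃ λ c → Ad (σ ⊕ e ⊕ b) c × 0ℤ < g (σ ⊕ e ⊕ b ⊕ c)
      s₄ = free>0⇒ h>0 g≥0 (proj₂ s₃)
      c : Letter
      c = proj₁ s₄

    -- An available letter of the word can be moved to its second place.
    adjacent : ∀ {a b c y} → Word a b c → Ad σ y → lookup σ y ℕ.< lookup (σ ⊕ a ⊕ b ⊕ c) y → y ≡ a ⊎ 0ℤ < O g′ σ a y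
    adjacent {a} {b} {c} {y} (aa , ab , ac , p) ay lt with y Finₚ.≟ a
    ... | yes e = inj₁ e
    ... | no y≢a with y Finₚ.≟ b
    ...   | yes refl = inj₂ (O-positive aa ay ab ac p)
    ...   | no y≢b with y Finₚ.≟ c
    ...     | yes refl = inj₂ (O-positive aa ay (ad-keep y≢a ay) (ad-keep (y≢b ∘ sym) ab) (subst (λ S → 0ℤ < g S) (⊕-comm (σ ⊕ a) b y) p))
    ...     | no y≢c = contradiction (sym (trans (look-other (σ ⊕ a ⊕ b) y≢c) (trans (look-other (σ ⊕ a) y≢b) (look-other σ y≢a)))) (ℕₚ.<⇒≢ lt)

    path : ∀ {a b c} → Word a b c → Path σ 3 (σ ⊕ a ⊕ b ⊕ c)
    path (aa , ab , ac , _) = snoc (snoc (snoc nil aa) ab) ac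

    first-grows : ∀ a b c → lookup σ a ℕ.< lookup (σ ⊕ a ⊕ b ⊕ c) a
    first-grows a b c = ℕₚ.<-≤-trans (subst (lookup σ a ℕ.<_) (sym (look-same σ a)) (ℕₚ.n<1+n _))
      (ℕₚ.≤-trans (look-mono (σ ⊕ a) b a) (look-mono (σ ⊕ a ⊕ b) c a))

    keep-absent : ∀ {k J y} → Path σ k J → Ad σ y → lookup J y ℕ.≤ lookup σ y → Ad J y
    keep-absent nil a _ = a
    keep-absent {y = y} (snoc {K = K} {x} p _) a le = ad-keep y≢x (keep-absent p a (ℕₚ.≤-trans (look-mono K x y) le))
      where
      y≢x : y ≢ x
      y≢x refl = ℕₚ.<⇒≱ (subst (lookup K y ℕ.<_) (sym (look-same K y)) (ℕₚ.n<1+n _)) (ℕₚ.≤-trans le (path-mono p y))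

    Joined : Letter → Letter → Set
    Joined e f = ∃ λ y → (y ≡ e ⊎ 0ℤ < O g′ σ e y) × (f ≡ y ⊎ 0ℤ < O g′ σ y f)

    -- Either f occurs in the word of e and is adjacent to e, or exchanging f into that word yields
    -- a word y₁ y₂ f. Its first letter stems from the word of e, so y₁ is adjacent or equal to e,
    -- and f to y₁.
    words-joined : ∀ {e b c f b′ c′} → Word e b c → Word f b′ c′ → Joined e f
    words-joined {e} {b} {c} {f} {b′} {c′} we wf@(af , _ , _ , gf) = cases (lookup σ f ℕₚ.<? lookup (σ ⊕ e ⊕ b ⊕ c) f)
      where
      cases : Dec (lookup σ f ℕ.< lookup (σ ⊕ e ⊕ b ⊕ c) f) → Joined e f
      cases (yes lt) = f , adjacent we af lt , inj₁ refl
      cases (no ¬lt) with ex (path we) (path wf) (proj₂ (proj₂ (proj₂ we))) gf (keep-absent (path we) af (ℕₚ.≮⇒≥ ¬lt))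
                         (ℕₚ.≤-<-trans (ℕₚ.≮⇒≥ ¬lt) (first-grows f b′ c′))
      ... | _ , u , (_ , refl , snoc {x = y₂} (snoc {x = y₁} nil a₁) a₂) , au , eq , _ , aKf , gK =
        y₁ , adjacent we a₁ (subst (λ S → lookup σ y₁ ℕ.< lookup S y₁) eq (first-grows y₁ y₂ u)) ,
        adjacent (a₁ , a₂ , aKf , gK) af
          (subst (lookup σ f ℕ.<_) (sym (look-same (σ ⊕ y₁ ⊕ y₂) f)) (ℕ.s≤s (ℕₚ.≤-trans (look-mono σ y₁ f) (look-mono (σ ⊕ y₁) y₂ f))))

    conn : ∀ e f → 0ℤ < P.m e → 0ℤ < P.m f → Joined e f
    conn e f me mf = words-joined (proj₂ (proj₂ (word e me))) (proj₂ (proj₂ (word f mf)))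

    hyp-free : HypAt g′ σ
    hyp-free = P.hyperbolic Q-bound Q-zero (Pull.pull 𝔸 h h≥0 compatible g g≥0 σ) conn

  -- A marked position

  guard-≤ : ∀ {P : Set} (d : Dec P) {x y} → 0ℤ ≤ y → (P → x ≤ y) → ⟦ d ⟧ * x ≤ y
  guard-≤ (yes p) {x} {y} _ q = subst (_≤ y) (sym (ℤₚ.*-identityˡ x)) (q p)
  guard-≤ (no _) q _ = q

  guard-yes : ∀ {P : Set} (d : Dec P) {x} → P → ⟦ d ⟧ * x ≡ x
  guard-yes d {x} p = trans (cong (_* x) (⟦⟧-yes d p)) (ℤₚ.*-identityˡ x)

  guard-no : ∀ {P : Set} (d : Dec P) {x} → ¬ P → ⟦ d ⟧ * x ≡ 0ℤ
  guard-no d {x} p = cong (_* x) (⟦⟧-no d p)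

  guard-zero : ∀ {P : Set} (d : Dec P) {x} → (P → x ≡ 0ℤ) → ⟦ d ⟧ * x ≡ 0ℤ
  guard-zero d {x} p = trans (*-guard d p) (ℤₚ.*-zeroʳ ⟦ d ⟧)

  module Degenerate (𝔸 : Alphabet) where
    open LanguageForm 𝔸

    O-zero : ∀ g σ e f → (Ad σ e → Ad σ f → Ad (σ ⊕ e) f → g (σ ⊕ e ⊕ f) ≡ 0ℤ) → O g σ e f ≡ 0ℤ
    O-zero g σ e f p = guard-zero (ad? σ e) {ι σ f * (ι (σ ⊕ e) f * g (σ ⊕ e ⊕ f))} λ ae →
      guard-zero (ad? σ f) {ι (σ ⊕ e) f * g (σ ⊕ e ⊕ f)} λ af → guard-zero (ad? (σ ⊕ e) f) (p ae af)

    D-zero : ∀ g σ e → (Ad σ e → ∀ b → ¬ Ad σ b → Ad (σ ⊕ e) b → g (σ ⊕ e ⊕ b) ≡ 0ℤ) → D g σ e ≡ 0ℤ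
    D-zero g σ e p = guard-zero (ad? σ e) {sum λ b → new σ b * (ι (σ ⊕ e) b * g (σ ⊕ e ⊕ b))} λ ae → ∑-zero λ b →
      guard-zero (¬? (ad? σ b)) {ι (σ ⊕ e) b * g (σ ⊕ e ⊕ b)} λ ¬ab → guard-zero (ad? (σ ⊕ e) b) (p ae b ¬ab)

    hyp-zero : ∀ g σ → (∀ e f → O g σ e f ≡ 0ℤ) → (∀ e → D g σ e ≡ 0ℤ) → HypAt g σ
    hyp-zero g σ Oz Dz = (λ _ → 0ℤ) , (λ s t _ _ _ _ → r s t) , λ w _ → ℤₚ.≤-reflexive
        (∑-zero λ e → trans (cong (w e *_) (cong₂ _+_ (∑-zero λ f → cong (_* w f) (Oz e f)) (cong (_* w e) (Dz e)))) (ℤₚ.*-zeroʳ (w e)))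
      where
      r : ∀ s t → 0ℤ ≡ s * 0ℤ + t * 0ℤ
      r = solve-∀

    -- A form supported on the row and the column of z vanishes on the hyperplane w(z) = 0.
    hyp-pinned : ∀ g σ z → (∀ e f → e ≢ z → f ≢ z → O g σ e f ≡ 0ℤ) → (∀ e → e ≢ z → D g σ e ≡ 0ℤ) → HypAt g σ
    hyp-pinned g σ z Oz Dz = (λ w → w z) , (λ _ _ _ _ _ eq → eq z) , λ w wz → ℤₚ.≤-reflexive (∑-zero λ e → term w wz e)
      where
      term : ∀ w → w z ≡ 0ℤ → ∀ e → w e * M.app g σ w e ≡ 0ℤ
      term w wz e with e Finₚ.≟ z
      ... | yes refl = cong (_* M.app g σ w e) wz
      ... | no e≢z = trans (cong (w e *_) (cong₂ _+_ (∑-zero entry) (cong (_* w e) (Dz e e≢z)))) (ℤₚ.*-zeroʳ (w e))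
        where
        entry : ∀ f → O g σ e f * w f ≡ 0ℤ
        entry f with f Finₚ.≟ z
        ... | yes refl = trans (cong (O g σ e f *_) wz) (ℤₚ.*-zeroʳ (O g σ e f))
        ... | no f≢z = cong (_* w f) (Oz e f e≢z f≢z)

    -- If both remaining letters have to include a fixed letter x, then every nonzero
    -- entry of the form involves x, or else the unique letter that unlocks x.
    hyp-missing : ∀ g σ x → lookup σ x ≡ 0 → (∀ a b → lookup (σ ⊕ a ⊕ b) x ≡ 0 → g (σ ⊕ a ⊕ b) ≡ 0ℤ) → HypAt g σ
    hyp-missing g σ x x∉ need with ad? σ x
    ... | yes ax = hyp-pinned g σ x
        (λ e f e≢x f≢x → O-zero g σ e f λ _ _ _ → avoid e f e≢x f≢x)
        (λ e e≢x → D-zero g σ e λ _ b ¬ab _ → avoid e b e≢x λ { refl → ¬ab ax })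
      where
      avoid : ∀ a b → a ≢ x → b ≢ x → g (σ ⊕ a ⊕ b) ≡ 0ℤ
      avoid a b a≢x b≢x = need a b (trans (look-other (σ ⊕ a) (b≢x ∘ sym)) (trans (look-other σ (a≢x ∘ sym)) x∉))
    ... | no ¬ax with missing ¬ax x∉
    ...   | y , y≺x , y∉ = hyp-pinned g σ y
        (λ e f _ _ → O-zero g σ e f λ ae af _ → avoid e f (λ { refl → ¬ax ae }) (λ { refl → ¬ax af }))
        (λ e e≢y → D-zero g σ e λ ae b _ ab →
          avoid e b (λ { refl → ¬ax ae }) (λ { refl →
            e≢y (sym (filled {σ} {e} {y} y∉ (proj₂ (ad-plain (¬ad-plain {σ} ¬ax) ab) y y≺x))) }))
      where
      avoid : ∀ a b → a ≢ x → b ≢ x → g (σ ⊕ a ⊕ b) ≡ 0ℤ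
      avoid a b a≢x b≢x = need a b (trans (look-other (σ ⊕ a) (b≢x ∘ sym)) (trans (look-other σ (a≢x ∘ sym)) x∉))

    full? : ∀ σ → Dec (∀ (x : Letter) → lookup σ x ≢ 0)
    full? σ = Finₚ.all? λ x → ¬? (lookup σ x ℕₚ.≟ 0)

    full : State → ℤ
    full σ = ⟦ full? σ ⟧

    module _ (plain : ∀ x → formal x ≡ false) where

      hyp-full : ∀ σ → HypAt full σ
      hyp-full σ with Finₚ.any? (λ x → lookup σ x ℕₚ.≟ 0)
      ... | yes (x , x∉) = hyp-missing full σ x x∉ λ a b z → ⟦⟧-no (full? (σ ⊕ a ⊕ b)) λ f → f x z
      ... | no ¬m = hyp-zero full σ
          (λ e f → O-zero full σ e f λ ae _ _ → ⊥-elim (¬m (e , proj₁ (ad-plain (plain e) ae))))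
          (λ e → D-zero full σ e λ ae _ _ _ → ⊥-elim (¬m (e , proj₁ (ad-plain (plain e) ae))))

      exchange-full : Exchange full
      exchange-full {J = J} _ _ fJ _ {v} av _ with full? J
      ... | yes f = contradiction (proj₁ (ad-plain (plain v) av)) (f v)
      ... | no _ = contradiction fJ (ℤₚ.<-irrefl refl)

  module MarkStep (𝔸 : Alphabet) (p : Fin (Alphabet.N 𝔸)) (fp : Alphabet.formal 𝔸 p ≡ false)
    (g : Language.State 𝔸 → ℤ) (g≥0 : ∀ σ → 0ℤ ≤ g σ) (hyp : ∀ σ → LanguageForm.HypAt 𝔸 g σ) (σ : Language.State 𝔸) where
    open LanguageForm 𝔸
    open Degenerate 𝔸

    g′ : State → ℤ
    g′ = mark p g

    used : ∀ {τ} → lookup τ p ≢ 0 → ¬ Ad τ p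
    used {τ} p∈ ap = p∈ (proj₁ (ad-plain fp ap))

    p∈₁ : ∀ τ → lookup (τ ⊕ p) p ≢ 0
    p∈₁ τ q = contradiction (trans (sym (look-same τ p)) q) λ ()

    p∈₂ : ∀ τ b → lookup (τ ⊕ p ⊕ b) p ≢ 0
    p∈₂ τ b q = p∈₁ τ (zero-back {τ ⊕ p} {p} b q)

    hyp-blocked : ¬ Ad σ p → HypAt g′ σ
    hyp-blocked ¬ap with lookup σ p ℕₚ.≟ 0
    ... | yes p∉ with missing ¬ap p∉
    ...   | x , x≺p , x∉ = hyp-missing g′ σ x x∉ λ a b z → guard-no (ad? (σ ⊕ a ⊕ b) p) λ q → proj₂ (ad-plain fp q) x x≺p z
    hyp-blocked ¬ap | no p∈ = hyp-zero g′ σ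
        (λ e f → O-zero g′ σ e f λ _ _ _ → guard-no (ad? (σ ⊕ e ⊕ f) p) (stays e f))
        (λ e → D-zero g′ σ e λ _ b _ _ → guard-no (ad? (σ ⊕ e ⊕ b) p) (stays e b))
      where
      stays : ∀ a b → ¬ Ad (σ ⊕ a ⊕ b) p
      stays a b = used {σ ⊕ a ⊕ b} λ z → p∈ (zero-back {σ} {p} a (zero-back {σ ⊕ a} {p} b z))

    module _ (ap : Ad σ p) where

      shift-σ : ∀ e f → σ ⊕ e ⊕ f ⊕ p ≡ σ ⊕ p ⊕ e ⊕ f
      shift-σ e f = trans (⊕-comm (σ ⊕ e) f p) (cong (_⊕ f) (⊕-comm σ e p))

      -- Letters that only p makes available occur in the form at σ p but not in the one at σ; their
      -- coordinates are set to zero.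
      cut : (Letter → ℤ) → Letter → ℤ
      cut w e = ι σ e * w e

      entry : ∀ w e f → w e * (O g′ σ e f * w f) ≡ cut w e * (O g (σ ⊕ p) e f * cut w f)
      entry w e f = cases (ad? σ e) (ad? σ f) (e Finₚ.≟ p) (f Finₚ.≟ p)
        where
        z₁ : ∀ x y → x * (0ℤ * y) ≡ 0ℤ
        z₁ = solve-∀
        z₂ : ∀ x y → x * (y * 0ℤ) ≡ 0ℤ
        z₂ = solve-∀
        vanish : O g′ σ e f ≡ 0ℤ → cut w e * (O g (σ ⊕ p) e f * cut w f) ≡ 0ℤ → w e * (O g′ σ e f * w f) ≡ cut w e * (O g (σ ⊕ p) e f * cut w f)
        vanish a b = trans (cong (λ x → w e * (x * w f)) a) (trans (z₁ (w e) (w f)) (sym b))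
        cases : Dec (Ad σ e) → Dec (Ad σ f) → Dec (e ≡ p) → Dec (f ≡ p) → w e * (O g′ σ e f * w f) ≡ cut w e * (O g (σ ⊕ p) e f * cut w f)
        cases (no ¬e) _ _ _ = vanish (guard-no (ad? σ e) ¬e) (cong (_* (O g (σ ⊕ p) e f * cut w f)) (guard-no (ad? σ e) ¬e))
        cases (yes _) (no ¬f) _ _ = vanish (O-zero g′ σ e f λ _ af _ → contradiction af ¬f)
          (trans (cong (λ x → cut w e * (O g (σ ⊕ p) e f * x)) (guard-no (ad? σ f) ¬f)) (z₂ (cut w e) (O g (σ ⊕ p) e f)))
        cases (yes _) (yes _) (yes refl) _ = vanish
          (O-zero g′ σ e f λ _ _ _ → guard-no (ad? (σ ⊕ e ⊕ f) e) (used (p∈₂ σ f)))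
          (trans (cong (λ x → cut w e * (x * cut w f)) (guard-no (ad? (σ ⊕ e) e) (used (p∈₁ σ)))) (z₁ (cut w e) (cut w f)))
        cases (yes _) (yes _) (no _) (yes refl) = vanish
          (O-zero g′ σ e f λ _ _ _ → guard-no (ad? (σ ⊕ e ⊕ f) f) (used (p∈₁ (σ ⊕ e))))
          (trans (cong (λ x → cut w e * (x * cut w f)) (O-zero g (σ ⊕ f) e f λ _ af _ → contradiction af (used (p∈₁ σ)))) (z₁ (cut w e) (cut w f)))
        cases (yes ae) (yes af) (no e≢p) (no f≢p) = cong₂ _*_ (sym (guard-yes (ad? σ e) ae)) (cong₂ _*_ core (sym (guard-yes (ad? σ f) af)))
          where
          e→ : Ad (σ ⊕ e) f → Ad (σ ⊕ p ⊕ e) f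
          e→ a = subst (λ S → Ad S f) (⊕-comm σ e p) (ad-keep f≢p a)
          e← : Ad (σ ⊕ p ⊕ e) f → Ad (σ ⊕ e) f
          e← a = ad-between e p af (subst (λ S → Ad S f) (⊕-comm σ p e) a)
          core : O g′ σ e f ≡ O g (σ ⊕ p) e f
          core = trans (guard-yes (ad? σ e) ae) (trans (guard-yes (ad? σ f) af)
            (trans (cong₂ _*_ (⟦⟧-iff (ad? (σ ⊕ e) f) (ad? (σ ⊕ p ⊕ e) f) e→ e←)
               (trans (guard-yes (ad? (σ ⊕ e ⊕ f) p) (ad-keep (f≢p ∘ sym) (ad-keep (e≢p ∘ sym) ap))) (cong g (shift-σ e f))))
            (sym (trans (guard-yes (ad? (σ ⊕ p) e) (ad-keep e≢p ae)) (guard-yes (ad? (σ ⊕ p) f) (ad-keep f≢p af))))))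

      -- What e unlocks at σ it also unlocks at σ p. A letter that needs both e and p counts only on
      -- the right, whence an inequality, in the direction that preserves nonpositivity.
      diagonal : ∀ w e → D g′ σ e * (w e * w e) ≤ D g (σ ⊕ p) e * (cut w e * cut w e)
      diagonal w e = cases (ad? σ e) (e Finₚ.≟ p)
        where
        rhs≥0 : 0ℤ ≤ D g (σ ⊕ p) e * (cut w e * cut w e)
        rhs≥0 = 0≤* (D≥0 g≥0 (σ ⊕ p) e) (0≤sq (cut w e))
        cases : Dec (Ad σ e) → Dec (e ≡ p) → D g′ σ e * (w e * w e) ≤ D g (σ ⊕ p) e * (cut w e * cut w e)
        cases (no ¬e) _ = subst (_≤ D g (σ ⊕ p) e * (cut w e * cut w e)) (sym (cong (_* (w e * w e)) (guard-no (ad? σ e) ¬e))) rhs≥0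
        cases (yes _) (yes refl) = subst (_≤ D g (σ ⊕ p) e * (cut w e * cut w e))
          (sym (cong (_* (w e * w e)) (D-zero g′ σ e λ _ b _ _ →
            guard-no (ad? (σ ⊕ e ⊕ b) e) (used (p∈₂ σ b))))) rhs≥0
        cases (yes ae) (no e≢p) = subst (D g′ σ e * (w e * w e) ≤_)
            (cong (λ x → D g (σ ⊕ p) e * (x * x)) (sym (guard-yes (ad? σ e) ae)))
            (ℤₚ.*-monoʳ-≤-nonNeg (w e * w e) {{nonNegative (0≤sq (w e))}}
              (subst₂ _≤_ (sym (guard-yes (ad? σ e) ae)) (sym (guard-yes (ad? (σ ⊕ p) e) (ad-keep e≢p ae))) (∑-mono term)))
          where
          term : ∀ b → new σ b * (ι (σ ⊕ e) b * g′ (σ ⊕ e ⊕ b)) ≤ new (σ ⊕ p) b * (ι (σ ⊕ p ⊕ e) b * g (σ ⊕ p ⊕ e ⊕ b))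
          term b = guard-≤ (¬? (ad? σ b)) r≥0 λ ¬b → guard-≤ (ad? (σ ⊕ e) b) r≥0 λ ab → guard-≤ (ad? (σ ⊕ e ⊕ b) p) r≥0 λ _ →
            ℤₚ.≤-reflexive (trans (cong g (shift-σ e b)) (sym (trans
              (guard-yes (¬? (ad? (σ ⊕ p) b)) λ q → e≢p (ad-new-unique ¬b ab q))
              (guard-yes (ad? (σ ⊕ p ⊕ e) b) (subst (λ S → Ad S b) (⊕-comm σ e p) (ad-keep (λ { refl → ¬b ap }) ab))))))
            where
            r≥0 : 0ℤ ≤ new (σ ⊕ p) b * (ι (σ ⊕ p ⊕ e) b * g (σ ⊕ p ⊕ e ⊕ b))
            r≥0 = guard≥0 (¬? (ad? (σ ⊕ p) b)) (guard≥0 (ad? (σ ⊕ p ⊕ e) b) (g≥0 _))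

      form-cut : ∀ w → M.form g′ σ w w ≤ M.form g (σ ⊕ p) (cut w) (cut w)
      form-cut w = subst₂ _≤_ (sym (M.form-split g′ σ w w)) (sym (M.form-split g (σ ⊕ p) (cut w) (cut w)))
        (ℤₚ.+-mono-≤ (ℤₚ.≤-reflexive (sum-cong-≗ λ e → sum-cong-≗ λ f → entry w e f)) (∑-mono (diagonal w)))

      cut-lin : ∀ s t u w e → cut (λ i → s * u i + t * w i) e ≡ s * cut u e + t * cut w e
      cut-lin s t u w e = r (ι σ e) s (u e) t (w e)
        where
        r : ∀ i s x t y → i * (s * x + t * y) ≡ s * (i * x) + t * (i * y)
        r = solve-∀

    hyp-mark : HypAt g′ σ
    hyp-mark with ad? σ p
    ... | no ¬ap = hyp-blocked ¬ap
    ... | yes ap with hyp (σ ⊕ p)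
    ...   | ℓ , lin , neg = (λ w → ℓ (cut ap w)) , 
        (λ s t u w v eq → lin s t (cut ap u) (cut ap w) (cut ap v) λ e →
          trans (cong (ι σ e *_) (eq e)) (cut-lin ap s t u w e)) , λ w z → ℤₚ.≤-trans (form-cut ap w) (neg (cut ap w) z)

  -- Formal letters

  extend : Alphabet → Alphabet
  extend 𝔸 = record { N = suc N ; formal = formal⁺ ; _≺_ = _≺⁺_ ; _≺?_ = ≺?⁺ ; ≺-plain = λ {x} {y} → plain⁺ x y }
    where
    open Alphabet 𝔸
    formal⁺ : Fin (suc N) → Bool
    formal⁺ zero = true
    formal⁺ (suc x) = formal x
    _≺⁺_ : Fin (suc N) → Fin (suc N) → Set
    suc x ≺⁺ suc y = x ≺ y
    _ ≺⁺ _ = ⊥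
    ≺?⁺ : ∀ x y → Dec (x ≺⁺ y)
    ≺?⁺ zero zero = no λ ()
    ≺?⁺ zero (suc y) = no λ ()
    ≺?⁺ (suc x) zero = no λ ()
    ≺?⁺ (suc x) (suc y) = x ≺? y
    plain⁺ : ∀ x y → x ≺⁺ y → formal⁺ x ≡ false
    plain⁺ zero zero ()
    plain⁺ zero (suc y) ()
    plain⁺ (suc x) zero ()
    plain⁺ (suc x) (suc y) p = ≺-plain p

  module Extension (𝔸 : Alphabet) where
    open LanguageForm 𝔸
    module L⁺ = LanguageForm (extend 𝔸)

    ad⁺ : ∀ {t σ x} → Ad σ x → L⁺.Ad (t ∷ σ) (suc x)
    ad⁺ (always p) = L⁺.always p
    ad⁺ (ready p q) = L⁺.ready p λ { (suc y) → q y }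

    ad⁻ : ∀ {t σ x} → L⁺.Ad (t ∷ σ) (suc x) → Ad σ x
    ad⁻ (L⁺.always p) = always p
    ad⁻ (L⁺.ready p q) = ready p λ y → q (suc y)

    ad₀ : ∀ {σ} → L⁺.Ad σ zero
    ad₀ = L⁺.always refl

    ι⁺ : ∀ t σ x → L⁺.ι (t ∷ σ) (suc x) ≡ ι σ x
    ι⁺ t σ x = ⟦⟧-iff (L⁺.ad? (t ∷ σ) (suc x)) (ad? σ x) ad⁻ ad⁺

    ι₀ : ∀ σ → L⁺.ι σ zero ≡ 1ℤ
    ι₀ σ = ⟦⟧-yes (L⁺.ad? σ zero) ad₀

  module Fold (𝔸 : Alphabet) (ω : Weights 𝔸) (g : Language.State 𝔸 → ℤ) (g≥0 : ∀ σ → 0ℤ ≤ g σ)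
    (ex : Language.Exchange 𝔸 g) (hyp : ∀ σ → LanguageForm.HypAt 𝔸 g σ) where
    open LanguageForm 𝔸
    open Weights ω
    open Extension 𝔸

    iter : ℕ → State → ℤ
    iter zero = g
    iter (suc t) = free h (iter t)

    iter≥0 : ∀ t σ → 0ℤ ≤ iter t σ
    iter≥0 zero = g≥0
    iter≥0 (suc t) = free≥0 (λ x → ℤₚ.<⇒≤ (h>0 x)) (iter≥0 t)

    iter-exchange : ∀ t → Exchange (iter t)
    iter-exchange zero = ex
    iter-exchange (suc t) = exchange-free h>0 (iter≥0 t) (iter-exchange t)

    iter-hyp : ∀ t σ → HypAt (iter t) σ
    iter-hyp zero = hyp
    iter-hyp (suc t) = FreeStep.hyp-free 𝔸 ω (iter t) (iter≥0 t) (iter-exchange t) (iter-hyp t)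

    -- The multiplicity of the new letter is the number of free positions before `g` takes over, so
    -- reading it once more lengthens the gap by one.
    fold : L⁺.State → ℤ
    fold (t ∷ σ) = iter t σ

    fold≥0 : ∀ σ → 0ℤ ≤ fold σ
    fold≥0 (t ∷ σ) = iter≥0 t σ

    module _ (t : ℕ) (σ : State) (w : L⁺.Letter → ℤ) where

      private
        w₀ : ℤ
        w₀ = w zero
        u φ : Letter → ℤ
        u e = w (suc e)
        φ e = 1ℤ * u e + w₀ * h e
        module I = M (iter t) σ
        module J = L⁺.M fold (t ∷ σ)

      restrict-suc : ∀ e f → L⁺.restrict (t ∷ σ) (suc e) w (suc f) ≡ restrict σ e u f
      restrict-suc e f = cases (ad? σ f)
        where
        cases : Dec (Ad σ f) → L⁺.restrict (t ∷ σ) (suc e) w (suc f) ≡ restrict σ e u f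
        cases (yes p) = trans (pick-yes (L⁺.ad? (t ∷ σ) (suc f)) (ad⁺ p)) (sym (pick-yes (ad? σ f) p))
        cases (no ¬p) = trans (pick-no (L⁺.ad? (t ∷ σ) (suc f)) (¬p ∘ ad⁻)) (sym (pick-no (ad? σ f) ¬p))

      row-suc : ∀ e → J.app w (suc e) ≡ w₀ * I.app h e + I.app u e
      row-suc e = begin
          J.app w (suc e)
            ≡⟨ L⁺.row fold (t ∷ σ) w (suc e) ⟩
          L⁺.ι (t ∷ σ) (suc e) * (L⁺.ι (t ∷ σ ⊕ e) zero * (L⁺.restrict (t ∷ σ) (suc e) w zero * iter (suc t) (σ ⊕ e))
            + sum (λ f → L⁺.ι (t ∷ σ ⊕ e) (suc f) * (L⁺.restrict (t ∷ σ) (suc e) w (suc f) * iter t (σ ⊕ e ⊕ f))))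
            ≡⟨ cong₂ _*_ (ι⁺ t σ e) (cong₂ _+_
                 (cong₂ _*_ (ι₀ (t ∷ σ ⊕ e)) (cong (_* iter (suc t) (σ ⊕ e)) (pick-yes (L⁺.ad? (t ∷ σ) zero) ad₀)))
                 (sum-cong-≗ λ f → cong₂ _*_ (ι⁺ t (σ ⊕ e) f) (cong (_* iter t (σ ⊕ e ⊕ f)) (restrict-suc e f)))) ⟩
          ι σ e * (1ℤ * (w₀ * iter (suc t) (σ ⊕ e)) + rest)
            ≡⟨ r (ι σ e) w₀ (iter (suc t) (σ ⊕ e)) rest ⟩
          w₀ * (ι σ e * iter (suc t) (σ ⊕ e)) + ι σ e * rest
            ≡⟨ sym (cong₂ _+_ (cong (w₀ *_) (row-h compatible (iter t) σ e)) (row (iter t) σ u e)) ⟩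
          w₀ * I.app h e + I.app u e ∎
        where
        open ≡-Reasoning
        rest : ℤ
        rest = sum (λ f → ι (σ ⊕ e) f * (restrict σ e u f * iter t (σ ⊕ e ⊕ f)))
        r : ∀ i w x y → i * (1ℤ * (w * x) + y) ≡ w * (i * x) + i * y
        r = solve-∀

      row-zero : J.app w zero ≡ w₀ * I.form h h + I.form u h
      row-zero = begin
          J.app w zero
            ≡⟨ L⁺.row fold (t ∷ σ) w zero ⟩
          L⁺.ι (t ∷ σ) zero * (L⁺.ι (suc t ∷ σ) zero * (L⁺.restrict (t ∷ σ) zero w zero * iter (suc (suc t)) σ)
            + sum (λ f → L⁺.ι (suc t ∷ σ) (suc f) * (L⁺.restrict (t ∷ σ) zero w (suc f) * iter (suc t) (σ ⊕ f))))
            ≡⟨ cong₂ _*_ (ι₀ (t ∷ σ)) (cong₂ _+_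
                 (cong₂ _*_ (ι₀ (suc t ∷ σ)) (cong (_* iter (suc (suc t)) σ) (pick-yes (L⁺.ad? (t ∷ σ) zero) ad₀)))
                 (sum-cong-≗ λ f → trans (cong (_* (L⁺.restrict (t ∷ σ) zero w (suc f) * iter (suc t) (σ ⊕ f))) (ι⁺ (suc t) σ f))
                   (trans (*-guard (ad? σ f) (λ a → cong (_* iter (suc t) (σ ⊕ f)) (pick-yes (L⁺.ad? (t ∷ σ) (suc f)) (ad⁺ a))))
                     (r₁ (ι σ f) (u f) (iter (suc t) (σ ⊕ f)))))) ⟩
          1ℤ * (1ℤ * (w₀ * iter (suc (suc t)) σ) + sum (λ f → u f * (ι σ f * iter (suc t) (σ ⊕ f))))
            ≡⟨ r₂ (w₀ * iter (suc (suc t)) σ) (sum (λ f → u f * (ι σ f * iter (suc t) (σ ⊕ f)))) ⟩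
          w₀ * iter (suc (suc t)) σ + sum (λ f → u f * (ι σ f * iter (suc t) (σ ⊕ f)))
            ≡⟨ sym (cong₂ _+_ (cong (w₀ *_) (form-h compatible (iter t) σ h)) (form-h compatible (iter t) σ u)) ⟩
          w₀ * I.form h h + I.form u h ∎
        where
        open ≡-Reasoning
        r₁ : ∀ i x y → i * (x * y) ≡ x * (i * y)
        r₁ = solve-∀
        r₂ : ∀ x y → 1ℤ * (1ℤ * x + y) ≡ x + y
        r₂ = solve-∀

      -- The new letter acts as the vector h. The form is a pull-back of that of `iter t`, hence
      -- hyperbolic without any connectedness argument.
      form-fold : J.form w w ≡ I.form φ φ
      form-fold = begin
          w₀ * J.app w zero + sum (λ e → u e * J.app w (suc e))
            ≡⟨ cong₂ _+_ (cong (w₀ *_) row-zero) (trans (sum-cong-≗ λ e → trans (cong (u e *_) (row-suc e)) (r₁ (u e) w₀ (I.app h e) (I.app u e)))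
                 (∑-lin₂ w₀ 1ℤ (λ e → u e * I.app h e) (λ e → u e * I.app u e))) ⟩
          w₀ * (w₀ * I.form h h + I.form u h) + (w₀ * I.form u h + 1ℤ * I.form u u)
            ≡⟨ r₂ w₀ (I.form h h) (I.form u h) (I.form u u) ⟩
          1ℤ * 1ℤ * I.form u u + + 2 * (1ℤ * w₀) * I.form u h + w₀ * w₀ * I.form h h
            ≡⟨ sym (I.form-quad (O-sym (iter t) σ) 1ℤ w₀ u h) ⟩
          I.form φ φ ∎
        where
        open ≡-Reasoning
        r₁ : ∀ u w x y → u * (w * x + y) ≡ w * (u * x) + 1ℤ * (u * y)
        r₁ = solve-∀
        r₂ : ∀ w a b c → w * (w * a + b) + (w * b + 1ℤ * c) ≡ 1ℤ * 1ℤ * c + + 2 * (1ℤ * w) * b + w * w * a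
        r₂ = solve-∀

    hyp-fold : ∀ σ → L⁺.HypAt fold σ
    hyp-fold (t ∷ σ) with iter-hyp t σ
    ... | ℓ , lin , neg = (λ w → ℓ (λ e → 1ℤ * w (suc e) + w zero * h e)) ,
        (λ s r u w v eq → lin s r _ _ _ λ e → trans (cong₂ (λ a b → 1ℤ * a + b * h e) (eq (suc e)) (eq zero))
          (q s r (u (suc e)) (w (suc e)) (u zero) (w zero) (h e))) ,
        λ w z → subst (_≤ 0ℤ) (sym (form-fold t σ w)) (neg _ z)
      where
      q : ∀ s r x y a b h → 1ℤ * (s * x + r * y) + (s * a + r * b) * h ≡ s * (1ℤ * x + a * h) + r * (1ℤ * y + b * h)
      q = solve-∀

    iter>0 : ∀ {t σ x} → Ad σ x → 0ℤ < iter t (σ ⊕ x) → 0ℤ < iter (suc t) σ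
    iter>0 {t} = free>0 h>0 (iter≥0 t)

    Swap : State → ℕ → ℕ → State → State → Letter → Set
    Swap σ k t J J′ v = ∃₂ λ K u → (∃ λ k′ → k ≡ suc k′ × Path σ k′ K) × Ad K u × K ⊕ u ≡ J × lookup J′ u ℕ.< lookup J u
      × Ad K v × 0ℤ < iter t (K ⊕ v)

    -- Here v occupies one of the t free positions, so that a formal letter is given up for it; t′ ≤
    -- s says that this letter is in excess in J.
    Trade : ℕ → ℕ → State → Letter → Set
    Trade t t′ J v = ∃ λ s → t ≡ suc s × t′ ℕ.≤ s × 0ℤ < iter s (J ⊕ v)

    prolong : ∀ {σ} d {k t J} → Path σ k J → 0ℤ < iter (d ℕ.+ t) J →
      ∃ λ J⁺ → Path σ (d ℕ.+ k) J⁺ × 0ℤ < iter t J⁺ × (∀ y → lookup J y ℕ.≤ lookup J⁺ y)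
    prolong zero {J = J} p q = J , p , q , λ _ → ℕₚ.≤-refl
    prolong {σ} (suc d) {k} {t} {J} p q with free>0⇒ h>0 (iter≥0 (d ℕ.+ t)) q
    ... | x , ax , q′ with prolong d (snoc p ax) q′
    ...   | J⁺ , p⁺ , r , le = J⁺ , subst (λ n → Path σ n J⁺) (ℕₚ.+-suc d k) p⁺ , r , λ y → ℕₚ.≤-trans (look-mono J x y) (le y)

    -- If J has at most as many free positions as J′, prolong J′ to the length of J and exchange
    -- there. Otherwise fill free positions of J one by one; when v can take the place of such a
    -- filling letter, a trade results.
    swap-or-trade : ∀ {σ} t {t′ k k′ J J′ v} → Path σ k J → Path σ k′ J′ → k ℕ.+ t ≡ k′ ℕ.+ t′ → 0ℤ < iter t J → 0ℤ < iter t′ J′ →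
      Ad J v → lookup J v ℕ.< lookup J′ v → Swap σ k t J J′ v ⊎ Trade t t′ J v
    swap-or-trade {σ} t {t′} {k} {k′} {J} {J′} {v} p p′ len gJ gJ′ av lv with t ℕₚ.≤? t′
    ... | yes t≤t′ with prolong (t′ ℕ.∸ t) p′ (subst (λ n → 0ℤ < iter n J′) (sym (ℕₚ.m∸n+n≡m t≤t′)) gJ′)
    ...   | J⁺ , p⁺ , g⁺ , le with iter-exchange t p (subst (λ n → Path σ n J⁺) k≡ p⁺) gJ g⁺ av (ℕₚ.<-≤-trans lv (le v))
      where
      k≡ : t′ ℕ.∸ t ℕ.+ k′ ≡ k
      k≡ = ℕₚ.+-cancelʳ-≡ t _ _ (trans (ℕₚ.+-assoc (t′ ℕ.∸ t) k′ t) (trans (cong (t′ ℕ.∸ t ℕ.+_) (ℕₚ.+-comm k′ t))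
             (trans (sym (ℕₚ.+-assoc (t′ ℕ.∸ t) t k′)) (trans (cong (ℕ._+ k′) (ℕₚ.m∸n+n≡m t≤t′)) (trans (ℕₚ.+-comm t′ k′) (sym len))))))
    ...     | K , u , pk , au , eq , lu , aKv , gK = inj₁ (K , u , pk , au , eq , ℕₚ.≤-<-trans (le u) lu , aKv , gK)
    swap-or-trade zero p p′ len gJ gJ′ av lv | no t≰t′ = contradiction ℕ.z≤n t≰t′
    swap-or-trade {σ} (suc t) {t′} {k} {k′} {J} {J′} {v} p p′ len gJ gJ′ av lv | no t≰t′ with free>0⇒ h>0 (iter≥0 t) gJ
    ... | y , ay , gy with v Finₚ.≟ y
    ...   | yes refl = inj₂ (t , refl , ℕₚ.≤-pred (ℕₚ.≰⇒> t≰t′) , gy)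
    ...   | no v≢y with swap-or-trade t (snoc p ay) p′ (trans (sym (ℕₚ.+-suc k t)) len) gy gJ′ (ad-keep v≢y av)
                          (subst (ℕ._< lookup J′ v) (sym (look-other J v≢y)) lv)
    ...     | inj₂ (s , refl , t′≤s , gs) = inj₂ (suc s , refl , ℕₚ.m≤n⇒m≤1+n t′≤s ,
                iter>0 {s} (ad-keep (v≢y ∘ sym) ay) (subst (λ S → 0ℤ < iter s S) (⊕-comm J y v) gs))
    ...     | inj₁ (K , u , (_ , refl , pK) , au , eq , lu , aKv , gK) with u Finₚ.≟ y
    ...       | yes refl = inj₂ (t , refl , ℕₚ.≤-pred (ℕₚ.≰⇒> t≰t′) , subst (λ S → 0ℤ < iter t (S ⊕ v)) (⊕-cancel K J y eq) gK)
    ...       | no u≢y with square p ay pK au eq u≢y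
    ...         | K₀ , pk₀ , ay₀ , au₀ , refl , refl = inj₁ (K₀ , u , pk₀ , au₀ , refl ,
                    subst (lookup J′ u ℕ.<_) (look-other (K₀ ⊕ u) u≢y) lu , ad-without ay av aKv ,
                    iter>0 {t} (ad-keep (v≢y ∘ sym) ay₀) (subst (λ S → 0ℤ < iter t S) (⊕-comm K₀ y v) gK))

    Projected : ℕ → State → ℕ → L⁺.State → Set
    Projected t₀ σ k J = ∃₂ λ i j → ∃ λ J₀ → k ≡ i ℕ.+ j × J ≡ i ℕ.+ t₀ ∷ J₀ × Path σ j J₀

    project : ∀ {t₀ σ k J} → L⁺.Path (t₀ ∷ σ) k J → Projected t₀ σ k J
    project {t₀} {σ} L⁺.nil = 0 , 0 , σ , refl , refl , nil
    project (L⁺.snoc {x = x} p a) with project p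
    project (L⁺.snoc {x = zero} p a) | i , j , J₀ , refl , refl , q = suc i , j , J₀ , refl , refl , q
    project (L⁺.snoc {x = suc x} p a) | i , j , J₀ , refl , refl , q = i , suc j , J₀ ⊕ x , sym (ℕₚ.+-suc i j) , refl , snoc q (ad⁻ a)

    lift-path : ∀ {t₀ σ j J} i → Path σ j J → L⁺.Path (t₀ ∷ σ) (i ℕ.+ j) (i ℕ.+ t₀ ∷ J)
    lift-path zero nil = L⁺.nil
    lift-path zero (snoc p a) = L⁺.snoc (lift-path zero p) (ad⁺ a)
    lift-path (suc i) p = L⁺.snoc (lift-path i p) ad₀

    exchange-fold : L⁺.Exchange fold
    exchange-fold {t₀ ∷ σ} {k} p p′ gJ gJ′ {v} av lv with project p | project p′
    exchange-fold {t₀ ∷ σ} {k} p p′ gJ gJ′ {suc v} av lv | i , j , J , refl , refl , q | i′ , j′ , J′ , k≡ , refl , q′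
      with swap-or-trade (i ℕ.+ t₀) q q′ len gJ gJ′ (ad⁻ av) lv
      where
      len : j ℕ.+ (i ℕ.+ t₀) ≡ j′ ℕ.+ (i′ ℕ.+ t₀)
      len = trans (sym (ℕₚ.+-assoc j i t₀)) (trans (cong (ℕ._+ t₀) (trans (ℕₚ.+-comm j i) (trans k≡ (ℕₚ.+-comm i′ j′)))) (ℕₚ.+-assoc j′ i′ t₀))
    ... | inj₁ (K , u , (j₀ , refl , pK) , au , refl , lu , aKv , gK) =
        i ℕ.+ t₀ ∷ K , suc u , (i ℕ.+ j₀ , ℕₚ.+-suc i j₀ , lift-path i pK) , ad⁺ au , refl , lu , ad⁺ aKv , gK
    ... | inj₂ (s , eq , t′≤s , gs) with i
    ...   | zero = contradiction (ℕₚ.≤-trans (ℕₚ.≤-trans (ℕₚ.≤-reflexive (sym eq)) (ℕₚ.m≤n+m t₀ i′)) t′≤s) (ℕₚ.<⇒≱ ℕₚ.≤-refl)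
    ...   | suc i₀ with ℕₚ.suc-injective eq
    ...     | refl = i₀ ℕ.+ t₀ ∷ J , zero , (i₀ ℕ.+ j , refl , lift-path i₀ q) , ad₀ , refl , ℕ.s≤s t′≤s , ad⁺ (ad⁻ av) , gs
    exchange-fold {t₀ ∷ σ} {k} p p′ gJ gJ′ {zero} av lv | i , j , J , refl , refl , q | i′ , j′ , J′ , k≡ , refl , q′
      -- Fewer new letters than J′ means more old ones. One of them gives way, and the position it
      -- vacates becomes free.
      with removal q q′ (exceeds-longer q q′ j′<j)
      where
      i<i′ : i ℕ.< i′
      i<i′ = ℕₚ.+-cancelʳ-< t₀ i i′ lv
      j′<j : j′ ℕ.< j
      j′<j = ℕₚ.≰⇒> λ j≤j′ → ℕₚ.<-irrefl k≡ (ℕₚ.+-mono-<-≤ i<i′ j≤j′)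
    ... | K , u , (j₀ , refl , pK) , au , refl , lu =
        i ℕ.+ t₀ ∷ K , suc u , (i ℕ.+ j₀ , ℕₚ.+-suc i j₀ , lift-path i pK) , ad⁺ au , refl , lu , ad₀ , iter>0 {i ℕ.+ t₀} au gJ

  -- Leading coefficients

  T[_] : ℕ → ℤ
  T[ n ] = + suc n

  T>0 : ∀ n → 0ℤ < T[ n ]
  T>0 n = +<+ (ℕ.s≤s ℕ.z≤n)

  T^>0 : ∀ n e → 0ℤ < T[ n ] ^ e
  T^>0 n zero = +<+ (ℕ.s≤s ℕ.z≤n)
  T^>0 n (suc e) = 0<* (T>0 n) (T^>0 n e)

  1≤T : ∀ n → 1ℤ ≤ T[ n ]
  1≤T n = +≤+ (ℕ.s≤s ℕ.z≤n)

  -- F(n) = Tᵉ(c + r) with T = n + 1 and 0 ≤ r ≤ C/T, multiplied out to remain in the integers.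
  record Leading (e : ℕ) (F : ℕ → ℤ) (c : ℤ) : Set where
    constructor leading
    field
      c≥0 : 0ℤ ≤ c
      C : ℤ
      C≥0 : 0ℤ ≤ C
      bounds : ∀ n → T[ n ] ^ e * c ≤ F n × T[ n ] * F n ≤ T[ n ] ^ e * (T[ n ] * c + C)

  leading-const : ∀ {c} → 0ℤ ≤ c → Leading 0 (λ _ → c) c
  leading-const {c} c≥0 = leading c≥0 0ℤ ℤₚ.≤-refl λ n → ℤₚ.≤-reflexive (ℤₚ.*-identityˡ c) , ℤₚ.≤-reflexive (r T[ n ] c)
    where
    r : ∀ t c → t * c ≡ 1ℤ * (t * c + 0ℤ)
    r = solve-∀

  leading-cong : ∀ {e F G c d} → (∀ n → F n ≡ G n) → c ≡ d → Leading e F c → Leading e G d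
  leading-cong {e} {c = c} eq refl (leading c≥0 C C≥0 b) = leading c≥0 C C≥0 λ n →
    subst (T[ n ] ^ e * c ≤_) (eq n) (proj₁ (b n)) , subst (λ x → T[ n ] * x ≤ T[ n ] ^ e * (T[ n ] * c + C)) (eq n) (proj₂ (b n))

  leading-+ : ∀ {e F G c d} → Leading e F c → Leading e G d → Leading e (λ n → F n + G n) (c + d)
  leading-+ {e} {F} {G} {c} {d} (leading c≥0 C C≥0 b) (leading d≥0 D D≥0 b′) = leading (0≤+ c≥0 d≥0) (C + D) (0≤+ C≥0 D≥0) λ n →
    subst (_≤ F n + G n) (sym (ℤₚ.*-distribˡ-+ (T[ n ] ^ e) c d)) (ℤₚ.+-mono-≤ (proj₁ (b n)) (proj₁ (b′ n))) ,
    subst₂ _≤_ (sym (ℤₚ.*-distribˡ-+ T[ n ] (F n) (G n))) (r (T[ n ] ^ e) T[ n ] c C d D) (ℤₚ.+-mono-≤ (proj₂ (b n)) (proj₂ (b′ n)))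
    where
    r : ∀ p t c C d D → p * (t * c + C) + p * (t * d + D) ≡ p * (t * (c + d) + (C + D))
    r = solve-∀

  leading-guard : ∀ {P : Set} (d : Dec P) {e F c} → Leading e F c → Leading e (λ n → ⟦ d ⟧ * F n) (⟦ d ⟧ * c)
  leading-guard (yes _) {F = F} {c} l = leading-cong (λ n → sym (ℤₚ.*-identityˡ (F n))) (sym (ℤₚ.*-identityˡ c)) l
  leading-guard (no _) {e} _ = leading ℤₚ.≤-refl 0ℤ ℤₚ.≤-refl λ n → ℤₚ.≤-reflexive (r₁ (T[ n ] ^ e)) , ℤₚ.≤-reflexive (r₂ (T[ n ] ^ e) T[ n ])
    where
    r₁ : ∀ p → p * 0ℤ ≡ 0ℤ
    r₁ = solve-∀
    r₂ : ∀ p t → t * 0ℤ ≡ p * (t * 0ℤ + 0ℤ)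
    r₂ = solve-∀

  leading-sum : ∀ {N e} {F : Fin N → ℕ → ℤ} {c : Fin N → ℤ} → (∀ x → Leading e (F x) (c x)) →
    Leading e (λ n → sum (λ x → F x n)) (sum c)
  leading-sum {zero} {e} _ = leading ℤₚ.≤-refl 0ℤ ℤₚ.≤-refl λ n → ℤₚ.≤-reflexive (r₁ (T[ n ] ^ e)) , ℤₚ.≤-reflexive (r₂ (T[ n ] ^ e) T[ n ])
    where
    r₁ : ∀ p → p * 0ℤ ≡ 0ℤ
    r₁ = solve-∀
    r₂ : ∀ p t → t * 0ℤ ≡ p * (t * 0ℤ + 0ℤ)
    r₂ = solve-∀
  leading-sum {suc N} {e} {F} {c} l = leading-+ {e} {F zero} {λ n → sum (λ x → F (suc x) n)} (l zero) (leading-sum (l ∘ suc))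

  leading-T* : ∀ {e F c} → Leading e F c → Leading (suc e) (λ n → T[ n ] * F n) c
  leading-T* {e} {F} {c} (leading c≥0 C C≥0 b) = leading c≥0 C C≥0 λ n →
    subst (_≤ T[ n ] * F n) (sym (ℤₚ.*-assoc T[ n ] (T[ n ] ^ e) c)) (*-monoˡ (ℤₚ.<⇒≤ (T>0 n)) (proj₁ (b n))) ,
    subst (T[ n ] * (T[ n ] * F n) ≤_) (sym (ℤₚ.*-assoc T[ n ] (T[ n ] ^ e) (T[ n ] * c + C))) (*-monoˡ (ℤₚ.<⇒≤ (T>0 n)) (proj₂ (b n)))

  leading-drop : ∀ {e F c} → Leading e F c → Leading (suc e) F 0ℤ
  leading-drop {e} {F} {c} (leading c≥0 C C≥0 b) = leading ℤₚ.≤-refl (c + C) (0≤+ c≥0 C≥0) λ n →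
    ℤₚ.≤-trans (ℤₚ.≤-reflexive (ℤₚ.*-zeroʳ (T[ n ] ^ suc e))) (ℤₚ.≤-trans (0≤* (ℤₚ.<⇒≤ (T^>0 n e)) c≥0) (proj₁ (b n))) ,
    ℤₚ.≤-trans (proj₂ (b n)) (diff (r (T[ n ] ^ e) T[ n ] c C) (0≤* (ℤₚ.<⇒≤ (T^>0 n e)) (0≤* C≥0 (0≤diff (1≤T n)))))
    where
    r : ∀ p t c C → t * p * (t * 0ℤ + (c + C)) - p * (t * c + C) ≡ p * (C * (t - 1ℤ))
    r = solve-∀

  leading-lower : ∀ {e F G c} → Leading e F c → Leading (suc e) G 0ℤ → Leading (suc e) (λ n → G n + T[ n ] * F n) c
  leading-lower {e} {F} {G} {c} l l′ = leading-cong {suc e} {λ n → G n + T[ n ] * F n} (λ _ → refl) (ℤₚ.+-identityˡ c)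
    (leading-+ {suc e} {G} {λ n → T[ n ] * F n} l′ (leading-T* {e} {F} l))

  -- Both sides have degree 2E + 2 in T, so the inequality passes to the leading coefficients.
  leading-compare : ∀ {E F G H a b c} → Leading (suc (suc E)) F a → Leading (suc E) G b → Leading E H c →
    (∀ n → F n * H n ≤ G n * G n) → a * c ≤ b * b
  leading-compare {E} {F} {G} {H} {a} {b} {c} (leading a≥0 _ _ fa) (leading b≥0 C C≥0 gb) (leading c≥0 _ _ hc) ineq with a * c ℤₚ.≤? b * b
  ... | yes p = p
  ... | no ¬p = contradiction (ℤₚ.≤-trans (ℤₚ.i<j⇒suc[i]≤j (ℤₚ.≰⇒> ¬p)) ℤₚ.≤-refl) λ q → ℤₚ.<-irrefl refl (ℤₚ.<-≤-trans (+<+ (ℕ.s≤s ℕ.z≤n)) (bad q))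
    where
    X : ℤ
    -- With T = 1 + X, the difference T²(1 + b²) - (Tb + C)² equals 1 + X + XC² > 0, which refutes
    -- ac ≥ 1 + b².
    X = + 2 * (b * C) + C * C
    X≥0 : 0ℤ ≤ X
    X≥0 = 0≤+ (0≤* {+ 2} (+≤+ ℕ.z≤n) (0≤* b≥0 C≥0)) (0≤* C≥0 C≥0)
    n : ℕ
    n = ∣ X ∣
    T p : ℤ
    T = T[ n ]
    p = T ^ E
    T-X : T ≡ 1ℤ + X
    T-X = cong (λ x → 1ℤ + x) (ℤₚ.0≤i⇒+∣i∣≡i X≥0)
    T≥0 : 0ℤ ≤ T
    T≥0 = ℤₚ.<⇒≤ (T>0 n)
    p≥0 : 0ℤ ≤ p
    p≥0 = ℤₚ.<⇒≤ (T^>0 n E)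
    F≥0 : 0ℤ ≤ F n
    F≥0 = ℤₚ.≤-trans (0≤* (ℤₚ.<⇒≤ (T^>0 n (suc (suc E)))) a≥0) (proj₁ (fa n))
    G≥0 : 0ℤ ≤ G n
    G≥0 = ℤₚ.≤-trans (0≤* (ℤₚ.<⇒≤ (T^>0 n (suc E))) b≥0) (proj₁ (gb n))
    lower : (T * (T * p)) * a * (p * c) ≤ F n * H n
    lower = ℤₚ.≤-trans (ℤₚ.*-monoʳ-≤-nonNeg (p * c) {{nonNegative (0≤* p≥0 c≥0)}} (proj₁ (fa n))) (*-monoˡ F≥0 (proj₁ (hc n)))
    upper : T * G n * (T * G n) ≤ T * p * (T * b + C) * (T * p * (T * b + C))
    upper = ℤₚ.≤-trans (ℤₚ.*-monoʳ-≤-nonNeg (T * G n) {{nonNegative (0≤* T≥0 G≥0)}} (proj₂ (gb n)))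
      (*-monoˡ (0≤* (0≤* T≥0 p≥0) (0≤+ (0≤* T≥0 b≥0) C≥0)) (proj₂ (gb n)))
    main : T * T * (a * c) ≤ (T * b + C) * (T * b + C)
    main = *-cancel {T * p * (T * p)} (0<* (T^>0 n (suc E)) (T^>0 n (suc E)))
      (subst₂ _≤_ (r₁ T p a c) (r₃ T p (T * b + C))
        (ℤₚ.≤-trans (*-monoˡ (0≤* T≥0 T≥0) (ℤₚ.≤-trans lower (ineq n))) (subst (_≤ T * p * (T * b + C) * (T * p * (T * b + C))) (r₂ T (G n)) upper)))
      where
      r₁ : ∀ t p a c → t * t * (t * (t * p) * a * (p * c)) ≡ t * p * (t * p) * (t * t * (a * c))
      r₁ = solve-∀
      r₂ : ∀ t g → t * g * (t * g) ≡ t * t * (g * g)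
      r₂ = solve-∀
      r₃ : ∀ t p x → t * p * x * (t * p * x) ≡ t * p * (t * p) * (x * x)
      r₃ = solve-∀
    bad : 1ℤ + b * b ≤ a * c → 1ℤ ≤ 0ℤ
    bad q = ℤₚ.≤-trans (diff (r₄ b C) (0≤+ X≥0 (0≤* X≥0 (0≤* C≥0 C≥0))))
      (subst (λ t → t * t * (1ℤ + b * b) - (t * b + C) * (t * b + C) ≤ 0ℤ) T-X
        (ℤₚ.i≤j⇒i-j≤0 (ℤₚ.≤-trans (*-monoˡ (0≤* T≥0 T≥0) q) main)))
      where
      r₄ : ∀ b C → (1ℤ + (+ 2 * (b * C) + C * C)) * (1ℤ + (+ 2 * (b * C) + C * C)) * (1ℤ + b * b)
          - ((1ℤ + (+ 2 * (b * C) + C * C)) * b + C) * ((1ℤ + (+ 2 * (b * C) + C * C)) * b + C) - 1ℤ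
        ≡ (+ 2 * (b * C) + C * C) + (+ 2 * (b * C) + C * C) * (C * C)
      r₄ = solve-∀

  -- Moving a mark

  unit : ∀ {N} → Fin N → Fin N → ℤ
  unit zero zero = 1ℤ
  unit zero (suc _) = 0ℤ
  unit (suc _) zero = 0ℤ
  unit (suc a) (suc i) = unit a i

  sum-unit : ∀ {N} (a : Fin N) (x : Fin N → ℤ) → sum (λ i → unit a i * x i) ≡ x a
  sum-unit zero x = trans (cong₂ _+_ (ℤₚ.*-identityˡ (x zero)) (∑-zero {f = λ i → unit zero (suc i) * x (suc i)} λ _ → refl)) (ℤₚ.+-identityʳ (x zero))
  sum-unit (suc a) x = trans (ℤₚ.+-identityˡ (sum λ i → unit a i * x (suc i))) (sum-unit a (x ∘ suc))

  record Lorentzian (𝔸 : Alphabet) (g : Language.State 𝔸 → ℤ) : Set where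
    field
      nonneg : ∀ σ → 0ℤ ≤ g σ
      exchange : Language.Exchange 𝔸 g
      hyperbolic : ∀ σ → LanguageForm.HypAt 𝔸 g σ

  module Closure (𝔸 : Alphabet) where
    open LanguageForm 𝔸
    open Lorentzian

    lorentzian-full : (∀ x → formal x ≡ false) → Lorentzian 𝔸 (Degenerate.full 𝔸)
    lorentzian-full plain = record
      { nonneg = λ σ → ⟦⟧≥0 (Degenerate.full? 𝔸 σ)
      ; exchange = Degenerate.exchange-full 𝔸 plain
      ; hyperbolic = Degenerate.hyp-full 𝔸 plain }

    lorentzian-free : ∀ (ω : Weights 𝔸) {g} → Lorentzian 𝔸 g → Lorentzian 𝔸 (free (Weights.h ω) g)
    lorentzian-free ω {g} l = record
      { nonneg = free≥0 (λ x → ℤₚ.<⇒≤ (Weights.h>0 ω x)) (nonneg l)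
      ; exchange = exchange-free (Weights.h>0 ω) (nonneg l) (exchange l)
      ; hyperbolic = FreeStep.hyp-free 𝔸 ω g (nonneg l) (exchange l) (hyperbolic l) }

    lorentzian-mark : ∀ {p} → formal p ≡ false → ∀ {g} → Lorentzian 𝔸 g → Lorentzian 𝔸 (mark p g)
    lorentzian-mark {p} fp {g} l = record
      { nonneg = mark≥0 {p} (nonneg l)
      ; exchange = exchange-mark fp (exchange l)
      ; hyperbolic = MarkStep.hyp-mark 𝔸 p fp g (nonneg l) (hyperbolic l) }

    fold : Weights 𝔸 → ∀ {g} → Lorentzian 𝔸 g → Language.State (extend 𝔸) → ℤ
    fold ω {g} l = Fold.fold 𝔸 ω g (nonneg l) (exchange l) (hyperbolic l)

    lorentzian-fold : ∀ (ω : Weights 𝔸) {g} (l : Lorentzian 𝔸 g) → Lorentzian (extend 𝔸) (fold ω l)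
    lorentzian-fold ω {g} l = record
      { nonneg = Fold.fold≥0 𝔸 ω g (nonneg l) (exchange l) (hyperbolic l)
      ; exchange = Fold.exchange-fold 𝔸 ω g (nonneg l) (exchange l) (hyperbolic l)
      ; hyperbolic = Fold.hyp-fold 𝔸 ω g (nonneg l) (exchange l) (hyperbolic l) }

    -- Formal letters precede nothing and therefore unlock nothing. On a and b the form is just the
    -- 2 × 2 matrix of values of `g`.
    formal-log-concave : ∀ {g} → Lorentzian 𝔸 g → ∀ σ a b → formal a ≡ true → formal b ≡ true →
      g (σ ⊕ a ⊕ a) * g (σ ⊕ b ⊕ b) ≤ g (σ ⊕ a ⊕ b) * g (σ ⊕ a ⊕ b)
    formal-log-concave {g} l σ a b fa fb with ≡0⊎> (nonneg l (σ ⊕ a ⊕ a))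
    ... | inj₁ z = subst (_≤ g (σ ⊕ a ⊕ b) * g (σ ⊕ a ⊕ b)) (sym (cong (_* g (σ ⊕ b ⊕ b)) z)) (0≤sq (g (σ ⊕ a ⊕ b)))
    ... | inj₂ pos = subst₂ _≤_ (cong₂ _*_ (entry a a fa fa) (entry b b fb fb)) (cong₂ _*_ (entry a b fa fb) (entry a b fa fb))
        (Hyperbolic.reverse-CS (O g σ) (D g σ) (O-sym g σ) (hyperbolic l σ) (unit a) (unit b) (subst (0ℤ <_) (sym (entry a a fa fa)) pos))
      where
      entry : ∀ a b → formal a ≡ true → formal b ≡ true → M.form g σ (unit a) (unit b) ≡ g (σ ⊕ a ⊕ b)
      entry a b fa fb = begin
          M.form g σ (unit a) (unit b)
            ≡⟨ sum-unit a (M.app g σ (unit b)) ⟩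
          sum (λ f → O g σ a f * unit b f) + D g σ a * unit b a
            ≡⟨ cong₂ _+_ (trans (sum-cong-≗ λ f → ℤₚ.*-comm (O g σ a f) (unit b f)) (sum-unit b (O g σ a)))
                 (cong (_* unit b a) (Degenerate.D-zero 𝔸 g σ a λ _ c ¬ac ac → contradiction (trans (sym fa) (≺-plain (ad-new ¬ac ac))) λ ())) ⟩
          O g σ a b + 0ℤ
            ≡⟨ ℤₚ.+-identityʳ (O g σ a b) ⟩
          O g σ a b
            ≡⟨ trans (guard-yes (ad? σ a) (always fa)) (trans (guard-yes (ad? σ b) (always fb)) (guard-yes (ad? (σ ⊕ a) b) (always fb))) ⟩
          g (σ ⊕ a ⊕ b) ∎
        where open ≡-Reasoning

  -- Words with free and marked slots

  module Template (n : ℕ) (_≺_ : Fin n → Fin n → Set) (_≺?_ : ∀ x y → Dec (x ≺ y)) where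

    𝔸₀ 𝔸₁ 𝔸₂ : Alphabet
    𝔸₀ = record { N = n ; formal = λ _ → false ; _≺_ = _≺_ ; _≺?_ = _≺?_ ; ≺-plain = λ _ → refl }
    𝔸₁ = extend 𝔸₀
    𝔸₂ = extend 𝔸₁

    module L₀ = LanguageForm 𝔸₀
    module L₁ = LanguageForm 𝔸₁
    module L₂ = LanguageForm 𝔸₂
    module E₀ = Extension 𝔸₀
    module E₁ = Extension 𝔸₁

    Slot : Set
    Slot = Maybe (Fin n)

    any : ℕ → List Slot
    any a = replicate a nothing

    one : Fin n → ℤ
    one _ = 1ℤ

    run : List Slot → L₀.State → ℤ
    run [] = Degenerate.full 𝔸₀
    run (nothing ∷ τ) = L₀.free one (run τ)
    run (just p ∷ τ) = L₀.mark p (run τ)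

    ω₀ : Weights 𝔸₀
    ω₀ = record { h = one ; co = one ; H = 1ℤ ; h>0 = λ _ → T>0 0 ; H>0 = T>0 0 ; co-h = λ _ → refl ; compatible = λ _ → refl }

    h₁ : ℤ → Fin (suc n) → ℤ
    h₁ T zero = 1ℤ
    h₁ T (suc _) = T

    ω₁ : ∀ T → 0ℤ < T → Weights 𝔸₁
    ω₁ T T>0′ = record { h = h₁ T ; co = co ; H = T ; h>0 = pos ; H>0 = T>0′ ; co-h = co-h ; compatible = λ {x} {y} → comp x y }
      where
      co : Fin (suc n) → ℤ
      co zero = T
      co (suc _) = 1ℤ
      pos : ∀ x → 0ℤ < h₁ T x
      pos zero = T>0 0
      pos (suc _) = T>0′
      co-h : ∀ x → co x * h₁ T x ≡ T
      co-h zero = ℤₚ.*-identityʳ T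
      co-h (suc _) = ℤₚ.*-identityˡ T
      comp : ∀ x y → Alphabet._≺_ 𝔸₁ x y → h₁ T x ≡ h₁ T y
      comp (suc x) (suc y) _ = refl

    h₂ : ℤ → Fin (suc (suc n)) → ℤ
    h₂ T zero = 1ℤ
    h₂ T (suc x) = h₁ T x

    ω₂ : ∀ T → 0ℤ < T → Weights 𝔸₂
    ω₂ T T>0′ = record { h = h₂ T ; co = co ; H = T ; h>0 = pos ; H>0 = T>0′ ; co-h = co-h ; compatible = λ {x} {y} → comp x y }
      where
      co : Fin (suc (suc n)) → ℤ
      co zero = T
      co (suc x) = Weights.co (ω₁ T T>0′) x
      pos : ∀ x → 0ℤ < h₂ T x
      pos zero = T>0 0
      pos (suc x) = Weights.h>0 (ω₁ T T>0′) x
      co-h : ∀ x → co x * h₂ T x ≡ T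
      co-h zero = ℤₚ.*-identityʳ T
      co-h (suc x) = Weights.co-h (ω₁ T T>0′) x
      comp : ∀ x y → Alphabet._≺_ 𝔸₂ x y → h₂ T x ≡ h₂ T y
      comp (suc x) (suc y) p = Weights.compatible (ω₁ T T>0′) {x} {y} p

    lorentzian-run : ∀ τ → Lorentzian 𝔸₀ (run τ)
    lorentzian-run [] = Closure.lorentzian-full 𝔸₀ λ _ → refl
    lorentzian-run (nothing ∷ τ) = Closure.lorentzian-free 𝔸₀ ω₀ (lorentzian-run τ)
    lorentzian-run (just p ∷ τ) = Closure.lorentzian-mark 𝔸₀ refl (lorentzian-run τ)

    -- The letters 0 and 1 of 𝔸₂ stand for an additional position before and after x.
    -- Their weight relative to the other letters is positive, so that no form
    -- degenerates, but tends to 0 as T → ∞.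
    module Move (pre : List Slot) (x : Fin n) (post : List Slot) where

      f₁ : L₁.State → ℤ
      f₁ = Closure.fold 𝔸₀ ω₀ (lorentzian-run post)

      f₂ : L₁.State → ℤ
      f₂ = L₁.mark (suc x) f₁

      lorentzian₂ : Lorentzian 𝔸₁ f₂
      lorentzian₂ = Closure.lorentzian-mark 𝔸₁ refl (Closure.lorentzian-fold 𝔸₀ ω₀ (lorentzian-run post))

      f₃ : ℕ → L₂.State → ℤ
      f₃ n = Closure.fold 𝔸₁ (ω₁ T[ n ] (T>0 n)) lorentzian₂

      run₂ : ℕ → List Slot → L₂.State → ℤ
      run₂ n [] = f₃ n
      -- One more position before x raises the degree of `f₃` in T by one. Against the formal letter
      -- that adds it, the ordinary letters prevail only with weight T².
      run₂ n (nothing ∷ τ) = L₂.free (h₂ (T[ n ] * T[ n ])) (run₂ n τ)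
      run₂ n (just p ∷ τ) = L₂.mark (suc (suc p)) (run₂ n τ)

      lorentzian-run₂ : ∀ n τ → Lorentzian 𝔸₂ (run₂ n τ)
      lorentzian-run₂ n [] = Closure.lorentzian-fold 𝔸₁ (ω₁ T[ n ] (T>0 n)) lorentzian₂
      lorentzian-run₂ n (nothing ∷ τ) = Closure.lorentzian-free 𝔸₂ (ω₂ (T[ n ] * T[ n ]) (0<* (T>0 n) (T>0 n))) (lorentzian-run₂ n τ)
      lorentzian-run₂ n (just p ∷ τ) = Closure.lorentzian-mark 𝔸₂ refl (lorentzian-run₂ n τ)

      around : ℕ → ℕ → List Slot
      around s t = any s ++ just x ∷ any t ++ post

      run≥0 : ∀ τ σ → 0ℤ ≤ run τ σ
      run≥0 τ = Lorentzian.nonneg (lorentzian-run τ)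

      f₁-run : ∀ t σ → f₁ (t ∷ σ) ≡ run (any t ++ post) σ
      f₁-run zero σ = refl
      f₁-run (suc t) σ = sum-cong-≗ λ y → cong (λ v → 1ℤ * (L₀.ι σ y * v)) (f₁-run t (σ L₀.⊕ y))

      f₂-run : ∀ t σ → f₂ (t ∷ σ) ≡ run (around 0 t) σ
      f₂-run t σ = cong₂ _*_ (E₀.ι⁺ t σ x) (f₁-run t (σ L₀.⊕ x))

      guarded : ∀ {e} {P : Fin n → Set} (d : ∀ y → Dec (P y)) (F : Fin n → ℕ → ℤ) {c : Fin n → ℤ} → (∀ y → Leading e (F y) (c y)) →
        ∀ y → Leading e (λ n → ⟦ d y ⟧ * F y n) (1ℤ * (⟦ d y ⟧ * c y))
      guarded d F {c} l y = leading-cong (λ _ → refl) (sym (ℤₚ.*-identityˡ (⟦ d y ⟧ * c y))) (leading-guard (d y) {F = F y} (l y))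

      -- Each of the s positions before x gives a factor T if an ordinary letter fills it, but only
      -- 1 if the other formal letter does; the latter words drop out of the top degree.
      f₃-leading : ∀ s t σ → Leading s (λ n → f₃ n (s ∷ t ∷ σ)) (run (around s t) σ)
      f₃-leading zero t σ = leading-cong (λ n → sym (f₂-run t σ)) refl (leading-const (run≥0 (around 0 t) σ))
      f₃-leading (suc s) t σ = leading-cong {suc s} (λ n → sym (eq n)) refl
          (leading-lower {s} {S} (leading-sum {F = λ y n → L₀.ι σ y * f₃ n (s ∷ t ∷ σ L₀.⊕ y)} (guarded (L₀.ad? σ) (λ y n → f₃ n (s ∷ t ∷ σ L₀.⊕ y)) λ y → f₃-leading s t (σ L₀.⊕ y))) (leading-drop (f₃-leading s (suc t) σ)))
        where
        S : ℕ → ℤ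
        S n = sum (λ y → L₀.ι σ y * f₃ n (s ∷ t ∷ σ L₀.⊕ y))
        eq : ∀ n → f₃ n (suc s ∷ t ∷ σ) ≡ f₃ n (s ∷ suc t ∷ σ) + T[ n ] * S n
        eq n = cong₂ _+_ (trans (ℤₚ.*-identityˡ _) (trans (cong (_* f₃ n (s ∷ suc t ∷ σ)) (E₀.ι₀ (t ∷ σ))) (ℤₚ.*-identityˡ _)))
          (trans (sum-cong-≗ λ y → cong (λ i → T[ n ] * (i * f₃ n (s ∷ t ∷ σ L₀.⊕ y))) (E₀.ι⁺ t σ y))
            (∑-* T[ n ] (λ y → L₀.ι σ y * f₃ n (s ∷ t ∷ σ L₀.⊕ y))))

      -- Counts every free slot twice: it is the exponent of T that the weights T² contribute.
      free-slots : List Slot → ℕ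
      free-slots [] = 0
      free-slots (nothing ∷ τ) = suc (suc (free-slots τ))
      free-slots (just _ ∷ τ) = free-slots τ

      run₂-leading : ∀ τ s t σ → Leading (free-slots τ ℕ.+ s) (λ n → run₂ n τ (s ∷ t ∷ σ)) (run (τ ++ around s t) σ)
      run₂-leading [] s t σ = f₃-leading s t σ
      run₂-leading (just p ∷ τ) s t σ = leading-cong (λ n → cong (_* run₂ n τ (s ∷ t ∷ σ L₀.⊕ p)) (sym (trans (E₁.ι⁺ s (t ∷ σ) (suc p)) (E₀.ι⁺ t σ p)))) refl
        (leading-guard (L₀.ad? σ p) {F = λ n → run₂ n τ (s ∷ t ∷ σ L₀.⊕ p)} (run₂-leading τ s t (σ L₀.⊕ p)))
      run₂-leading (nothing ∷ τ) s t σ = leading-cong {suc (suc E)} (λ n → sym (eq n)) refl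
          (leading-lower {suc E} {λ n → T[ n ] * S n} {R}
            (leading-T* {E} {S} (leading-sum {F = λ y n → L₀.ι σ y * run₂ n τ (s ∷ t ∷ σ L₀.⊕ y)}
              (guarded (L₀.ad? σ) (λ y n → run₂ n τ (s ∷ t ∷ σ L₀.⊕ y)) λ y → run₂-leading τ s t (σ L₀.⊕ y))))
            (leading-+ {F = λ n → run₂ n τ (suc s ∷ t ∷ σ)} {λ n → run₂ n τ (s ∷ suc t ∷ σ)}
              (subst (λ e → Leading (suc e) (λ n → run₂ n τ (suc s ∷ t ∷ σ)) 0ℤ) (ℕₚ.+-suc (free-slots τ) s)
                (leading-drop {F = λ n → run₂ n τ (suc s ∷ t ∷ σ)} (run₂-leading τ (suc s) t σ)))
              (leading-drop {suc E} {λ n → run₂ n τ (s ∷ suc t ∷ σ)} (leading-drop {E} {λ n → run₂ n τ (s ∷ suc t ∷ σ)} (run₂-leading τ s (suc t) σ)))))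
        where
        E : ℕ
        E = free-slots τ ℕ.+ s
        S R : ℕ → ℤ
        S n = sum (λ y → L₀.ι σ y * run₂ n τ (s ∷ t ∷ σ L₀.⊕ y))
        R n = run₂ n τ (suc s ∷ t ∷ σ) + run₂ n τ (s ∷ suc t ∷ σ)
        open ≡-Reasoning
        eq : ∀ n → run₂ n (nothing ∷ τ) (s ∷ t ∷ σ) ≡ R n + T[ n ] * (T[ n ] * S n)
        eq n = begin
          1ℤ * (L₂.ι (s ∷ t ∷ σ) zero * a) + (1ℤ * (L₂.ι (s ∷ t ∷ σ) (suc zero) * b)
            + sum (λ y → TT * (L₂.ι (s ∷ t ∷ σ) (suc (suc y)) * f y)))
            ≡⟨ cong₂ (λ i q → 1ℤ * (i * a) + q) (E₁.ι₀ (s ∷ t ∷ σ)) (cong₂ (λ i q → 1ℤ * (i * b) + q) (trans (E₁.ι⁺ s (t ∷ σ) zero) (E₀.ι₀ (t ∷ σ)))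
                 (trans (sum-cong-≗ λ y → cong (λ i → TT * (i * f y)) (trans (E₁.ι⁺ s (t ∷ σ) (suc y)) (E₀.ι⁺ t σ y)))
                   (∑-* TT (λ y → L₀.ι σ y * f y)))) ⟩
          1ℤ * (1ℤ * a) + (1ℤ * (1ℤ * b) + TT * S n)
            ≡⟨ r a b T[ n ] (S n) ⟩
          a + b + T[ n ] * (T[ n ] * S n) ∎
          where
          TT a b : ℤ
          TT = T[ n ] * T[ n ]
          a = run₂ n τ (suc s ∷ t ∷ σ)
          b = run₂ n τ (s ∷ suc t ∷ σ)
          f : Fin _ → ℤ
          f y = run₂ n τ (s ∷ t ∷ σ L₀.⊕ y)
          r : ∀ a b t s → 1ℤ * (1ℤ * a) + (1ℤ * (1ℤ * b) + t * t * s) ≡ a + b + t * (t * s)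
          r = solve-∀

      log-concave : ∀ σ → run (pre ++ around 2 0) σ * run (pre ++ around 0 2) σ
        ≤ run (pre ++ around 1 1) σ * run (pre ++ around 1 1) σ
      log-concave σ = leading-compare {free-slots pre ℕ.+ 0}
        (subst (λ e → Leading e (λ n → run₂ n pre (2 ∷ 0 ∷ σ)) (run (pre ++ around 2 0) σ)) (trans (ℕₚ.+-suc (free-slots pre) 1) (cong suc (ℕₚ.+-suc (free-slots pre) 0))) (run₂-leading pre 2 0 σ))
        (subst (λ e → Leading e (λ n → run₂ n pre (1 ∷ 1 ∷ σ)) (run (pre ++ around 1 1) σ)) (ℕₚ.+-suc (free-slots pre) 0) (run₂-leading pre 1 1 σ))
        (run₂-leading pre 0 2 σ)
        (λ n → Closure.formal-log-concave 𝔸₂ (lorentzian-run₂ n pre) (0 ∷ 0 ∷ σ) zero (suc zero) refl refl)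

  -- Counting linear extensions

  open import Defs
    using (FinPoset; allVecs; IsLinExt; isLinExt?; pos; Places; places?; shift; _<P_; _<P?_)
    renaming (N to count)

  tally : ∀ {A : Set} {P : A → Set} → (∀ x → Dec (P x)) → List A → ℤ
  tally P? [] = 0ℤ
  tally P? (x ∷ xs) = ⟦ P? x ⟧ + tally P? xs

  tally-filter : ∀ {A : Set} {P : A → Set} (P? : ∀ x → Dec (P x)) xs → + List.length (List.filter P? xs) ≡ tally P? xs
  tally-filter P? [] = refl
  tally-filter P? (x ∷ xs) with P? x
  ... | yes _ = cong (λ z → 1ℤ + z) (tally-filter P? xs)
  ... | no _ = trans (tally-filter P? xs) (sym (ℤₚ.+-identityˡ (tally P? xs)))

  tally-++ : ∀ {A : Set} {P : A → Set} (P? : ∀ x → Dec (P x)) xs ys → tally P? (xs ++ ys) ≡ tally P? xs + tally P? ys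
  tally-++ P? [] ys = sym (ℤₚ.+-identityˡ (tally P? ys))
  tally-++ P? (x ∷ xs) ys = trans (cong (λ z → ⟦ P? x ⟧ + z) (tally-++ P? xs ys)) (sym (ℤₚ.+-assoc ⟦ P? x ⟧ (tally P? xs) (tally P? ys)))

  tally-map : ∀ {A B : Set} {P : B → Set} (P? : ∀ x → Dec (P x)) (f : A → B) xs → tally P? (List.map f xs) ≡ tally (λ x → P? (f x)) xs
  tally-map P? f [] = refl
  tally-map P? f (x ∷ xs) = cong (λ z → ⟦ P? (f x) ⟧ + z) (tally-map P? f xs)

  tally-concatMap : ∀ {A B : Set} {P : B → Set} (P? : ∀ x → Dec (P x)) (f : A → List B) {N} (k : Fin N → A) →
    tally P? (List.concatMap f (List.tabulate k)) ≡ sum (λ i → tally P? (f (k i)))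
  tally-concatMap P? f {zero} k = refl
  tally-concatMap P? f {suc N} k = trans (tally-++ P? (f (k zero)) (List.concatMap f (List.tabulate (k ∘ suc))))
    (cong (λ z → tally P? (f (k zero)) + z) (tally-concatMap P? f (k ∘ suc)))

  tally-iff : ∀ {A : Set} {P Q : A → Set} (P? : ∀ x → Dec (P x)) (Q? : ∀ x → Dec (Q x)) →
    (∀ x → P x → Q x) → (∀ x → Q x → P x) → ∀ xs → tally P? xs ≡ tally Q? xs
  tally-iff P? Q? f g [] = refl
  tally-iff P? Q? f g (x ∷ xs) = cong₂ _+_ (⟦⟧-iff (P? x) (Q? x) (f x) (g x)) (tally-iff P? Q? f g xs)

  tally-× : ∀ {A R : Set} {P : A → Set} (R? : Dec R) (P? : ∀ x → Dec (P x)) xs →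
    tally (λ x → R? ×-dec P? x) xs ≡ ⟦ R? ⟧ * tally P? xs
  tally-× R? P? [] = sym (ℤₚ.*-zeroʳ ⟦ R? ⟧)
  tally-× R? P? (x ∷ xs) = trans (cong₂ _+_ (head R?) (tally-× R? P? xs)) (sym (ℤₚ.*-distribˡ-+ ⟦ R? ⟧ ⟦ P? x ⟧ (tally P? xs)))
    where
    head : ∀ {R} (R? : Dec R) → ⟦ R? ×-dec P? x ⟧ ≡ ⟦ R? ⟧ * ⟦ P? x ⟧
    head (no _) = refl
    head (yes _) with P? x
    ... | yes _ = refl
    ... | no _ = refl

  tally-none : ∀ {A : Set} {P : A → Set} (P? : ∀ x → Dec (P x)) → (∀ x → ¬ P x) → ∀ xs → tally P? xs ≡ 0ℤ
  tally-none P? f [] = refl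
  tally-none P? f (x ∷ xs) = cong₂ _+_ (⟦⟧-no (P? x) (f x)) (tally-none P? f xs)

  unit-≡ : ∀ {N} (a i : Fin N) → unit a i ≡ ⟦ a Finₚ.≟ i ⟧
  unit-≡ a i with a Finₚ.≟ i
  ... | yes refl = same a
    where
    same : ∀ {N} (a : Fin N) → unit a a ≡ 1ℤ
    same zero = refl
    same (suc a) = same a
  ... | no a≢i = differ a i a≢i
    where
    differ : ∀ {N} (a i : Fin N) → a ≢ i → unit a i ≡ 0ℤ
    differ zero zero p = contradiction refl p
    differ zero (suc i) p = refl
    differ (suc a) zero p = refl
    differ (suc a) (suc i) p = differ a i (p ∘ cong suc)

  module Words (n : ℕ) (_≺_ : Fin n → Fin n → Set) (_≺?_ : ∀ x y → Dec (x ≺ y)) where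
    open Template n _≺_ _≺?_
    open L₀ using (State; Ad; ad?; _⊕_; ι; ready; look-same; look-other; look-mono; ad-plain; >⇒≢0; ≢0⇒>)

    Ordered : State → ∀ {m} → Vec (Fin n) m → Set
    Ordered σ [] = ∀ x → lookup σ x ≢ 0
    Ordered σ (x ∷ w) = Ad σ x × Ordered (σ ⊕ x) w

    ordered? : ∀ σ {m} (w : Vec (Fin n) m) → Dec (Ordered σ w)
    ordered? σ [] = Degenerate.full? 𝔸₀ σ
    ordered? σ (x ∷ w) = ad? σ x ×-dec ordered? (σ ⊕ x) w

    Fits : Slot → Fin n → Set
    Fits nothing _ = ⊤
    Fits (just p) x = p ≡ x

    fits? : ∀ s x → Dec (Fits s x)
    fits? nothing _ = yes tt
    fits? (just p) x = p Finₚ.≟ x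

    Matches : List Slot → ∀ {m} → Vec (Fin n) m → Set
    Matches [] [] = ⊤
    Matches (s ∷ τ) (x ∷ w) = Fits s x × Matches τ w
    Matches _ _ = ⊥

    matches? : ∀ τ {m} (w : Vec (Fin n) m) → Dec (Matches τ w)
    matches? [] [] = yes tt
    matches? [] (_ ∷ _) = no λ ()
    matches? (_ ∷ _) [] = no λ ()
    matches? (s ∷ τ) (x ∷ w) = fits? s x ×-dec matches? τ w

    admissible? : ∀ τ σ {m} (w : Vec (Fin n) m) → Dec (Ordered σ w × Matches τ w)
    admissible? τ σ w = ordered? σ w ×-dec matches? τ w

    run-step : ∀ s τ σ → run (s ∷ τ) σ ≡ sum (λ x → ⟦ fits? s x ⟧ * (ι σ x * run τ (σ ⊕ x)))
    run-step nothing τ σ = refl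
    run-step (just p) τ σ = trans (sym (sum-unit p (λ x → ι σ x * run τ (σ ⊕ x))))
      (sum-cong-≗ λ x → cong (_* (ι σ x * run τ (σ ⊕ x))) (unit-≡ p x))

    run-tally : ∀ τ σ → run τ σ ≡ tally (admissible? τ σ) (allVecs n (List.length τ))
    run-tally [] σ = trans (⟦⟧-iff (Degenerate.full? 𝔸₀ σ) (admissible? [] σ []) (λ p → p , tt) proj₁) (sym (ℤₚ.+-identityʳ _))
    run-tally (s ∷ τ) σ = begin
        run (s ∷ τ) σ
          ≡⟨ run-step s τ σ ⟩
        sum (λ x → ⟦ fits? s x ⟧ * (ι σ x * run τ (σ ⊕ x)))
          ≡⟨ sum-cong-≗ (λ x → trans (cong (λ z → ⟦ fits? s x ⟧ * (ι σ x * z)) (run-tally τ (σ ⊕ x))) (sym (letter x))) ⟩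
        sum (λ x → tally (admissible? (s ∷ τ) σ) (List.map (x ∷_) ws))
          ≡⟨ sym (tally-concatMap (admissible? (s ∷ τ) σ) (λ x → List.map (x ∷_) ws) (λ x → x)) ⟩
        tally (admissible? (s ∷ τ) σ) (allVecs n (suc (List.length τ))) ∎
      where
      open ≡-Reasoning
      ws : List (Vec (Fin n) (List.length τ))
      ws = allVecs n (List.length τ)
      letter : ∀ x → tally (admissible? (s ∷ τ) σ) (List.map (x ∷_) ws) ≡ ⟦ fits? s x ⟧ * (ι σ x * tally (admissible? τ (σ ⊕ x)) ws)
      letter x = trans (tally-map (admissible? (s ∷ τ) σ) (x ∷_) ws)
        (trans (tally-iff (λ w → admissible? (s ∷ τ) σ (x ∷ w)) (λ w → fits? s x ×-dec (ad? σ x ×-dec admissible? τ (σ ⊕ x) w))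
          (λ { w ((a , o) , (f , m)) → f , a , o , m }) (λ { w (f , a , o , m) → (a , o) , (f , m) }) ws)
        (trans (tally-× (fits? s x) (λ w → ad? σ x ×-dec admissible? τ (σ ⊕ x) w) ws)
          (cong (⟦ fits? s x ⟧ *_) (tally-× (ad? σ x) (admissible? τ (σ ⊕ x)) ws))))

  -- Linear extensions as admissible words

  module Extensions {n : ℕ} (P : FinPoset n) where

    -- Words are read from the top of the poset downwards.
    _≺_ : Fin n → Fin n → Set
    x ≺ y = _<P_ P y x

    open Template n _≺_ (λ x y → _<P?_ P y x)
    open Words n _≺_ (λ x y → _<P?_ P y x)
    open L₀ using (State; Ad; ad?; _⊕_; ready; look-same; look-other; look-mono; ad-plain; >⇒≢0; ≢0⇒>)

    -- The conditions on a linear extension relative to a prefix already read, a form that survives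
    -- moving the first letter of w into σ.
    record Valid (σ : State) {m} (w : Vec (Fin n) m) : Set where
      constructor valid
      field
        fresh : ∀ i → lookup σ (lookup w i) ≡ 0
        distinct : ∀ i j → lookup w i ≡ lookup w j → i ≡ j
        after : ∀ i y → y ≺ lookup w i → lookup σ y ≢ 0 ⊎ ∃ λ j → toℕ j ℕ.< toℕ i × lookup w j ≡ y
        exhaustive : ∀ x → lookup σ x ≢ 0 ⊎ ∃ λ i → lookup w i ≡ x

    placed : ∀ σ x → lookup (σ ⊕ x) x ≢ 0
    placed σ x q = contradiction (trans (sym (look-same σ x)) q) λ ()

    still : ∀ σ x y → lookup σ y ≢ 0 → lookup (σ ⊕ x) y ≢ 0
    still σ x y p = >⇒≢0 (ℕₚ.<-≤-trans (≢0⇒> p) (look-mono σ x y))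

    before : ∀ σ x y → lookup (σ ⊕ x) y ≢ 0 → lookup σ y ≢ 0 ⊎ x ≡ y
    before σ x y p with y Finₚ.≟ x
    ... | yes y≡x = inj₂ (sym y≡x)
    ... | no y≢x = inj₁ λ q → p (trans (look-other σ y≢x) q)

    valid⇒ordered : ∀ {σ m} (w : Vec (Fin n) m) → Valid σ w → Ordered σ w
    valid⇒ordered [] v x with Valid.exhaustive v x
    ... | inj₁ p = p
    ... | inj₂ (() , _)
    valid⇒ordered {σ} (x ∷ w) (valid fresh distinct after exhaustive) = ready (fresh zero) first , valid⇒ordered w (valid fresh′ distinct′ after′ exhaustive′)
      where
      first : ∀ y → y ≺ x → lookup σ y ≢ 0
      first y r with after zero y r
      ... | inj₁ p = p
      ... | inj₂ (_ , () , _)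
      fresh′ : ∀ i → lookup (σ ⊕ x) (lookup w i) ≡ 0
      fresh′ i = trans (look-other σ λ q → contradiction (distinct (suc i) zero q) λ ()) (fresh (suc i))
      distinct′ : ∀ i j → lookup w i ≡ lookup w j → i ≡ j
      distinct′ i j q = Finₚ.suc-injective (distinct (suc i) (suc j) q)
      after′ : ∀ i y → y ≺ lookup w i → lookup (σ ⊕ x) y ≢ 0 ⊎ ∃ λ j → toℕ j ℕ.< toℕ i × lookup w j ≡ y
      after′ i y r with after (suc i) y r
      ... | inj₁ p = inj₁ (still σ x y p)
      ... | inj₂ (zero , _ , refl) = inj₁ (placed σ x)
      ... | inj₂ (suc j , ℕ.s≤s lt , q) = inj₂ (j , lt , q)
      exhaustive′ : ∀ y → lookup (σ ⊕ x) y ≢ 0 ⊎ ∃ λ i → lookup w i ≡ y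
      exhaustive′ y with exhaustive y
      ... | inj₁ p = inj₁ (still σ x y p)
      ... | inj₂ (zero , refl) = inj₁ (placed σ x)
      ... | inj₂ (suc i , q) = inj₂ (i , q)

    ordered⇒valid : ∀ {σ m} (w : Vec (Fin n) m) → Ordered σ w → Valid σ w
    ordered⇒valid [] o = valid (λ ()) (λ ()) (λ ()) (λ x → inj₁ (o x))
    ordered⇒valid {σ} (x ∷ w) (a , o) with ordered⇒valid w o
    ... | valid fresh distinct after exhaustive = valid fresh′ distinct′ after′ exhaustive′
      where
      x∉ : lookup σ x ≡ 0
      x∉ = proj₁ (ad-plain refl a)
      x≢ : ∀ i → x ≢ lookup w i
      x≢ i refl = placed σ x (fresh i)
      fresh′ : ∀ i → lookup σ (lookup (x ∷ w) i) ≡ 0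
      fresh′ zero = x∉
      fresh′ (suc i) = trans (sym (look-other σ (x≢ i ∘ sym))) (fresh i)
      distinct′ : ∀ i j → lookup (x ∷ w) i ≡ lookup (x ∷ w) j → i ≡ j
      distinct′ zero zero _ = refl
      distinct′ zero (suc j) q = contradiction q (x≢ j)
      distinct′ (suc i) zero q = contradiction (sym q) (x≢ i)
      distinct′ (suc i) (suc j) q = cong suc (distinct i j q)
      after′ : ∀ i y → y ≺ lookup (x ∷ w) i → lookup σ y ≢ 0 ⊎ ∃ λ j → toℕ j ℕ.< toℕ i × lookup (x ∷ w) j ≡ y
      after′ zero y r = inj₁ (proj₂ (ad-plain refl a) y r)
      after′ (suc i) y r with after i y r
      ... | inj₂ (j , lt , q) = inj₂ (suc j , ℕ.s≤s lt , q)
      ... | inj₁ p with before σ x y p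
      ...   | inj₁ p′ = inj₁ p′
      ...   | inj₂ q = inj₂ (zero , ℕ.s≤s ℕ.z≤n , q)
      exhaustive′ : ∀ y → lookup σ y ≢ 0 ⊎ ∃ λ i → lookup (x ∷ w) i ≡ y
      exhaustive′ y with exhaustive y
      ... | inj₂ (i , q) = inj₂ (suc i , q)
      ... | inj₁ p with before σ x y p
      ...   | inj₁ p′ = inj₁ p′
      ...   | inj₂ q = inj₂ (zero , q)

    start : State
    start = Vec.replicate n 0

    start-empty : ∀ x → lookup start x ≡ 0
    start-empty x = Vecₚ.lookup-replicate x 0

    ordered⇒linExt : ∀ w → Ordered start w → IsLinExt P w
    ordered⇒linExt w o with ordered⇒valid w o
    ... | valid fresh distinct after exhaustive = distinct , surjective , reversing
      where
      surjective : ∀ x → ∃ λ i → lookup w i ≡ x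
      surjective x with exhaustive x
      ... | inj₁ p = contradiction (start-empty x) p
      ... | inj₂ q = q
      reversing : ∀ i j → _<P_ P (lookup w i) (lookup w j) → toℕ j ℕ.< toℕ i
      reversing i j r with after i (lookup w j) r
      ... | inj₁ p = contradiction (start-empty (lookup w j)) p
      ... | inj₂ (k , lt , q) = subst (λ k → toℕ k ℕ.< toℕ i) (distinct k j q) lt

    linExt⇒ordered : ∀ w → IsLinExt P w → Ordered start w
    linExt⇒ordered w (distinct , surjective , reversing) = valid⇒ordered w
        (valid (λ i → start-empty (lookup w i)) distinct after (λ x → inj₂ (surjective x)))
      where
      after : ∀ i y → y ≺ lookup w i → lookup start y ≢ 0 ⊎ ∃ λ j → toℕ j ℕ.< toℕ i × lookup w j ≡ y
      after i y r with surjective y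
      ... | j , refl = inj₂ (j , reversing i j r , refl)

    At : ∀ {m} → Vec (Fin n) m → ℕ → Fin n → Set
    At w k y = ∃ λ i → toℕ i ≡ k × lookup w i ≡ y

    Describes : List Slot → ∀ {k} → (Fin k → ℕ) → (Fin k → Fin n) → Set
    Describes τ q y = ∀ {l} (w : Vec (Fin n) l) → List.length τ ≡ l →
      (Matches τ w → ∀ t → At w (q t) (y t)) × ((∀ t → At w (q t) (y t)) → Matches τ w)

    describes-free : ∀ r {y : Fin 0 → Fin n} → Describes (any r) (λ ()) y
    describes-free zero [] _ = (λ _ ()) , λ _ → tt
    describes-free (suc r) (x ∷ w) e = (λ _ ()) , λ _ → tt , proj₂ (describes-free r {λ ()} w (ℕₚ.suc-injective e)) (λ ())

    describes-any : ∀ a {τ k} {q : Fin k → ℕ} {y : Fin k → Fin n} → Describes τ q y → Describes (any a ++ τ) (λ t → a ℕ.+ q t) y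
    describes-any zero d = d
    describes-any (suc a) d [] ()
    describes-any (suc a) {τ} {k} {q} {y} d (x ∷ w) e = to , from
      where
      ih = describes-any a {τ} {k} {q} {y} d w (ℕₚ.suc-injective e)
      to : Matches (any (suc a) ++ τ) (x ∷ w) → ∀ t → At (x ∷ w) (suc a ℕ.+ q t) (y t)
      to (_ , m) t with proj₁ ih m t
      ... | i , e , f = suc i , cong suc e , f
      from : (∀ t → At (x ∷ w) (suc a ℕ.+ q t) (y t)) → Matches (any (suc a) ++ τ) (x ∷ w)
      from f = tt , proj₂ ih λ t → case f t of λ { (zero , () , _) ; (suc i , e , g) → i , ℕₚ.suc-injective e , g }

    describes-just : ∀ {τ k} {q : Fin k → ℕ} {y : Fin (suc k) → Fin n} (q′ : Fin (suc k) → ℕ) → q′ zero ≡ 0 → (∀ t → q′ (suc t) ≡ suc (q t)) →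
      Describes τ q (y ∘ suc) → Describes (just (y zero) ∷ τ) q′ y
    describes-just q′ _ _ d [] ()
    describes-just {τ} {k} {q} {y} q′ z s d (x ∷ w) e = to , from
      where
      ih = d w (ℕₚ.suc-injective e)
      to : Matches (just (y zero) ∷ τ) (x ∷ w) → ∀ t → At (x ∷ w) (q′ t) (y t)
      to (f , _) zero = zero , sym z , sym f
      to (_ , m) (suc t) with proj₁ ih m t
      ... | i , e , f = suc i , trans (cong suc e) (sym (s t)) , f
      from : (∀ t → At (x ∷ w) (q′ t) (y t)) → Matches (just (y zero) ∷ τ) (x ∷ w)
      from f = (case f zero of λ { (zero , _ , g) → sym g ; (suc i , e , _) → contradiction (trans e z) λ () }) ,
        proj₂ ih λ t → case f (suc t) of λ
          { (zero , e , _) → contradiction (trans e (s t)) λ ()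
          ; (suc i , e , g) → i , ℕₚ.suc-injective (trans e (s t)) , g }

    template : ∀ m → (Fin (suc m) → Fin n) → (Fin m → ℕ) → List Slot
    template zero p a = just (p zero) ∷ []
    template (suc m) p a = just (p zero) ∷ any (a zero) ++ template m (p ∘ suc) (a ∘ suc)

    template-cong : ∀ m p {a b : Fin m → ℕ} → (∀ l → a l ≡ b l) → template m p a ≡ template m p b
    template-cong zero p e = refl
    template-cong (suc m) p e = cong (just (p zero) ∷_) (cong₂ (λ k τ → any k ++ τ) (e zero) (template-cong m (p ∘ suc) (e ∘ suc)))

    length-template : ∀ m p a → List.length (template m p a) ≡ suc (pos a (fromℕ m))
    length-template zero p a = refl
    length-template (suc m) p a = cong suc (trans (Listₚ.length-++ (any (a zero)))
      (trans (cong₂ ℕ._+_ (Listₚ.length-replicate (a zero)) (length-template m (p ∘ suc) (a ∘ suc))) (ℕₚ.+-suc (a zero) _)))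

    describes-template : ∀ m p a r → Describes (template m p a ++ any r) (pos a) p
    describes-template zero p a r = describes-just (pos a) refl (λ ()) (describes-free r)
    describes-template (suc m) p a r = describes-just {q = λ t → a zero ℕ.+ pos (a ∘ suc) t} (pos a) refl (λ _ → refl)
      (subst (λ τ → Describes τ (λ t → a zero ℕ.+ pos (a ∘ suc) t) (p ∘ suc))
        (sym (Listₚ.++-assoc (any (a zero)) (template m (p ∘ suc) (a ∘ suc)) (any r)))
        (describes-any (a zero) (describes-template m (p ∘ suc) (a ∘ suc) r)))

    -- Free slots after the last mark bring the pattern to length n, so that it describes whole
    -- words.
    count-run : ∀ {m} p a → List.length (template m p a) ℕ.≤ n →
      + count P p a ≡ run (template m p a ++ any (n ℕ.∸ List.length (template m p a))) start
    count-run {m} p a le = begin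
        + count P p a
          ≡⟨ tally-filter (λ w → isLinExt? P w ×-dec places? p a w) (allVecs n n) ⟩
        tally (λ w → isLinExt? P w ×-dec places? p a w) (allVecs n n)
          ≡⟨ tally-iff (λ w → isLinExt? P w ×-dec places? p a w) (admissible? τ start)
               (λ { w (e , q) → linExt⇒ordered w e , proj₂ (describes-template m p a r w len) q })
               (λ { w (o , q) → ordered⇒linExt w o , proj₁ (describes-template m p a r w len) q }) (allVecs n n) ⟩
        tally (admissible? τ start) (allVecs n n)
          ≡⟨ cong (λ l → tally (admissible? τ start) (allVecs n l)) (sym len) ⟩
        tally (admissible? τ start) (allVecs n (List.length τ))
          ≡⟨ sym (run-tally τ start) ⟩
        run τ start ∎
      where
      open ≡-Reasoning
      r : ℕ
      r = n ℕ.∸ List.length (template m p a)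
      τ : List Slot
      τ = template m p a ++ any r
      len : List.length τ ≡ n
      len = trans (Listₚ.length-++ (template m p a)) (trans (cong (List.length (template m p a) ℕ.+_) (Listₚ.length-replicate r)) (ℕₚ.m+[n∸m]≡n le))

    count-overflow : ∀ {m} p a → n ℕ.< List.length (template m p a) → count P p a ≡ 0
    count-overflow {m} p a lt = ℤₚ.+-injective (trans (tally-filter (λ w → isLinExt? P w ×-dec places? p a w) (allVecs n n))
      (tally-none (λ w → isLinExt? P w ×-dec places? p a w) impossible (allVecs n n)))
      where
      impossible : ∀ w → ¬ (IsLinExt P w × Places p a w)
      impossible w (_ , q) with q (fromℕ m)
      ... | i , e , _ = ℕₚ.<⇒≱ (ℕₚ.≤-trans (ℕₚ.≤-reflexive (cong suc (sym e))) (Finₚ.toℕ<n i))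
                          (ℕₚ.≤-pred (subst (suc n ℕ.≤_) (length-template m p a) lt))

    Agree : ∀ {m} → (u d : Fin m) → (a b : Fin m → ℕ) → Set
    Agree u d a b = ∀ l → l ≢ u → l ≢ d → b l ≡ a l

    -- The parts `pre`, x and `post` are chosen before b, so that all three gap sequences share
    -- them.
    template-split : ∀ m p (a : Fin m → ℕ) (u d : Fin m) → toℕ d ≡ suc (toℕ u) →
      ∃ λ pre → ∃₂ λ x post → ∀ b → Agree u d a b → template m p b ≡ pre ++ any (b u) ++ just x ∷ any (b d) ++ post
    template-split (suc (suc m)) p a zero (suc zero) _ =
      just (p zero) ∷ [] , p (suc zero) , template m (λ l → p (suc (suc l))) (λ l → a (suc (suc l))) , λ b agree →
        cong (λ τ → just (p zero) ∷ any (b zero) ++ just (p (suc zero)) ∷ any (b (suc zero)) ++ τ)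
          (template-cong m (λ l → p (suc (suc l))) λ l → agree (suc (suc l)) (λ ()) (λ ()))
    template-split (suc (suc m)) p a zero (suc (suc d)) ()
    template-split (suc m) p a (suc u) (suc d) e with template-split m (p ∘ suc) (a ∘ suc) u d (ℕₚ.suc-injective e)
    ... | pre , x , post , f = just (p zero) ∷ any (a zero) ++ pre , x , post , λ b agree →
        cong (just (p zero) ∷_) (trans (cong₂ (λ k τ → any k ++ τ) (agree zero (λ ()) (λ ()))
          (f (b ∘ suc) λ l l≢u l≢d → agree (suc l) (l≢u ∘ Finₚ.suc-injective) (l≢d ∘ Finₚ.suc-injective)))
          (sym (Listₚ.++-assoc (any (a zero)) pre _)))

    any-+ : ∀ a b → any (a ℕ.+ b) ≡ any a ++ any b
    any-+ zero b = refl
    any-+ (suc a) b = cong (nothing ∷_) (any-+ a b)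

    -- The A and B slots common to all three patterns move to the outer parts. What varies next to x
    -- is (s, t) = (2, 0), (1, 1), (0, 2), the exponents of the two formal letters.
    regroup : ∀ pre A s x t B post r →
      (pre ++ any (s ℕ.+ A) ++ just x ∷ any (t ℕ.+ B) ++ post) ++ any r ≡ (pre ++ any A) ++ any s ++ just x ∷ any t ++ (any B ++ post ++ any r)
    regroup pre A s x t B post r = begin
        (pre ++ any (s ℕ.+ A) ++ Y) ++ R
          ≡⟨ cong (λ k → (pre ++ any k ++ Y) ++ R) (ℕₚ.+-comm s A) ⟩
        (pre ++ any (A ℕ.+ s) ++ Y) ++ R
          ≡⟨ cong (λ τ → (pre ++ τ ++ Y) ++ R) (any-+ A s) ⟩
        (pre ++ (any A ++ any s) ++ Y) ++ R
          ≡⟨ Listₚ.++-assoc pre ((any A ++ any s) ++ Y) R ⟩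
        pre ++ ((any A ++ any s) ++ Y) ++ R
          ≡⟨ cong (pre ++_) (trans (Listₚ.++-assoc (any A ++ any s) Y R) (Listₚ.++-assoc (any A) (any s) (Y ++ R))) ⟩
        pre ++ any A ++ any s ++ Y ++ R
          ≡⟨ sym (Listₚ.++-assoc pre (any A) (any s ++ Y ++ R)) ⟩
        (pre ++ any A) ++ any s ++ just x ∷ (any (t ℕ.+ B) ++ post) ++ R
          ≡⟨ cong (λ τ → (pre ++ any A) ++ any s ++ just x ∷ τ) (trans (cong (λ τ → (τ ++ post) ++ R) (any-+ t B))
               (trans (Listₚ.++-assoc (any t ++ any B) post R) (Listₚ.++-assoc (any t) (any B) (post ++ R)))) ⟩
        (pre ++ any A) ++ any s ++ just x ∷ any t ++ (any B ++ post ++ R) ∎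
      where
      open ≡-Reasoning
      Y R : List Slot
      Y = just x ∷ any (t ℕ.+ B) ++ post
      R = any r

    length-split : ∀ pre s x t post → List.length (pre ++ any s ++ just x ∷ any t ++ post) ≡ List.length pre ℕ.+ suc (s ℕ.+ t ℕ.+ List.length post)
    length-split pre s x t post = trans (Listₚ.length-++ pre) (cong (List.length pre ℕ.+_) (trans (Listₚ.length-++ (any s))
      (trans (cong₂ ℕ._+_ (Listₚ.length-replicate s) (cong suc (trans (Listₚ.length-++ (any t)) (cong (ℕ._+ List.length post) (Listₚ.length-replicate t)))))
        (trans (ℕₚ.+-suc s (t ℕ.+ List.length post)) (cong suc (sym (ℕₚ.+-assoc s t (List.length post))))))))

    module _ {m} (a : Fin m → ℕ) (u d : Fin m) where

      shift-up : shift a u d u ≡ suc (a u)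
      shift-up with u Finₚ.≟ u
      ... | yes _ = refl
      ... | no q = contradiction refl q

      shift-down : d ≢ u → shift a u d d ≡ a d ℕ.∸ 1
      shift-down d≢u with d Finₚ.≟ u
      ... | yes q = contradiction q d≢u
      ... | no _ with d Finₚ.≟ d
      ...   | yes _ = refl
      ...   | no q = contradiction refl q

      shift-other : ∀ l → l ≢ u → l ≢ d → shift a u d l ≡ a l
      shift-other l l≢u l≢d with l Finₚ.≟ u
      ... | yes q = contradiction q l≢u
      ... | no _ with l Finₚ.≟ d
      ...   | yes q = contradiction q l≢d
      ...   | no _ = refl

    log-concavity : ∀ {m} (p : Fin (suc m) → Fin n) (a : Fin m → ℕ) (u d : Fin m) → toℕ d ≡ suc (toℕ u) → 0 ℕ.< a u → 0 ℕ.< a d →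
      count P p (shift a u d) ℕ.* count P p (shift a d u) ℕ.≤ count P p a ℕ.* count P p a
    log-concavity {m} p a u d e au ad = go (a u) (a d) refl refl au ad
      where
      d≢u : d ≢ u
      d≢u refl = ℕₚ.<⇒≢ (ℕₚ.n<1+n (toℕ u)) e
      go : ∀ α β → a u ≡ α → a d ≡ β → 0 ℕ.< α → 0 ℕ.< β →
        count P p (shift a u d) ℕ.* count P p (shift a d u) ℕ.≤ count P p a ℕ.* count P p a
      go (suc A) (suc B) eu ed _ _ with template-split m p a u d e
      ... | pre , x , post , split = cases (List.length (template m p a) ℕₚ.≤? n)
        where
        shape : ℕ → ℕ → List Slot
        shape s t = pre ++ any (s ℕ.+ A) ++ just x ∷ any (t ℕ.+ B) ++ post
        b₊ b₋ : Fin m → ℕ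
        b₊ = shift a u d
        b₋ = shift a d u
        form₀ : template m p a ≡ shape 1 1
        form₀ = trans (split a λ _ _ _ → refl) (cong₂ (λ s t → pre ++ any s ++ just x ∷ any t ++ post) eu ed)
        form₊ : template m p b₊ ≡ shape 2 0
        form₊ = trans (split b₊ (shift-other a u d)) (cong₂ (λ s t → pre ++ any s ++ just x ∷ any t ++ post)
          (trans (shift-up a u d) (cong suc eu)) (trans (shift-down a u d d≢u) (cong (ℕ._∸ 1) ed)))
        form₋ : template m p b₋ ≡ shape 0 2
        form₋ = trans (split b₋ λ l l≢u l≢d → shift-other a d u l l≢d l≢u) (cong₂ (λ s t → pre ++ any s ++ just x ∷ any t ++ post)
          (trans (shift-down a d u (d≢u ∘ sym)) (cong (ℕ._∸ 1) eu)) (trans (shift-up a d u) (cong suc ed)))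
        len : ∀ {b s t} → template m p b ≡ shape s t → s ℕ.+ A ℕ.+ (t ℕ.+ B) ≡ suc A ℕ.+ suc B → List.length (template m p b) ≡ List.length (template m p a)
        len {b} {s} {t} f q = trans (cong List.length f) (trans (length-split pre (s ℕ.+ A) x (t ℕ.+ B) post)
          (trans (cong (λ k → List.length pre ℕ.+ suc (k ℕ.+ List.length post)) q)
            (sym (trans (cong List.length form₀) (length-split pre (suc A) x (suc B) post)))))
        len₊ : List.length (template m p b₊) ≡ List.length (template m p a)
        len₊ = len {b₊} {2} {0} form₊ (cong suc (sym (ℕₚ.+-suc A B)))
        len₋ : List.length (template m p b₋) ≡ List.length (template m p a)
        len₋ = len {b₋} {0} {2} form₋ (ℕₚ.+-suc A (suc B))
        cases : Dec (List.length (template m p a) ℕ.≤ n) →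
          count P p b₊ ℕ.* count P p b₋ ℕ.≤ count P p a ℕ.* count P p a
        -- The three patterns have equal length. If it exceeds n, no word matches, and the left side
        -- is zero.
        cases (no ¬le) = subst (λ z → z ℕ.* count P p b₋ ℕ.≤ count P p a ℕ.* count P p a)
          (sym (count-overflow p b₊ (subst (n ℕ.<_) (sym len₊) (ℕₚ.≰⇒> ¬le)))) ℕ.z≤n
        cases (yes le) = ℤₚ.drop‿+≤+ (subst₂ _≤_
            (trans (cong₂ _*_ (sym (value {b₊} {2} {0} form₊ len₊)) (sym (value {b₋} {0} {2} form₋ len₋))) (sym (ℤₚ.pos-* (count P p b₊) (count P p b₋))))
            (trans (cong₂ _*_ (sym (value {a} {1} {1} form₀ refl)) (sym (value {a} {1} {1} form₀ refl))) (sym (ℤₚ.pos-* (count P p a) (count P p a))))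
            (Move.log-concave (pre ++ any A) x (any B ++ post ++ any r) start))
          where
          r : ℕ
          r = n ℕ.∸ List.length (template m p a)
          value : ∀ {b s t} → template m p b ≡ shape s t → List.length (template m p b) ≡ List.length (template m p a) →
            + count P p b ≡ run ((pre ++ any A) ++ any s ++ just x ∷ any t ++ (any B ++ post ++ any r)) start
          value {b} {s} {t} f l = trans (count-run p b (subst (ℕ._≤ n) (sym l) le))
            (cong (λ τ → run τ start) (trans (cong₂ (λ τ k → τ ++ any (n ℕ.∸ k)) f l) (regroup pre A s x t B post r)))

open import Defs
open import Data.Nat using (ℕ; suc; _*_; _≤_; _<_)
open import Data.Nat.Properties using (<⇒≤)
open import Data.Fin using (Fin; toℕ)
open import Data.Product using (∃)
open import Data.Rational using (ℚ) renaming (_≤_ to _≤ℚ_)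
open import Relation.Binary.PropositionalEquality using (_≡_)

theorem3p7 : ∀ {n m} (P : FinPoset n) (p : Fin (suc m) → Fin n) (lam : Fin (suc m) → ℚ)
    → (∀ s t → p s ≡ p t → s ≡ t)
    → (∀ x → IsMinimal P x → ∃ λ t → p t ≡ x)
    → (∀ x → IsMaximal P x → ∃ λ t → p t ≡ x)
    → (∀ s t → _≤P_ P (p s) (p t) → lam s ≤ℚ lam t)
    → (∀ s t → toℕ s ≤ toℕ t → lam t ≤ℚ lam s)
    → (∀ s t → _<P_ P (p t) (p s) → toℕ s < toℕ t)
    → (a : Fin m → ℕ) (u d : Fin m)
    → toℕ d ≡ suc (toℕ u)
    → 1 < a u → 1 < a d
    → N P p (shift a u d) * N P p (shift a d u) ≤ N P p a * N P p a
theorem3p7 P p _ _ _ _ _ _ _ a u d d≡1+u 1<au 1<ad =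
  LinearExtensionForms.Extensions.log-concavity P p a u d d≡1+u (<⇒≤ 1<au) (<⇒≤ 1<ad)
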